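{- There is a universal constant $C$ such that the following holds. For every instance of the Multistage Spanning set Maintenance (MSM) problem with matroid $\mathcal{M}$ of rank $r$ and $T$ time steps, with $rT\ge 2$, and every feasible solution $(y,z)$ of the linear program (LP) given in the context, there is a randomized polynomial-time procedure that, from $(y,z)$, produces a feasible MSM solution $\{S_t\}_{t\in[T]}$ whose expected cost satisfies $$\mathbb{E}\Big[\sum_{t=1}^T\big(c_t(S_t)+a(S_t\setminus S_{t-1})\big)\Big]\le C\log(rT)\cdot\Big(\sum_{t,e}a(e)\,y_t(e)+\sum_{t,e}c_t(e)\,z_t(e)\Big).$$
   Context: An instance consists of a matroid $\mathcal{M}=(E,\mathcal{I})$ on a finite set, acquisition costs $a(e)\ge0$ for $e\in E$, and holding costs $c_t(e)\in[0,\infty]$ for $t\in[T]=\{1,\dots,T\}$, $e\in E$ (convention $0\cdot\infty=0$). For a set $S$, $a(S)=\sum_{e\in S}a(e)$ and $c_t(S)=\sum_{e\in S}c_t(e)$. An MSM solution is a sequence of spanning sets $S_t\subseteq E$ ($\mathrm{rank}(S_t)=\mathrm{rank}(E)$), $t\in[T]$; its cost is $\sum_{t}(c_t(S_t)+a(S_t\setminus S_{t-1}))$ with $S_0:=\emptyset$. The base polytope is $\mathcal{P}_B(\mathcal{M})=\{x\in\mathbb{R}^{E}_{\ge0}: x(S)\le\mathrm{rank}(S)\ \forall S\subseteq E,\ x(E)=\mathrm{rank}(E)\}$. The linear program is: minimize $\sum_{t,e}a(e)y_t(e)+\sum_{t,e}c_t(e)z_t(e)$ subject to $z_t\in\mathcal{P}_B(\mathcal{M})$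 for all $t\in[T]$; $y_t(e)\ge z_t(e)-z_{t-1}(e)$ for all $t\in[T]$, $e\in E$ (with $z_0:=0$); and $y_t(e),z_t(e)\ge0$. -}

module Defs where

open import Algebra.Bundles using (RawMonoid)
import Algebra.Definitions.RawMonoid as RawMonoidDefs
open import Algebra.Structures using (IsCommutativeRing)
open import Data.Bool.Base using (Bool; true; false; if_then_else_)
open import Data.Fin.Base using (Fin; zero; suc; inject₁)
import Data.Fin.Properties as Fin
open import Data.Fin.Subset
  using (Subset; Side; inside; outside; _∈_; _∉_; _⊆_; _∪_; _─_; ⁅_⁆; ⋃; ∣_∣)
  renaming (⊥ to ∅; ⊤ to full)
open import Data.Fin.Subset.Properties using (_⊆?_)
open import Data.List.Base as List using (List; []; _∷_; _++_; length)
open import Data.List.Extrema.Nat using (max)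
import Data.List.Membership.Propositional as List
open import Data.List.Relation.Unary.All as All using (All; []; _∷_)
open import Data.Integer.Base as ℤ using (+_)
import Data.Integer.Properties as ℤ
open import Data.Nat.Base as ℕ using (ℕ; zero; suc; z≤n; s≤s)
import Data.Nat.GCD as ℕ
open import Data.Nat.Induction using (<-rec)
open import Data.Nat.Logarithm
import Data.Nat.Properties as ℕ
open import Data.Product.Base using (_×_; _,_; ∃-syntax; proj₁; proj₂)
open import Data.Rational as ℚ using (ℚ; mkℚ; ↥_; ↧_; ↧ₙ_; 0ℚ; 1ℚ)
import Data.Rational.Properties as ℚ
open import Data.Sum.Base using (_⊎_; inj₁; inj₂)
open import Data.Unit.Base using (⊤; tt)
open import Data.Vec.Base as Vec using ([]; _∷_)
open import Relation.Binary.Core using (Rel)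
import Relation.Binary.Construct.Add.Supremum.NonStrict as AddSupremum
open import Relation.Binary.PropositionalEquality
  using (_≡_; _≢_; refl; sym; trans; cong; cong₂; subst)
open import Relation.Binary.Structures using (IsDecTotalOrder)
open import Relation.Nullary.Construct.Add.Supremum using (_⁺; ⊤⁺; [_])
open import Relation.Nullary.Decidable using (Dec; does; _×-dec_)
open import Relation.Nullary.Negation using (contradiction)
open import Level using (0ℓ)

------------------------------------------------------------------------
-- Scalars

-- The standard library has no real numbers; costs and LP solutions take
-- values in an arbitrary ordered field with decidable order.
record OrderedField : Set₁ where
  infix  8 -_ _⁻¹
  infixl 7 _*_
  infixl 6 _+_ _-_
  infix  4 _≤_ _<_
  field
    Carrier           : Set
    _+_ _*_           : Carrier → Carrier → Carrier
    -_ _⁻¹            : Carrier → Carrier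
    0# 1#             : Carrier
    _≤_               : Rel Carrier 0ℓ
    isCommutativeRing : IsCommutativeRing _≡_ _+_ _*_ -_ 0# 1#
    isDecTotalOrder   : IsDecTotalOrder _≡_ _≤_
    0≢1               : 0# ≢ 1#
    -- The value of 0# ⁻¹ is unspecified.
    *-inverseʳ        : ∀ x → x ≢ 0# → x * x ⁻¹ ≡ 1#
    +-monoˡ-≤         : ∀ z {x y} → x ≤ y → x + z ≤ y + z
    *-nonNeg          : ∀ {x y} → 0# ≤ x → 0# ≤ y → 0# ≤ x * y

  open IsDecTotalOrder isDecTotalOrder public using (_≟_; _≤?_)

  _-_ : Carrier → Carrier → Carrier
  x - y = x + (- y)

  _<_ : Rel Carrier 0ℓ
  x < y = x ≤ y × x ≢ y

  +-rawMonoid : RawMonoid 0ℓ 0ℓ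
  +-rawMonoid = record { Carrier = Carrier ; _≈_ = _≡_ ; _∙_ = _+_ ; ε = 0# }

  open RawMonoidDefs +-rawMonoid public using (sum) renaming (_×_ to _×#_)

  fromℕ : ℕ → Carrier
  fromℕ n = n ×# 1#

  -- Truncation to [0,1].
  clip : Carrier → Carrier
  clip x = if does (x ≤? 0#) then 0# else (if does (1# ≤? x) then 1# else x)

-- The length of the representation of a scalar, up to an additive constant.
-- With ℚ-height below, running time is bit complexity up to a polynomial; the
-- constant 0 is a height on every field and gives unit-cost (real RAM) time.
record Height (F : OrderedField) : Set where
  open OrderedField F
  field
    height   : Carrier → ℕ
    height-0 : height 0# ≡ 0
    height-1 : height 1# ≡ 0
    height-+ : ∀ x y → height (x + y) ℕ.≤ suc (height x ℕ.+ height y)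
    height-* : ∀ x y → height (x * y) ℕ.≤ height x ℕ.+ height y
    height-neg : ∀ x → height (- x) ℕ.≤ height x
    height-inv : ∀ x → height (x ⁻¹) ℕ.≤ height x

------------------------------------------------------------------------
-- Rationals, with the logarithm of the larger of ∣numerator∣ and denominator

n≤2^⌈log₂n⌉ : ∀ n → n ℕ.≤ 2 ℕ.^ ⌈log₂ n ⌉
n≤2^⌈log₂n⌉ = <-rec _ go
  where
  open ℕ.≤-Reasoning
  go : ∀ n → (∀ {m} → m ℕ.< n → m ℕ.≤ 2 ℕ.^ ⌈log₂ m ⌉) → n ℕ.≤ 2 ℕ.^ ⌈log₂ n ⌉
  go zero          _  = z≤n
  go (suc zero)    _  = ℕ.≤-refl
  go n@(suc (suc m)) ih = begin
    n                             ≡⟨ ℕ.⌊n/2⌋+⌈n/2⌉≡n n ⟨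
    ℕ.⌊ n /2⌋ ℕ.+ h               ≤⟨ ℕ.+-mono-≤ (ℕ.⌊n/2⌋≤⌈n/2⌉ n) (ℕ.m≤m+n h 0) ⟩
    2 ℕ.* h                       ≤⟨ ℕ.*-monoʳ-≤ 2 (ih (ℕ.⌈n/2⌉<n m)) ⟩
    2 ℕ.^ suc ⌈log₂ h ⌉           ≡⟨ cong (λ k → 2 ℕ.^ suc k) (⌈log₂⌈n/2⌉⌉≡⌈log₂n⌉∸1 n) ⟩
    2 ℕ.^ suc (⌈log₂ n ⌉ ℕ.∸ 1)   ≡⟨ cong (2 ℕ.^_) (ℕ.m+[n∸m]≡n {1} (⌈log₂⌉-mono-≤ {2} {n} (s≤s (s≤s z≤n)))) ⟩
    2 ℕ.^ ⌈log₂ n ⌉               ∎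
    where h = ℕ.⌈ n /2⌉

⌈log₂⌉-bound : ∀ m n k → k ℕ.≤ m ℕ.* n → ⌈log₂ k ⌉ ℕ.≤ ⌈log₂ m ⌉ ℕ.+ ⌈log₂ n ⌉
⌈log₂⌉-bound m n k k≤mn = begin
  ⌈log₂ k ⌉ ≤⟨ ⌈log₂⌉-mono-≤ (ℕ.≤-trans k≤mn (ℕ.*-mono-≤ (n≤2^⌈log₂n⌉ m) (n≤2^⌈log₂n⌉ n))) ⟩
  ⌈log₂ (2 ℕ.^ ⌈log₂ m ⌉ ℕ.* 2 ℕ.^ ⌈log₂ n ⌉) ⌉ ≡⟨ cong ⌈log₂_⌉ (ℕ.^-distribˡ-+-* 2 ⌈log₂ m ⌉ ⌈log₂ n ⌉) ⟨
  ⌈log₂ (2 ℕ.^ (⌈log₂ m ⌉ ℕ.+ ⌈log₂ n ⌉)) ⌉ ≡⟨ ⌈log₂2^n⌉≡n _ ⟩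
  ⌈log₂ m ⌉ ℕ.+ ⌈log₂ n ⌉ ∎
  where open ℕ.≤-Reasoning

ℚ-inv : ℚ → ℚ
ℚ-inv (mkℚ (+ zero) d c)   = 0ℚ
ℚ-inv p@(mkℚ ℤ.+[1+ _ ] d c) = ℚ.1/ p
ℚ-inv p@(mkℚ ℤ.-[1+ _ ] d c) = ℚ.1/ p

ℚ-inverse : ∀ p → p ≢ 0ℚ → p ℚ.* ℚ-inv p ≡ 1ℚ
ℚ-inverse p@(mkℚ (+ zero) d c) p≢0 = contradiction (ℚ.↥p≡0⇒p≡0 p refl) p≢0
ℚ-inverse p@(mkℚ ℤ.+[1+ _ ] d c) _ = ℚ.*-inverseʳ p
ℚ-inverse p@(mkℚ ℤ.-[1+ _ ] d c) _ = ℚ.*-inverseʳ p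

ℚ-orderedField : OrderedField
ℚ-orderedField = record
  { _+_ = ℚ._+_ ; _*_ = ℚ._*_ ; -_ = ℚ.-_ ; _⁻¹ = ℚ-inv
  ; 0# = 0ℚ ; 1# = 1ℚ ; _≤_ = ℚ._≤_
  ; isCommutativeRing = ℚ.+-*-isCommutativeRing
  ; isDecTotalOrder   = ℚ.≤-isDecTotalOrder
  ; 0≢1         = λ ()
  ; *-inverseʳ  = ℚ-inverse
  ; +-monoˡ-≤   = ℚ.+-monoˡ-≤
  ; *-nonNeg    = λ {x} {y} 0≤x 0≤y →
      subst (ℚ._≤ (x ℚ.* y)) (ℚ.*-zeroʳ x)
        (ℚ.*-monoˡ-≤-nonNeg x {{ℚ.nonNegative 0≤x}} 0≤y)
  }

mag : ℚ → ℕ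
mag p = ℤ.∣ ↥ p ∣ ℕ.⊔ ↧ₙ p

mag-/ : ∀ i n .{{_ : ℕ.NonZero n}} → mag (i ℚ./ n) ℕ.≤ ℤ.∣ i ∣ ℕ.⊔ n
mag-/ i n = ℕ.⊔-mono-≤ (fac _ g ℤ.∣ i ∣ numer) (fac _ g n denom)
  where
  instance _ = ℕ.≢-nonZero (ℕ.gcd[m,n]≢0 ℤ.∣ i ∣ n (inj₂ (ℕ.≢-nonZero⁻¹ n)))
  g = ℕ.gcd ℤ.∣ i ∣ n
  fac : ∀ a g b .{{_ : ℕ.NonZero g}} → a ℕ.* g ≡ b → a ℕ.≤ b
  fac a g b eq = ℕ.≤-trans (ℕ.m≤m*n a g) (ℕ.≤-reflexive eq)
  numer : ℤ.∣ ↥ (i ℚ./ n) ∣ ℕ.* g ≡ ℤ.∣ i ∣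
  numer = trans (sym (ℤ.abs-* (↥ (i ℚ./ n)) (+ g))) (cong ℤ.∣_∣ (ℚ.↥-/ i n))
  denom : ↧ₙ (i ℚ./ n) ℕ.* g ≡ n
  denom = trans (sym (ℤ.abs-* (↧ (i ℚ./ n)) (+ g))) (cong ℤ.∣_∣ (ℚ.↧-/ i n))

mag-* : ∀ p q → mag (p ℚ.* q) ℕ.≤ mag p ℕ.* mag q
mag-* p@record{} q@record{} = ℕ.≤-trans (mag-/ (↥ p ℤ.* ↥ q) (↧ₙ p ℕ.* ↧ₙ q))
  (ℕ.⊔-lub
    (ℕ.≤-trans (ℕ.≤-reflexive (ℤ.abs-* (↥ p) (↥ q)))
               (ℕ.*-mono-≤ (ℕ.m≤m⊔n ℤ.∣ ↥ p ∣ _) (ℕ.m≤m⊔n ℤ.∣ ↥ q ∣ _)))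
    (ℕ.*-mono-≤ (ℕ.m≤n⊔m ℤ.∣ ↥ p ∣ _) (ℕ.m≤n⊔m ℤ.∣ ↥ q ∣ _)))

mag-+ : ∀ p q → mag (p ℚ.+ q) ℕ.≤ 2 ℕ.* (mag p ℕ.* mag q)
mag-+ p@record{} q@record{} = ℕ.≤-trans (mag-/ (↥ p ℤ.* ↧ q ℤ.+ ↥ q ℤ.* ↧ p) (↧ₙ p ℕ.* ↧ₙ q))
  (ℕ.⊔-lub
    (begin
      ℤ.∣ ↥ p ℤ.* ↧ q ℤ.+ ↥ q ℤ.* ↧ p ∣             ≤⟨ ℤ.∣i+j∣≤∣i∣+∣j∣ (↥ p ℤ.* ↧ q) (↥ q ℤ.* ↧ p) ⟩
      ℤ.∣ ↥ p ℤ.* ↧ q ∣ ℕ.+ ℤ.∣ ↥ q ℤ.* ↧ p ∣         ≡⟨ cong₂ ℕ._+_ (ℤ.abs-* (↥ p) (↧ q)) (trans (ℤ.abs-* (↥ q) (↧ p)) (ℕ.*-comm ℤ.∣ ↥ q ∣ (↧ₙ p))) ⟩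
      ℤ.∣ ↥ p ∣ ℕ.* ↧ₙ q ℕ.+ ↧ₙ p ℕ.* ℤ.∣ ↥ q ∣       ≤⟨ ℕ.+-mono-≤ (ℕ.*-mono-≤ (ℕ.m≤m⊔n ℤ.∣ ↥ p ∣ _) (ℕ.m≤n⊔m ℤ.∣ ↥ q ∣ _)) (ℕ.*-mono-≤ (ℕ.m≤n⊔m ℤ.∣ ↥ p ∣ _) (ℕ.m≤m⊔n ℤ.∣ ↥ q ∣ _)) ⟩
      mag p ℕ.* mag q ℕ.+ mag p ℕ.* mag q         ≡⟨ cong (mag p ℕ.* mag q ℕ.+_) (ℕ.+-identityʳ _) ⟨
      2 ℕ.* (mag p ℕ.* mag q)                     ∎)
    (ℕ.≤-trans (ℕ.*-mono-≤ (ℕ.m≤n⊔m ℤ.∣ ↥ p ∣ _) (ℕ.m≤n⊔m ℤ.∣ ↥ q ∣ _)) (ℕ.m≤m+n _ _)))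
  where open ℕ.≤-Reasoning

ℚ-height : Height ℚ-orderedField
ℚ-height = record
  { height     = λ p → ⌈log₂ mag p ⌉
  ; height-0   = refl
  ; height-1   = refl
  ; height-+   = λ p q → ℕ.≤-trans (⌈log₂⌉-bound 2 (mag p ℕ.* mag q) _ (mag-+ p q))
                   (s≤s (⌈log₂⌉-bound (mag p) (mag q) _ ℕ.≤-refl))
  ; height-*   = λ p q → ⌈log₂⌉-bound (mag p) (mag q) _ (mag-* p q)
  ; height-neg = λ p → ⌈log₂⌉-mono-≤ (ℕ.≤-reflexive (cong₂ ℕ._⊔_
                   (trans (cong ℤ.∣_∣ (ℚ.↥-neg p)) (ℤ.∣-i∣≡∣i∣ (↥ p))) (cong ℤ.∣_∣ (ℚ.↧-neg p))))
  ; height-inv = λ p → ⌈log₂⌉-mono-≤ (mag-inv p)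
  }
  where
  mag-inv : ∀ p → mag (ℚ-inv p) ℕ.≤ mag p
  mag-inv (mkℚ (+ zero) d c)     = s≤s z≤n
  mag-inv (mkℚ ℤ.+[1+ n ] d c) = ℕ.≤-reflexive (ℕ.⊔-comm (suc d) (suc n))
  mag-inv (mkℚ ℤ.-[1+ n ] d c) = ℕ.≤-reflexive (ℕ.⊔-comm (suc d) (suc n))

------------------------------------------------------------------------
-- Scalars extended by ∞

module Extended (F : OrderedField) where
  open OrderedField F
  open AddSupremum _≤_ public using (_≤⁺_)

  infixl 6 _+⁺_
  infixr 7 _·⁺_

  Carrier⁺ : Set
  Carrier⁺ = Carrier ⁺

  _+⁺_ : Carrier⁺ → Carrier⁺ → Carrier⁺
  [ x ] +⁺ [ y ] = [ x + y ]
  [ _ ] +⁺ ⊤⁺    = ⊤⁺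
  ⊤⁺    +⁺ _     = ⊤⁺

  -- Only ever used with a nonnegative left factor; 0 · ∞ = 0.
  _·⁺_ : Carrier → Carrier⁺ → Carrier⁺
  x ·⁺ [ y ] = [ x * y ]
  x ·⁺ ⊤⁺    = if does (x ≟ 0#) then [ 0# ] else ⊤⁺

  +⁺-rawMonoid : RawMonoid 0ℓ 0ℓ
  +⁺-rawMonoid = record { Carrier = Carrier⁺ ; _≈_ = _≡_ ; _∙_ = _+⁺_ ; ε = [ 0# ] }

  open RawMonoidDefs +⁺-rawMonoid public using () renaming (sum to sum⁺)

  -- X ≤ K · log₂ N · Y, for K ≥ 0, N ≥ 1 and Y ≥ 0: the real number log₂ N is
  -- the infimum of the fractions p / q with N ^ q ≤ 2 ^ p.
  _≤_·log₂_·_ : Carrier⁺ → ℕ → ℕ → Carrier⁺ → Set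
  X ≤ K ·log₂ N · Y =
    ∀ p q → 1 ℕ.≤ q → N ℕ.^ q ℕ.≤ 2 ℕ.^ p →
    fromℕ q ·⁺ X ≤⁺ fromℕ (K ℕ.* p) ·⁺ Y

------------------------------------------------------------------------
-- Matroids

record Matroid (n : ℕ) : Set₁ where
  field
    Independent  : Subset n → Set
    independent? : ∀ I → Dec (Independent I)
    ∅-indep      : Independent ∅
    hereditary   : ∀ {I J} → I ⊆ J → Independent J → Independent I
    augmentation : ∀ {I J} → Independent I → Independent J → ∣ I ∣ ℕ.< ∣ J ∣ →
                   ∃[ e ] (e ∈ J × e ∉ I × Independent (I ∪ ⁅ e ⁆))

subsets : ∀ n → List (Subset n)
subsets zero    = [] ∷ []
subsets (suc n) = List.map (inside ∷_) (subsets n) ++ List.map (outside ∷_) (subsets n)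

module _ {n : ℕ} (M : Matroid n) where
  open Matroid M

  rank : Subset n → ℕ
  rank S = max 0 (List.map ∣_∣
    (List.filter (λ I → (I ⊆? S) ×-dec independent? I) (subsets n)))

  Spanning : Subset n → Set
  Spanning S = rank S ≡ rank full

------------------------------------------------------------------------
-- Multistage spanning set maintenance and its linear program

-- previous x₀ x t is the entry before x t, with x₀ before the first.
previous : ∀ {A : Set} {T} → A → (Fin T → A) → Fin T → A
previous x₀ x zero    = x₀
previous x₀ x (suc t) = x (inject₁ t)

module Problem (F : OrderedField) where
  open OrderedField F
  open Extended F

  record Instance (n T : ℕ) : Set₁ where
    field
      matroid  : Matroid n
      a        : Fin n → Carrier
      c        : Fin T → Fin n → Carrier⁺
      a-nonNeg : ∀ e → 0# ≤ a e
      c-nonNeg : ∀ t e → [ 0# ] ≤⁺ c t e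

  sumOver : ∀ {n} → (Fin n → Carrier) → Subset n → Carrier
  sumOver x S = sum (λ e → if Vec.lookup S e then x e else 0#)

  sumOver⁺ : ∀ {n} → (Fin n → Carrier⁺) → Subset n → Carrier⁺
  sumOver⁺ x S = sum⁺ (λ e → if Vec.lookup S e then x e else [ 0# ])

  record BasePolytope {n} (M : Matroid n) (x : Fin n → Carrier) : Set where
    field
      nonNeg : ∀ e → 0# ≤ x e
      rank-≤ : ∀ S → sumOver x S ≤ fromℕ (rank M S)
      rank-≡ : sumOver x full ≡ fromℕ (rank M full)

  module _ {n T} (I : Instance n T) where
    open Instance I

    cost : (Fin T → Subset n) → Carrier⁺
    cost S = sum⁺ λ t → sumOver⁺ (c t) (S t) +⁺ [ sumOver a (S t ─ previous ∅ S t) ]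

    record LPFeasible (y z : Fin T → Fin n → Carrier) : Set where
      field
        z-base   : ∀ t → BasePolytope matroid (z t)
        y-change : ∀ t e → z t e - previous (λ _ → 0#) z t e ≤ y t e
        y-nonNeg : ∀ t e → 0# ≤ y t e
        z-nonNeg : ∀ t e → 0# ≤ z t e

    lpCost : (y z : Fin T → Fin n → Carrier) → Carrier⁺
    lpCost y z = [ sum (λ t → sum λ e → a e * y t e) ]
              +⁺ sum⁺ (λ t → sum⁺ λ e → z t e ·⁺ c t e)

------------------------------------------------------------------------
-- Randomized programs

-- A first-order call-by-value language over immutable lists, executed on a
-- pointer machine with access to random bits and to an independence oracle.
-- Iteration is over lists, so every program terminates.  Programs
-- are syntax, independent of the ground set, the field and the matroid.

infixr 6 _⊗_
infixr 5 _⊕_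

data Ty : Set where
  elt num 𝟙 : Ty
  _⊗_ _⊕_   : Ty → Ty → Ty
  list      : Ty → Ty

bool : Ty
bool = 𝟙 ⊕ 𝟙

data Term (Γ : List Ty) : Ty → Set where
  var        : ∀ {τ} → τ List.∈ Γ → Term Γ τ
  let′       : ∀ {σ τ} → Term Γ σ → Term (σ ∷ Γ) τ → Term Γ τ
  unit       : Term Γ 𝟙
  pair       : ∀ {σ τ} → Term Γ σ → Term Γ τ → Term Γ (σ ⊗ τ)
  fst        : ∀ {σ τ} → Term Γ (σ ⊗ τ) → Term Γ σ
  snd        : ∀ {σ τ} → Term Γ (σ ⊗ τ) → Term Γ τ
  inl        : ∀ {σ τ} → Term Γ σ → Term Γ (σ ⊕ τ)
  inr        : ∀ {σ τ} → Term Γ τ → Term Γ (σ ⊕ τ)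
  case       : ∀ {ρ σ τ} → Term Γ (ρ ⊕ σ) →
               Term (ρ ∷ Γ) τ → Term (σ ∷ Γ) τ → Term Γ τ
  nil        : ∀ {τ} → Term Γ (list τ)
  cons       : ∀ {τ} → Term Γ τ → Term Γ (list τ) → Term Γ (list τ)
  uncons     : ∀ {τ} → Term Γ (list τ) → Term Γ (𝟙 ⊕ (τ ⊗ list τ))
  -- In the body, variable 0 is the list entry and variable 1 the accumulator.
  fold       : ∀ {σ τ} → Term Γ (list σ) → Term Γ τ → Term (σ ∷ τ ∷ Γ) τ → Term Γ τ
  zero# one# : Term Γ num
  add mul    : Term Γ num → Term Γ num → Term Γ num
  neg inv    : Term Γ num → Term Γ num
  leq        : Term Γ num → Term Γ num → Term Γ bool
  same       : Term Γ elt → Term Γ elt → Term Γ bool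
  -- Oracle call: is the set of the listed elements independent?
  indep      : Term Γ (list elt) → Term Γ bool
  -- A fresh coin coming up true with probability the argument, clipped to [0,1].
  flip       : Term Γ num → Term Γ bool

module Semantics {F : OrderedField} (H : Height F) {n : ℕ} (M : Matroid n) where
  open OrderedField F
  open Extended F
  open Height H
  open Matroid M

  Val : Ty → Set
  Val elt      = Fin n
  Val num      = Carrier
  Val 𝟙        = ⊤
  Val (σ ⊗ τ)  = Val σ × Val τ
  Val (σ ⊕ τ)  = Val σ ⊎ Val τ
  Val (list τ) = List (Val τ)

  size : ∀ τ → Val τ → ℕ
  size elt      _        = 1
  size num      x        = suc (height x)
  size 𝟙        _        = 1
  size (σ ⊗ τ)  (u , v)  = suc (size σ u ℕ.+ size τ v)
  size (σ ⊕ τ)  (inj₁ u) = suc (size σ u)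
  size (σ ⊕ τ)  (inj₂ v) = suc (size τ v)
  size (list τ) vs       = List.foldr (λ v s → suc (size τ v ℕ.+ s)) 1 vs

  -- The outcomes of a run: probability, elapsed time, result.
  Run : Set → Set
  Run A = List (Carrier × ℕ × A)

  infixl 1 _>>=_
  infixr 0 _⟫_

  return : ∀ {A} → A → Run A
  return v = (1# , 0 , v) ∷ []

  _>>=_ : ∀ {A B} → Run A → (A → Run B) → Run B
  m >>= k = List.concatMap
    (λ (p , s , u) → List.map (λ (q , t , v) → p * q , s ℕ.+ t , v) (k u)) m

  _⟫_ : ∀ {A} → ℕ → Run A → Run A
  s ⟫ m = List.map (λ (p , t , v) → p , s ℕ.+ t , v) m

  toVal : Bool → Val bool
  toVal true  = inj₁ tt
  toVal false = inj₂ tt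

  toSet : List (Fin n) → Subset n
  toSet es = ⋃ (List.map ⁅_⁆ es)

  foldM : ∀ {A B : Set} → (A → B → Run B) → B → List A → Run B
  foldM f b []       = return b
  foldM f b (x ∷ xs) = foldM f b xs >>= λ b′ → 1 ⟫ f x b′

  bernoulli : Carrier → Run (Val bool)
  bernoulli p = (clip p , 0 , inj₁ tt) ∷ (1# - clip p , 0 , inj₂ tt) ∷ []

  Env : List Ty → Set
  Env = All Val

  eval : ∀ {Γ τ} → Term Γ τ → Env Γ → Run (Val τ)
  eval (var i)      ρ = 1 ⟫ return (All.lookup ρ i)
  eval (let′ s t)   ρ = eval s ρ >>= λ u → 1 ⟫ eval t (u ∷ ρ)
  eval unit         ρ = 1 ⟫ return tt
  eval (pair s t)   ρ = eval s ρ >>= λ u → eval t ρ >>= λ v → 1 ⟫ return (u , v)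
  eval (fst t)      ρ = eval t ρ >>= λ v → 1 ⟫ return (proj₁ v)
  eval (snd t)      ρ = eval t ρ >>= λ v → 1 ⟫ return (proj₂ v)
  eval (inl t)      ρ = eval t ρ >>= λ v → 1 ⟫ return (inj₁ v)
  eval (inr t)      ρ = eval t ρ >>= λ v → 1 ⟫ return (inj₂ v)
  eval (case r s t) ρ = eval r ρ >>= λ where
    (inj₁ u) → 1 ⟫ eval s (u ∷ ρ)
    (inj₂ v) → 1 ⟫ eval t (v ∷ ρ)
  eval nil          ρ = 1 ⟫ return []
  eval (cons s t)   ρ = eval s ρ >>= λ u → eval t ρ >>= λ vs → 1 ⟫ return (u ∷ vs)
  eval (uncons t)   ρ = eval t ρ >>= λ where
    []       → 1 ⟫ return (inj₁ tt)
    (v ∷ vs) → 1 ⟫ return (inj₂ (v , vs))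
  eval (fold r s t) ρ = eval r ρ >>= λ xs → eval s ρ >>= λ b →
    1 ⟫ foldM (λ x b′ → eval t (x ∷ b′ ∷ ρ)) b xs
  eval zero#        ρ = 1 ⟫ return 0#
  eval one#         ρ = 1 ⟫ return 1#
  eval (add s t)    ρ = eval s ρ >>= λ x → eval t ρ >>= λ y →
    suc (height x ℕ.+ height y) ⟫ return (x + y)
  eval (mul s t)    ρ = eval s ρ >>= λ x → eval t ρ >>= λ y →
    suc (height x ℕ.+ height y) ⟫ return (x * y)
  eval (neg t)      ρ = eval t ρ >>= λ x → suc (height x) ⟫ return (- x)
  eval (inv t)      ρ = eval t ρ >>= λ x → suc (height x) ⟫ return (x ⁻¹)
  eval (leq s t)    ρ = eval s ρ >>= λ x → eval t ρ >>= λ y →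
    suc (height x ℕ.+ height y) ⟫ return (toVal (does (x ≤? y)))
  eval (same s t)   ρ = eval s ρ >>= λ d → eval t ρ >>= λ e →
    1 ⟫ return (toVal (does (d Fin.≟ e)))
  eval (indep t)    ρ = eval t ρ >>= λ es →
    suc (length es) ⟫ return (toVal (does (independent? (toSet es))))
  eval (flip t)     ρ = eval t ρ >>= λ x → suc (height x) ⟫ bernoulli x

  expectation : ∀ {A} → (A → Carrier⁺) → Run A → Carrier⁺
  expectation f m = List.foldr (λ (p , _ , v) s → p ·⁺ f v +⁺ s) [ 0# ] m

------------------------------------------------------------------------
-- Rounding procedures

cost∞ : Ty
cost∞ = 𝟙 ⊕ num

-- All elements e with a(e); then for each time t and each element e the
-- entries e, c_t(e), y_t(e), z_t(e).
InputTy : Ty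
InputTy = list (elt ⊗ num) ⊗ list (list (elt ⊗ cost∞ ⊗ num ⊗ num))

OutputTy : Ty
OutputTy = list (list elt)

Procedure : Set
Procedure = Term (InputTy ∷ []) OutputTy

module Rounding {F : OrderedField} (H : Height F) {n T : ℕ}
                (I : Problem.Instance F n T)
                (y z : Fin T → Fin n → OrderedField.Carrier F) where
  open OrderedField F
  open Extended F
  open Problem F
  open Instance I
  open Semantics H matroid

  encode⁺ : Carrier⁺ → Val cost∞
  encode⁺ ⊤⁺    = inj₁ tt
  encode⁺ [ x ] = inj₂ x

  input : Val InputTy
  input = List.tabulate (λ e → e , a e)
        , List.tabulate λ t → List.tabulate λ e → e , encode⁺ (c t e) , y t e , z t e

  inputSize : ℕ
  inputSize = size InputTy input

  run : Procedure → Run (Val OutputTy)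
  run A = eval A (input ∷ [])

  -- The t-th listed set, and the empty set past the end of the list.
  nth : List (List (Fin n)) → ∀ {T} → Fin T → Subset n
  nth []       _       = ∅
  nth (S ∷ Ss) zero    = toSet S
  nth (S ∷ Ss) (suc t) = nth Ss t

  solution : Val OutputTy → Fin T → Subset n
  solution out t = nth out t

  Feasible : Val OutputTy → Set
  Feasible out = length out ≡ T × (∀ t → Spanning matroid (solution out t))

  AlwaysFeasible : Procedure → Set
  AlwaysFeasible A = ∀ p s out → (p , s , out) List.∈ run A → 0# < p → Feasible out

  AlwaysWithin : ℕ → Procedure → Set
  AlwaysWithin b A = ∀ p s out → (p , s , out) List.∈ run A → 0# < p → s ℕ.≤ b

  expectedCost : Procedure → Carrier⁺
  expectedCost A = expectation (λ out → cost I (solution out)) (run A)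

{-# OPTIONS --safe #-}
module Submission where

-- The set of each time step is sampled in L ≥ log₂ (rT) independent rounds.  In
-- a round every element follows its own Markov chain over the time steps, with
-- marginals z_t(e) and consecutive states coupled so that it enters with
-- probability (z_t(e) - z_{t-1}(e))⁺ ≤ y_t(e); a round therefore costs at most
-- the value of the linear program.
--
-- Let D(S) = r - rank S.  If R is the set chosen at time t in one round, then
-- an element unspanned when it is considered is chosen with probability
-- z(e), so D(S) - E D(S ∪ R) is at least the expected z-mass outside the span of
-- S ∪ R, which is at least E D(S ∪ R) because z lies in the base polytope.  Hence a
-- round halves the expected deficit, and after L rounds it is at most 1 / T.
--
-- What is missing is added greedily from the elements of positive mass whose
-- weight a(e) + c_t(e) is at most V_t := Σ z_t(e) (a(e) + c_t(e)).
-- They span: otherwise z_t would put mass at least 1 on elements heavier than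
-- V_t.  The repair costs at most V_t D(S_t), and V_t is at most the value of the
-- linear program, so in expectation all repairs together cost at most that value.

open import Algebra.Bundles using (CommutativeRing)
import Algebra.Properties.Ring as RingProperties
import Algebra.Properties.Semiring.Mult as Mult
import Algebra.Properties.Semiring.Sum as Sum
import Algebra.Solver.Ring.NaturalCoefficients.Default as SemiringSolver
open import Data.Bool.Base using (true; false; _∨_; if_then_else_; T)
open import Data.Empty using (⊥; ⊥-elim)
open import Data.Fin.Base using (Fin; zero; suc; inject₁)
import Data.Fin.Properties as Fin
open import Data.Fin.Subset
  using (Subset; inside; outside; _∈_; _∉_; _⊆_; _∪_; _─_; ⁅_⁆; ⋃; ∣_∣)
  renaming (⊥ to ∅; ⊤ to full)
open import Data.Fin.Subset.Properties
open import Data.List.Base as List using (List; []; _∷_; _++_; length)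
open import Data.List.Extrema.Nat using (argmax-sel; xs≤max)
open import Data.List.Membership.Propositional using () renaming (_∈_ to _∈ₗ_)
import Data.List.Membership.Propositional.Properties as List
import Data.List.Properties as List
open import Data.List.Relation.Unary.All as All using (All; []; _∷_)
import Data.List.Relation.Unary.All.Properties as All
open import Data.List.Relation.Unary.Any using (here; there)
open import Data.List.Relation.Unary.Unique.Propositional using (Unique; []; _∷_)
import Data.List.Relation.Unary.Unique.Propositional.Properties as Unique
open import Data.Nat.Base as ℕ using (ℕ; zero; suc; z≤n; s≤s; NonZero)
import Data.Nat.Properties as ℕ
open import Data.Nat.Tactic.RingSolver using (solve-∀)
open import Data.Product.Base using (_×_; _,_; proj₁; proj₂; Σ-syntax; ∃-syntax)
open import Data.Sum.Base using (_⊎_; inj₁; inj₂; [_,_]′)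
open import Data.Unit.Base using (⊤; tt)
open import Data.Vec.Base as Vec using ([]; _∷_)
import Data.Vec.Properties as Vec
open import Function.Base using (id; _∘_)
open import Level using (0ℓ)
open import Relation.Binary.Bundles using (Poset)
import Relation.Binary.Construct.Add.Supremum.NonStrict as Supremum
open import Relation.Binary.PropositionalEquality
  using (_≡_; _≢_; refl; sym; trans; cong; cong₂; subst; subst₂; module ≡-Reasoning)
import Relation.Binary.Reasoning.PartialOrder as PartialOrderReasoning
open import Relation.Binary.Structures using (IsDecTotalOrder)
open import Relation.Nullary using (¬_; Dec; yes; no; does; contradiction)
open import Relation.Nullary.Construct.Add.Supremum using (⊤⁺; [_])
open import Relation.Nullary.Decidable using (_×-dec_; ¬?; dec-true)
open import Defs

-- The scalars form an arbitrary ordered field, without exponentials, and every outcome has to be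
-- spanning. Tail bounds are therefore replaced by the rank deficit: halving it involves a single
-- time step at a time, and whatever deficit remains is exactly what the repair pays for, at most
-- V_t per unit of rank. The coupling of consecutive time steps matters for the acquisition costs
-- alone.
--
-- Folds consume a list from its end, so each trajectory is sampled backwards in time, from a
-- fictitious step after the last one. An element is newly acquired at time t if it is chosen at t
-- and then rejected when the walk arrives at t - 1.
--
-- An infinite holding cost is treated as 0. Elements of mass zero never enter a set, so if the
-- linear program has finite value, no element of infinite cost is ever chosen; otherwise the bound
-- is trivial.
--
-- The constant 4 comes from 2 ^ L ≤ 4rT: the rounds and the repair cost at most L + 1 times the
-- linear program, and L + 1 ≤ 3 + log₂ (rT) ≤ 4 log₂ (rT) as rT ≥ 2.

-- Arithmetic and finite sums in an ordered field.

module FieldProperties (F : OrderedField) where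
  open OrderedField F public
  open IsDecTotalOrder isDecTotalOrder public
    using (antisym; total; isPartialOrder)
    renaming (refl to ≤-refl; trans to ≤-trans; reflexive to ≤-reflexive)

  commutativeRing : CommutativeRing 0ℓ 0ℓ
  commutativeRing = record { isCommutativeRing = isCommutativeRing }

  open CommutativeRing commutativeRing public
    using ( +-comm; +-assoc; *-comm; *-assoc; +-identityˡ; +-identityʳ; *-identityˡ; *-identityʳ
          ; zeroˡ; zeroʳ; distribˡ; distribʳ; -‿inverseˡ; -‿inverseʳ
          ; commutativeSemiring; semiring; ring)
  open RingProperties ring public using (-‿distribˡ-*; -‿involutive; -0#≈0#)
  open Mult semiring public using (×-homo-+; ×1-homo-*)
  open Sum semiring public
    using (sum-cong-≗; ∑-distrib-+; ∑-comm; *-distribˡ-sum)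
  open SemiringSolver commutativeSemiring public using (solve; _:=_; _:+_; _:*_; con)

  ≤-poset : Poset 0ℓ 0ℓ 0ℓ
  ≤-poset = record { isPartialOrder = isPartialOrder }

  module ≤-Reasoning = PartialOrderReasoning ≤-poset

  +-monoʳ-≤ : ∀ z {x y} → x ≤ y → z + x ≤ z + y
  +-monoʳ-≤ z {x} {y} p rewrite +-comm z x | +-comm z y = +-monoˡ-≤ z p

  +-mono-≤ : ∀ {w x y z} → w ≤ x → y ≤ z → w + y ≤ x + z
  +-mono-≤ {x = x} {y} p q = ≤-trans (+-monoˡ-≤ y p) (+-monoʳ-≤ x q)

  x+y-y≡x : ∀ x y → (x + y) - y ≡ x
  x+y-y≡x x y = trans (+-assoc x y (- y)) (trans (cong (x +_) (-‿inverseʳ y)) (+-identityʳ x))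

  x-y+y≡x : ∀ x y → (x - y) + y ≡ x
  x-y+y≡x x y = trans (+-assoc x (- y) y) (trans (cong (x +_) (-‿inverseˡ y)) (+-identityʳ x))

  x+y*0≡x : ∀ x y → x + y * 0# ≡ x
  x+y*0≡x x y = trans (cong (x +_) (zeroʳ y)) (+-identityʳ x)

  +-cancelʳ-≤ : ∀ z {x y} → x + z ≤ y + z → x ≤ y
  +-cancelʳ-≤ z {x} {y} p = subst₂ _≤_ (x+y-y≡x x z) (x+y-y≡x y z) (+-monoˡ-≤ (- z) p)

  x≤y+z⇒x-z≤y : ∀ {x y z} → x ≤ y + z → x - z ≤ y
  x≤y+z⇒x-z≤y {x} {y} {z} p = subst (x - z ≤_) (x+y-y≡x y z) (+-monoˡ-≤ (- z) p)

  x-z≤y⇒x≤y+z : ∀ {x y z} → x - z ≤ y → x ≤ y + z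
  x-z≤y⇒x≤y+z {x} {y} {z} p = subst (_≤ y + z) (x-y+y≡x x z) (+-monoˡ-≤ z p)

  x≤y⇒0≤y-x : ∀ {x y} → x ≤ y → 0# ≤ y - x
  x≤y⇒0≤y-x {x} {y} p = subst (_≤ y - x) (-‿inverseʳ x) (+-monoˡ-≤ (- x) p)

  0≤y-x⇒x≤y : ∀ {x y} → 0# ≤ y - x → x ≤ y
  0≤y-x⇒x≤y {x} {y} p = subst₂ _≤_ (+-identityˡ x) (x-y+y≡x y x) (+-monoˡ-≤ x p)

  x≤y+x : ∀ {x y} → 0# ≤ y → x ≤ y + x
  x≤y+x {x} {y} p = subst (_≤ y + x) (+-identityˡ x) (+-monoˡ-≤ x p)

  x≤x+y : ∀ {x y} → 0# ≤ y → x ≤ x + y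
  x≤x+y {x} {y} p = subst (_≤ x + y) (+-identityʳ x) (+-monoʳ-≤ x p)

  0≤+ : ∀ {x y} → 0# ≤ x → 0# ≤ y → 0# ≤ x + y
  0≤+ p q = ≤-trans p (x≤x+y q)

  *-monoˡ-≤ : ∀ {x y z} → 0# ≤ z → x ≤ y → z * x ≤ z * y
  *-monoˡ-≤ {x} {y} {z} 0≤z x≤y = subst₂ _≤_ (+-identityˡ _) lemma
      (+-monoˡ-≤ (z * x) (*-nonNeg 0≤z (x≤y⇒0≤y-x x≤y)))
    where
    lemma : z * (y - x) + z * x ≡ z * y
    lemma = trans (sym (distribˡ z _ x)) (cong (z *_) (x-y+y≡x y x))

  *-monoʳ-≤ : ∀ {x y z} → 0# ≤ z → x ≤ y → x * z ≤ y * z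
  *-monoʳ-≤ {x} {y} {z} 0≤z x≤y = subst₂ _≤_ (*-comm z x) (*-comm z y) (*-monoˡ-≤ 0≤z x≤y)

  0≤1 : 0# ≤ 1#
  0≤1 with total 0# 1#
  ... | inj₁ p = p
  ... | inj₂ p = subst (0# ≤_) square (*-nonNeg q q)
    where
    q : 0# ≤ - 1#
    q = subst (0# ≤_) (+-identityˡ _) (x≤y⇒0≤y-x p)
    square : - 1# * - 1# ≡ 1#
    square = trans (sym (-‿distribˡ-* 1# (- 1#))) (trans (cong -_ (*-identityˡ _)) (-‿involutive 1#))

  ¬1≤0 : ¬ 1# ≤ 0#
  ¬1≤0 p = 0≢1 (antisym 0≤1 p)

  ≰⇒≥ : ∀ {x y} → ¬ x ≤ y → y ≤ x
  ≰⇒≥ {x} {y} p with total x y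
  ... | inj₁ q = contradiction q p
  ... | inj₂ q = q

  fromℕ-nonNeg : ∀ n → 0# ≤ fromℕ n
  fromℕ-nonNeg zero    = ≤-refl
  fromℕ-nonNeg (suc n) = 0≤+ 0≤1 (fromℕ-nonNeg n)

  fromℕ-+ : ∀ m n → fromℕ (m ℕ.+ n) ≡ fromℕ m + fromℕ n
  fromℕ-+ = ×-homo-+ 1#

  fromℕ-* : ∀ m n → fromℕ (m ℕ.* n) ≡ fromℕ m * fromℕ n
  fromℕ-* = ×1-homo-*

  fromℕ-mono : ∀ {m n} → m ℕ.≤ n → fromℕ m ≤ fromℕ n
  fromℕ-mono {n = n} z≤n = fromℕ-nonNeg n
  fromℕ-mono (s≤s p) = +-monoʳ-≤ 1# (fromℕ-mono p)

  fromℕ-pos : ∀ n → 1# ≤ fromℕ (suc n)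
  fromℕ-pos n = x≤x+y (fromℕ-nonNeg n)

  fromℕ-suc≢0 : ∀ n → fromℕ (suc n) ≢ 0#
  fromℕ-suc≢0 n p = ¬1≤0 (subst (1# ≤_) p (fromℕ-pos n))

  *-inverse-cancel : ∀ x {y} → y ≢ 0# → y * (x * y ⁻¹) ≡ x
  *-inverse-cancel x {y} y≢0 = begin
    y * (x * y ⁻¹)  ≡⟨ solve 3 (λ y x i → y :* (x :* i) := x :* (y :* i)) refl y x (y ⁻¹) ⟩
    x * (y * y ⁻¹)  ≡⟨ cong (x *_) (*-inverseʳ y y≢0) ⟩
    x * 1#          ≡⟨ *-identityʳ x ⟩
    x               ∎
    where open ≡-Reasoning

  *-cancelˡ-≤ : ∀ {x y z} → 0# ≤ z → z ≢ 0# → z * x ≤ z * y → x ≤ y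
  *-cancelˡ-≤ {x} {y} {z} 0≤z z≢0 p with x ≤? y
  ... | yes q = q
  ... | no  q = contradiction (antisym y≤x x≤y) λ { refl → q ≤-refl }
    where
    y≤x = ≰⇒≥ q
    zx≡zy : z * x ≡ z * y
    zx≡zy = antisym p (*-monoˡ-≤ 0≤z y≤x)
    cancel : ∀ u → z ⁻¹ * (z * u) ≡ u
    cancel u = trans (solve 3 (λ i z u → i :* (z :* u) := z :* (u :* i)) refl (z ⁻¹) z u) (*-inverse-cancel u z≢0)
    x≤y : x ≤ y
    x≤y = ≤-reflexive (trans (sym (cancel x)) (trans (cong (z ⁻¹ *_) zx≡zy) (cancel y)))

  clip-nonNeg : ∀ x → 0# ≤ clip x
  clip-nonNeg x with x ≤? 0#
  ... | yes _ = ≤-refl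
  ... | no x≰0 with 1# ≤? x
  ...   | yes _ = 0≤1
  ...   | no  _ = ≰⇒≥ x≰0

  clip-≤1 : ∀ x → clip x ≤ 1#
  clip-≤1 x with x ≤? 0#
  ... | yes _ = 0≤1
  ... | no _ with 1# ≤? x
  ...   | yes _   = ≤-refl
  ...   | no 1≰x = ≰⇒≥ 1≰x

  x+[1-x]≡1 : ∀ x → x + (1# - x) ≡ 1#
  x+[1-x]≡1 x = trans (+-comm x _) (x-y+y≡x 1# x)

  -- The product with `d` is taken because the inverse of zero is unspecified: for `d` equal to zero
  -- it vanishes whatever `clip` receives. So in all cases it is `u` truncated to the interval from
  -- 0 to `d`, and the alternatives say which part of the truncation applies.
  *-clip : ∀ {d} u → 0# ≤ d → (u ≤ 0# × d * clip (u * d ⁻¹) ≡ 0#)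
                              ⊎ (d ≤ u × d * clip (u * d ⁻¹) ≡ d)
                              ⊎ (0# ≤ u × u ≤ d × d * clip (u * d ⁻¹) ≡ u)
  *-clip {d} u 0≤d with d ≟ 0#
  *-clip u 0≤d | yes refl with total u 0#
  ... | inj₁ u≤0 = inj₁ (u≤0 , zeroˡ _)
  ... | inj₂ 0≤u = inj₂ (inj₁ (0≤u , zeroˡ _))
  *-clip {d} u 0≤d | no d≢0 with u * d ⁻¹ ≤? 0#
  ... | yes q = inj₁ (subst₂ _≤_ (*-inverse-cancel u d≢0) (zeroʳ d) (*-monoˡ-≤ 0≤d q) , zeroʳ d)
  ... | no q with 1# ≤? u * d ⁻¹
  ...   | yes r = inj₂ (inj₁ (subst₂ _≤_ (*-identityʳ d) (*-inverse-cancel u d≢0) (*-monoˡ-≤ 0≤d r)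
                             , *-identityʳ d))
  ...   | no r = inj₂ (inj₂
          ( subst₂ _≤_ (zeroʳ d) (*-inverse-cancel u d≢0) (*-monoˡ-≤ 0≤d (≰⇒≥ q))
          , subst₂ _≤_ (*-inverse-cancel u d≢0) (*-identityʳ d) (*-monoˡ-≤ 0≤d (≰⇒≥ r))
          , *-inverse-cancel u d≢0))

  sum-mono : ∀ {n} {f g : Fin n → Carrier} → (∀ i → f i ≤ g i) → sum f ≤ sum g
  sum-mono {zero}  p = ≤-refl
  sum-mono {suc n} p = +-mono-≤ (p zero) (sum-mono (p ∘ suc))

  sum-zero : ∀ n → sum {n} (λ _ → 0#) ≡ 0#
  sum-zero zero    = refl
  sum-zero (suc n) = trans (+-identityˡ _) (sum-zero n)

  sum-nonNeg : ∀ {n} {f : Fin n → Carrier} → (∀ i → 0# ≤ f i) → 0# ≤ sum f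
  sum-nonNeg {n} {f} p = subst (_≤ sum f) (sum-zero n) (sum-mono p)

  term≤sum : ∀ {n} {f : Fin n → Carrier} → (∀ i → 0# ≤ f i) → ∀ i → f i ≤ sum f
  term≤sum p zero    = x≤x+y (sum-nonNeg (p ∘ suc))
  term≤sum p (suc i) = ≤-trans (term≤sum (p ∘ suc) i) (x≤y+x (p zero))

  sum-cong : ∀ {n} {f g : Fin n → Carrier} → (∀ i → f i ≡ g i) → sum f ≡ sum g
  sum-cong = sum-cong-≗

  sum-+ : ∀ {n} (f g : Fin n → Carrier) → sum (λ i → f i + g i) ≡ sum f + sum g
  sum-+ = ∑-distrib-+

  sum-* : ∀ {n} c (f : Fin n → Carrier) → sum (λ i → c * f i) ≡ c * sum f
  sum-* c f = sym (*-distribˡ-sum c f)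

  sum-swap : ∀ {m n} (f : Fin m → Fin n → Carrier) → sum (λ i → sum (f i)) ≡ sum (λ j → sum λ i → f i j)
  sum-swap = ∑-comm

-- Finite subsets and the sets given by lists.

does-true : ∀ {P : Set} (P? : Dec P) → does P? ≡ true → P
does-true (yes p) _ = p

∈-subsets : ∀ {n} (S : Subset n) → S ∈ₗ subsets n
∈-subsets []            = here refl
∈-subsets (inside ∷ S)  = List.∈-++⁺ˡ (List.∈-map⁺ (inside ∷_) (∈-subsets S))
∈-subsets (outside ∷ S) = List.∈-++⁺ʳ _ (List.∈-map⁺ (outside ∷_) (∈-subsets S))

∣⁅x⁆∪p∣≡1+∣p∣ : ∀ {n} (x : Fin n) (p : Subset n) → x ∉ p → ∣ ⁅ x ⁆ ∪ p ∣ ≡ suc ∣ p ∣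
∣⁅x⁆∪p∣≡1+∣p∣ zero    (inside ∷ p)  x∉p = contradiction Vec.here x∉p
∣⁅x⁆∪p∣≡1+∣p∣ zero    (outside ∷ p) x∉p = cong (suc ∘ ∣_∣) (∪-identityˡ p)
∣⁅x⁆∪p∣≡1+∣p∣ (suc x) (inside ∷ p)  x∉p = cong suc (∣⁅x⁆∪p∣≡1+∣p∣ x p (x∉p ∘ Vec.there))
∣⁅x⁆∪p∣≡1+∣p∣ (suc x) (outside ∷ p) x∉p = ∣⁅x⁆∪p∣≡1+∣p∣ x p (x∉p ∘ Vec.there)

x∈⁅x⁆∪p : ∀ {n} (x : Fin n) (p : Subset n) → x ∈ ⁅ x ⁆ ∪ p
x∈⁅x⁆∪p x p = p⊆p∪q p (x∈⁅x⁆ x)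

p⊆⁅x⁆∪p : ∀ {n} (x : Fin n) (p : Subset n) → p ⊆ ⁅ x ⁆ ∪ p
p⊆⁅x⁆∪p x p = q⊆p∪q ⁅ x ⁆ p

⁅x⁆∪p⊆ : ∀ {n} {x : Fin n} {p q : Subset n} → x ∈ q → p ⊆ q → ⁅ x ⁆ ∪ p ⊆ q
⁅x⁆∪p⊆ {x = x} {p} x∈q p⊆q y∈ with x∈p∪q⁻ ⁅ x ⁆ p y∈
... | inj₁ y∈⁅x⁆ = subst (_∈ _) (sym (x∈⁅y⁆⇒x≡y x y∈⁅x⁆)) x∈q
... | inj₂ y∈p   = p⊆q y∈p

⁅x⁆∪-mono : ∀ {n} (x : Fin n) {p q : Subset n} → p ⊆ q → ⁅ x ⁆ ∪ p ⊆ ⁅ x ⁆ ∪ q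
⁅x⁆∪-mono x {q = q} p⊆q = ⁅x⁆∪p⊆ (x∈⁅x⁆∪p x q) (p⊆⁅x⁆∪p x q ∘ p⊆q)

x∈p⇒⁅x⁆∪p≡p : ∀ {n} {x : Fin n} {p : Subset n} → x ∈ p → ⁅ x ⁆ ∪ p ≡ p
x∈p⇒⁅x⁆∪p≡p {x = x} {p} x∈p = ⊆-antisym (⁅x⁆∪p⊆ x∈p id) (p⊆⁅x⁆∪p x p)

setOf : ∀ {n} → List (Fin n) → Subset n
setOf es = ⋃ (List.map ⁅_⁆ es)

∈-setOf⁺ : ∀ {n} {e : Fin n} {es} → e ∈ₗ es → e ∈ setOf es
∈-setOf⁺ {es = e ∷ es} (here refl) = x∈⁅x⁆∪p e (setOf es)
∈-setOf⁺ {es = d ∷ es} (there e∈)  = p⊆⁅x⁆∪p d (setOf es) (∈-setOf⁺ e∈)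

∈-setOf⁻ : ∀ {n} {e : Fin n} {es} → e ∈ setOf es → e ∈ₗ es
∈-setOf⁻ {es = []}     e∈ = contradiction e∈ ∉⊥
∈-setOf⁻ {es = d ∷ es} e∈ with x∈p∪q⁻ ⁅ d ⁆ (setOf es) e∈
... | inj₁ p = here (x∈⁅y⁆⇒x≡y d p)
... | inj₂ p = there (∈-setOf⁻ p)

-- Rank, span and greedy bases of a matroid.

module MatroidProperties {n} (M : Matroid n) where
  open Matroid M

  rk : Subset n → ℕ
  rk = rank M

  indep-augment : ∀ {I J} → Independent I → Independent J → ∣ I ∣ ℕ.< ∣ J ∣ →
                  ∃[ e ] (e ∈ J × e ∉ I × Independent (⁅ e ⁆ ∪ I))
  indep-augment {I} i j I<J with augmentation i j I<J
  ... | e , e∈J , e∉I , p = e , e∈J , e∉I , subst Independent (∪-comm I ⁅ e ⁆) p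

  module _ (S : Subset n) where
    private
      candidate? : ∀ I → Dec (I ⊆ S × Independent I)
      candidate? I = (I ⊆? S) ×-dec independent? I

    ∣I∣≤rank : ∀ {I} → I ⊆ S → Independent I → ∣ I ∣ ℕ.≤ rk S
    ∣I∣≤rank {I} I⊆S i = All.lookup
      (xs≤max 0 (List.map ∣_∣ (List.filter candidate? (subsets n))))
      (List.∈-map⁺ ∣_∣ (List.∈-filter⁺ candidate? (∈-subsets I) (I⊆S , i)))

    rank-attained : ∃[ I ] (I ⊆ S × Independent I × ∣ I ∣ ≡ rk S)
    rank-attained with argmax-sel id 0 (List.map ∣_∣ (List.filter candidate? (subsets n)))
    ... | inj₁ p = ∅ , ⊆-min S , ∅-indep , trans (∣⊥∣≡0 n) (sym p)
    ... | inj₂ p with List.∈-map⁻ ∣_∣ p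
    ...   | I , I∈ , eq with List.∈-filter⁻ candidate? {xs = subsets n} I∈
    ...     | _ , I⊆S , i = I , I⊆S , i , sym eq

  rank-mono : ∀ {S S′} → S ⊆ S′ → rk S ℕ.≤ rk S′
  rank-mono {S} {S′} S⊆S′ with rank-attained S
  ... | I , I⊆S , i , eq = subst (ℕ._≤ rk S′) eq (∣I∣≤rank S′ (S⊆S′ ∘ I⊆S) i)

  rank≤rank-full : ∀ S → rk S ℕ.≤ rk full
  rank≤rank-full S = rank-mono (⊆-max S)

  rank≤∣∣ : ∀ S → rk S ℕ.≤ ∣ S ∣
  rank≤∣∣ S with rank-attained S
  ... | I , I⊆S , i , eq = subst (ℕ._≤ ∣ S ∣) eq (p⊆q⇒∣p∣≤∣q∣ I⊆S)

  Spanned : Subset n → Fin n → Set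
  Spanned S e = rk (⁅ e ⁆ ∪ S) ≡ rk S

  opaque
    spanned? : ∀ S e → Dec (Spanned S e)
    spanned? S e = rk (⁅ e ⁆ ∪ S) ℕ.≟ rk S

  unspanned⇒rank< : ∀ {S e} → ¬ Spanned S e → rk S ℕ.< rk (⁅ e ⁆ ∪ S)
  unspanned⇒rank< {S} {e} p = ℕ.≤∧≢⇒< (rank-mono (p⊆⁅x⁆∪p e S)) (p ∘ sym)

  ∈⇒spanned : ∀ {S e} → e ∈ S → Spanned S e
  ∈⇒spanned e∈S = cong rk (x∈p⇒⁅x⁆∪p≡p e∈S)

  maximal⇒∣I∣≡rank : ∀ {I S} → I ⊆ S → Independent I →
    (∀ {e} → e ∈ S → e ∉ I → ¬ Independent (⁅ e ⁆ ∪ I)) → ∣ I ∣ ≡ rk S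
  maximal⇒∣I∣≡rank {I} {S} I⊆S i maximal with ∣ I ∣ ℕ.<? rk S
  ... | no  ≮ = ℕ.≤-antisym (∣I∣≤rank S I⊆S i) (ℕ.≮⇒≥ ≮)
  ... | yes < with rank-attained S
  ...   | J , J⊆S , j , eq with indep-augment i j (subst (∣ I ∣ ℕ.<_) (sym eq) <)
  ...     | e , e∈J , e∉I , p = contradiction p (maximal (J⊆S e∈J) e∉I)

  extend-to-base : ∀ {I S} → I ⊆ S → Independent I →
    ∃[ J ] (I ⊆ J × J ⊆ S × Independent J × ∣ J ∣ ≡ rk S)
  extend-to-base {S = S} I⊆S i = go (rk S) I⊆S i (ℕ.m≤m+n (rk S) _)
    where
    go : ∀ k {I} → I ⊆ S → Independent I → rk S ℕ.≤ k ℕ.+ ∣ I ∣ →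
         ∃[ J ] (I ⊆ J × J ⊆ S × Independent J × ∣ J ∣ ≡ rk S)
    go k {I} I⊆S i bound with ∣ I ∣ ℕ.<? rk S
    ... | no  ≮ = I , id , I⊆S , i , ℕ.≤-antisym (∣I∣≤rank S I⊆S i) (ℕ.≮⇒≥ ≮)
    go zero I⊆S i bound | yes < = contradiction bound (ℕ.<⇒≱ <)
    go (suc k) {I} I⊆S i bound | yes < with rank-attained S
    ... | J , J⊆S , j , eq with indep-augment i j (subst (∣ I ∣ ℕ.<_) (sym eq) <)
    ...   | e , e∈J , e∉I , p with go k (⁅x⁆∪p⊆ (J⊆S e∈J) I⊆S) p
                (subst (rk S ℕ.≤_) (trans (sym (ℕ.+-suc k ∣ I ∣)) (cong (k ℕ.+_) (sym (∣⁅x⁆∪p∣≡1+∣p∣ e I e∉I)))) bound)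
    ...     | K , ⊆K , rest = K , ⊆K ∘ p⊆⁅x⁆∪p e I , rest

  base-test : ∀ {I S e} → I ⊆ S → ∣ I ∣ ≡ rk S → e ∉ I → Independent (⁅ e ⁆ ∪ I) → rk S ℕ.< rk (⁅ e ⁆ ∪ S)
  base-test {I} {S} {e} I⊆S eq e∉I p = subst (ℕ._≤ rk (⁅ e ⁆ ∪ S))
    (trans (∣⁅x⁆∪p∣≡1+∣p∣ e I e∉I) (cong suc eq))
    (∣I∣≤rank (⁅ e ⁆ ∪ S) (⁅x⁆∪-mono e I⊆S) p)

  -- Extend a base `I` of `S` to a base `K` of `S′`. Were `e` outside the span of `S′`, a base of
  -- `S′` with `e` added would augment `K` by some `f`. This `f` cannot lie in `S′`, where `K` is
  -- maximal, so it is `e`; but then `I` with `e` is independent by heredity, and `e` is outside the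
  -- span of `S` too.
  spanned-mono : ∀ {S S′ e} → S ⊆ S′ → Spanned S e → Spanned S′ e
  spanned-mono {S} {S′} {e} S⊆S′ sp with spanned? S′ e
  ... | yes p = p
  ... | no  p with rank-attained S | rank-attained (⁅ e ⁆ ∪ S′)
  ...   | I , I⊆S , i , ∣I∣≡ | J , J⊆ , j , ∣J∣≡ with extend-to-base (S⊆S′ ∘ I⊆S) i
  ...     | K , I⊆K , K⊆S′ , k , ∣K∣≡
            with indep-augment k j (subst₂ ℕ._<_ (sym ∣K∣≡) (sym ∣J∣≡) (unspanned⇒rank< p))
  ...       | f , f∈J , f∉K , q with x∈p∪q⁻ ⁅ e ⁆ S′ (J⊆ f∈J)
  ...         | inj₂ f∈S′ = contradiction
                  (subst (ℕ._≤ rk S′) (trans (∣⁅x⁆∪p∣≡1+∣p∣ f K f∉K) (cong suc ∣K∣≡))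
                     (∣I∣≤rank S′ (⁅x⁆∪p⊆ f∈S′ K⊆S′) q))
                  (ℕ.<-irrefl refl)
  ...         | inj₁ f∈e with x∈⁅y⁆⇒x≡y e f∈e
  ...           | refl = contradiction sp
                    (ℕ.>⇒≢ (base-test I⊆S ∣I∣≡ (f∉K ∘ I⊆K) (hereditary (⁅x⁆∪-mono f I⊆K) q)))

  closure : Subset n → Subset n
  closure S = Vec.tabulate (does ∘ spanned? S)

  ∈-closure⁺ : ∀ {S e} → Spanned S e → e ∈ closure S
  ∈-closure⁺ {S} {e} p = Vec.lookup⇒[]= e (closure S)
    (trans (Vec.lookup∘tabulate (does ∘ spanned? S) e) (dec-true (spanned? S e) p))

  ∈-closure⁻ : ∀ {S e} → e ∈ closure S → Spanned S e
  ∈-closure⁻ {S} {e} p = does-true (spanned? S e)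
    (trans (sym (Vec.lookup∘tabulate (does ∘ spanned? S) e)) (Vec.[]=⇒lookup p))

  -- A base of `S` smaller than a base of `G` could be augmented by some `f` in `G`, which would
  -- then raise the rank of `S`. Applied to closures, and to the light elements, which the repair
  -- spans one by one.
  rank-spanned : ∀ {S G} → (∀ {e} → e ∈ G → Spanned S e) → rk G ℕ.≤ rk S
  rank-spanned {S} {G} sp with rk S ℕ.<? rk G
  ... | no ≮ = ℕ.≮⇒≥ ≮
  ... | yes < with rank-attained S | rank-attained G
  ...   | I , I⊆S , i , ∣I∣≡ | J , J⊆G , j , ∣J∣≡
          with indep-augment i j (subst₂ ℕ._<_ (sym ∣I∣≡) (sym ∣J∣≡) <)
  ...     | f , f∈J , f∉I , q =
            contradiction (sp (J⊆G f∈J)) (ℕ.>⇒≢ (base-test I⊆S ∣I∣≡ f∉I q))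

  rank-closure : ∀ S → rk (closure S) ≡ rk S
  rank-closure S = ℕ.≤-antisym (rank-spanned ∈-closure⁻) (rank-mono (∈-closure⁺ ∘ ∈⇒spanned))

  -- The oracle knows only independence, and a sampled set may be dependent. A greedy base stands in
  -- for the set: if the listed elements are distinct, its length is the rank, and testing a further
  -- element against it decides whether the set spans that element.
  greedyStep : Fin n → List (Fin n) → List (Fin n)
  greedyStep e I = if does (independent? (setOf (e ∷ I))) then e ∷ I else I

  greedy : List (Fin n) → List (Fin n)
  greedy = List.foldr greedyStep []

  greedy-⊆ : ∀ es → setOf (greedy es) ⊆ setOf es
  greedy-⊆ [] = id
  greedy-⊆ (e ∷ es) with independent? (setOf (e ∷ greedy es))
  ... | yes _ = ⁅x⁆∪-mono e (greedy-⊆ es)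
  ... | no  _ = p⊆⁅x⁆∪p e (setOf es) ∘ greedy-⊆ es

  greedy-indep : ∀ es → Independent (setOf (greedy es))
  greedy-indep [] = ∅-indep
  greedy-indep (e ∷ es) with independent? (setOf (e ∷ greedy es))
  ... | yes p = p
  ... | no  _ = greedy-indep es

  greedy-extends : ∀ e es → setOf (greedy es) ⊆ setOf (greedy (e ∷ es))
  greedy-extends e es with independent? (setOf (e ∷ greedy es))
  ... | yes _ = p⊆⁅x⁆∪p e (setOf (greedy es))
  ... | no  _ = id

  -- A rejected element is dependent on the elements kept up to then. These are all kept later on,
  -- so by heredity it never passes the test again.
  greedy-maximal : ∀ es {e} → e ∈ setOf es → Independent (⁅ e ⁆ ∪ setOf (greedy es)) → e ∈ setOf (greedy es)
  greedy-maximal []       e∈ p = e∈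
  greedy-maximal (d ∷ es) {e} e∈ p with x∈p∪q⁻ ⁅ d ⁆ (setOf es) e∈
  ... | inj₂ e∈es = greedy-extends d es
          (greedy-maximal es e∈es (hereditary (⁅x⁆∪-mono e (greedy-extends d es)) p))
  ... | inj₁ e∈d with x∈⁅y⁆⇒x≡y d e∈d
  ...   | refl with independent? (setOf (d ∷ greedy es))
  ...     | yes _ = x∈⁅x⁆∪p d (setOf (greedy es))
  ...     | no ¬q = contradiction p ¬q

  ∣greedy∣≡rank : ∀ es → ∣ setOf (greedy es) ∣ ≡ rk (setOf es)
  ∣greedy∣≡rank es = maximal⇒∣I∣≡rank (greedy-⊆ es) (greedy-indep es)
    (λ e∈ e∉ p → e∉ (greedy-maximal es e∈ p))

  -- The test also succeeds for an element that is already in the greedy base; hence the first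
  -- alternative, in which the set does not change and nothing has to be paid.
  greedy-test-yes : ∀ e es → Independent (setOf (e ∷ greedy es)) →
    setOf (e ∷ es) ≡ setOf es ⊎ rk (setOf es) ℕ.< rk (setOf (e ∷ es))
  greedy-test-yes e es p with e ∈? setOf (greedy es)
  ... | yes e∈ = inj₁ (x∈p⇒⁅x⁆∪p≡p (greedy-⊆ es e∈))
  ... | no  e∉ = inj₂ (base-test (greedy-⊆ es) (∣greedy∣≡rank es) e∉ p)

  -- After a failed test `greedy es` is a maximal independent subset of the enlarged set as well, so
  -- the rank has not grown.
  greedy-test-no : ∀ e es → ¬ Independent (setOf (e ∷ greedy es)) → Spanned (setOf es) e
  greedy-test-no e es ¬p = trans (sym (maximal⇒∣I∣≡rank
      (p⊆⁅x⁆∪p e (setOf es) ∘ greedy-⊆ es) (greedy-indep es) maximal)) (∣greedy∣≡rank es)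
    where
    maximal : ∀ {f} → f ∈ setOf (e ∷ es) → f ∉ setOf (greedy es) → ¬ Independent (⁅ f ⁆ ∪ setOf (greedy es))
    maximal {f} f∈ f∉ q with x∈p∪q⁻ ⁅ e ⁆ (setOf es) f∈
    ... | inj₂ f∈es = f∉ (greedy-maximal es f∈es q)
    ... | inj₁ f∈e with x∈⁅y⁆⇒x≡y e f∈e
    ...   | refl = ¬p q

  length-greedy≤ : ∀ es → length (greedy es) ℕ.≤ length es
  length-greedy≤ [] = z≤n
  length-greedy≤ (e ∷ es) with independent? (setOf (e ∷ greedy es))
  ... | yes _ = s≤s (length-greedy≤ es)
  ... | no  _ = ℕ.m≤n⇒m≤1+n (length-greedy≤ es)

  -- With repetitions the list could outgrow the set, since an element that is already kept passes
  -- the independence test again.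
  length-greedy : ∀ {es} → Unique es → length (greedy es) ≡ rk (setOf es)
  length-greedy {es} u = trans (length≡∣∣ u) (∣greedy∣≡rank es)
    where
    length≡∣∣ : ∀ {es} → Unique es → length (greedy es) ≡ ∣ setOf (greedy es) ∣
    length≡∣∣ [] = sym (∣⊥∣≡0 n)
    length≡∣∣ {e ∷ es} (e∉ ∷ u) with independent? (setOf (e ∷ greedy es))
    ... | no  _ = length≡∣∣ u
    ... | yes _ = trans (cong suc (length≡∣∣ u)) (sym (∣⁅x⁆∪p∣≡1+∣p∣ e _
            λ e∈ → All.lookup e∉ (∈-setOf⁻ (greedy-⊆ es e∈)) refl))

-- Runs of programs: values, times, expectations.

-- Defined by recursion, so that for a concrete program it reduces to a product of unit types and
-- its proofs are inferred. Only the sampling falls outside; everything else has a single outcome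
-- and is analysed through `det` and `time`.
FlipFree : ∀ {Γ τ} → Term Γ τ → Set
FlipFree (var _)      = ⊤
FlipFree (let′ s t)   = FlipFree s × FlipFree t
FlipFree unit         = ⊤
FlipFree (pair s t)   = FlipFree s × FlipFree t
FlipFree (fst t)      = FlipFree t
FlipFree (snd t)      = FlipFree t
FlipFree (inl t)      = FlipFree t
FlipFree (inr t)      = FlipFree t
FlipFree (case r s t) = FlipFree r × FlipFree s × FlipFree t
FlipFree nil          = ⊤
FlipFree (cons s t)   = FlipFree s × FlipFree t
FlipFree (uncons t)   = FlipFree t
FlipFree (fold r s t) = FlipFree r × FlipFree s × FlipFree t
FlipFree zero#        = ⊤
FlipFree one#         = ⊤
FlipFree (add s t)    = FlipFree s × FlipFree t
FlipFree (mul s t)    = FlipFree s × FlipFree t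
FlipFree (neg t)      = FlipFree t
FlipFree (inv t)      = FlipFree t
FlipFree (leq s t)    = FlipFree s × FlipFree t
FlipFree (same s t)   = FlipFree s × FlipFree t
FlipFree (indep t)    = FlipFree t
FlipFree (flip _)     = ⊥

module RunProperties {F : OrderedField} (H : Height F) {n : ℕ} (M : Matroid n) where
  open FieldProperties F
  open Height H
  open Matroid M
  open Semantics H M

  uncons′ : ∀ {A : Set} → List A → ⊤ ⊎ (A × List A)
  uncons′ []       = inj₁ tt
  uncons′ (x ∷ xs) = inj₂ (x , xs)

  -- det and time are junk at flip.
  det : ∀ {Γ τ} → Term Γ τ → Env Γ → Val τ
  det (var i)      ρ = All.lookup ρ i
  det (let′ s t)   ρ = det t (det s ρ ∷ ρ)
  det unit         ρ = tt
  det (pair s t)   ρ = det s ρ , det t ρ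
  det (fst t)      ρ = proj₁ (det t ρ)
  det (snd t)      ρ = proj₂ (det t ρ)
  det (inl t)      ρ = inj₁ (det t ρ)
  det (inr t)      ρ = inj₂ (det t ρ)
  det (case r s t) ρ = [ (λ u → det s (u ∷ ρ)) , (λ v → det t (v ∷ ρ)) ]′ (det r ρ)
  det nil          ρ = []
  det (cons s t)   ρ = det s ρ ∷ det t ρ
  det (uncons t)   ρ = uncons′ (det t ρ)
  det (fold r s t) ρ = List.foldr (λ x b → det t (x ∷ b ∷ ρ)) (det s ρ) (det r ρ)
  det zero#        ρ = 0#
  det one#         ρ = 1#
  det (add s t)    ρ = det s ρ + det t ρ
  det (mul s t)    ρ = det s ρ * det t ρ
  det (neg t)      ρ = - det t ρ
  det (inv t)      ρ = det t ρ ⁻¹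
  det (leq s t)    ρ = toVal (does (det s ρ ≤? det t ρ))
  det (same s t)   ρ = toVal (does (det s ρ Fin.≟ det t ρ))
  det (indep t)    ρ = toVal (does (independent? (toSet (det t ρ))))
  det (flip _)     ρ = inj₂ tt

  foldTime : ∀ {A B : Set} → (A → B → ℕ) → (A → B → B) → B → List A → ℕ
  foldTime τ f b []       = 0
  foldTime τ f b (x ∷ xs) = foldTime τ f b xs ℕ.+ suc (τ x (List.foldr f b xs))

  time : ∀ {Γ τ} → Term Γ τ → Env Γ → ℕ
  time (var i)      ρ = 1
  time (let′ s t)   ρ = time s ρ ℕ.+ suc (time t (det s ρ ∷ ρ))
  time unit         ρ = 1
  time (pair s t)   ρ = time s ρ ℕ.+ (time t ρ ℕ.+ 1)
  time (fst t)      ρ = time t ρ ℕ.+ 1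
  time (snd t)      ρ = time t ρ ℕ.+ 1
  time (inl t)      ρ = time t ρ ℕ.+ 1
  time (inr t)      ρ = time t ρ ℕ.+ 1
  time (case r s t) ρ = time r ρ ℕ.+ suc ([ (λ u → time s (u ∷ ρ)) , (λ v → time t (v ∷ ρ)) ]′ (det r ρ))
  time nil          ρ = 1
  time (cons s t)   ρ = time s ρ ℕ.+ (time t ρ ℕ.+ 1)
  time (uncons t)   ρ = time t ρ ℕ.+ 1
  time (fold r s t) ρ = time r ρ ℕ.+ (time s ρ ℕ.+ suc
    (foldTime (λ x b → time t (x ∷ b ∷ ρ)) (λ x b → det t (x ∷ b ∷ ρ)) (det s ρ) (det r ρ)))
  time zero#        ρ = 1
  time one#         ρ = 1
  time (add s t)    ρ = time s ρ ℕ.+ (time t ρ ℕ.+ suc (height (det s ρ) ℕ.+ height (det t ρ)))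
  time (mul s t)    ρ = time s ρ ℕ.+ (time t ρ ℕ.+ suc (height (det s ρ) ℕ.+ height (det t ρ)))
  time (neg t)      ρ = time t ρ ℕ.+ suc (height (det t ρ))
  time (inv t)      ρ = time t ρ ℕ.+ suc (height (det t ρ))
  time (leq s t)    ρ = time s ρ ℕ.+ (time t ρ ℕ.+ suc (height (det s ρ) ℕ.+ height (det t ρ)))
  time (same s t)   ρ = time s ρ ℕ.+ (time t ρ ℕ.+ 1)
  time (indep t)    ρ = time t ρ ℕ.+ suc (length (det t ρ))
  time (flip t)     ρ = 0

  single : ∀ {A : Set} → ℕ → A → Run A
  single s v = (1# , s , v) ∷ []

  single->>= : ∀ {A B : Set} {m : Run A} {s u} (k : A → Run B) → m ≡ single s u → (m >>= k) ≡ (s ⟫ k u)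
  single->>= {s = s} {u} k refl = trans (List.++-identityʳ _)
    (List.map-cong (λ (q , t , v) → cong (_, s ℕ.+ t , v) (*-identityˡ q)) (k u))

  ⟫-single : ∀ {A : Set} s {m : Run A} {t v} → m ≡ single t v → (s ⟫ m) ≡ single (s ℕ.+ t) v
  ⟫-single s refl = refl

  >>=-single : ∀ {A B : Set} {m : Run A} {s u t v} (k : A → Run B) →
               m ≡ single s u → k u ≡ single t v → (m >>= k) ≡ single (s ℕ.+ t) v
  >>=-single {s = s} k p q = trans (single->>= k p) (⟫-single s q)

  >>=-return : ∀ {A B : Set} {m : Run A} {s u} (c : A → ℕ) (g : A → B) → m ≡ single s u →
               (m >>= λ u → c u ⟫ return (g u)) ≡ single (s ℕ.+ c u) (g u)
  >>=-return {s = s} {u} c g p = trans (>>=-single (λ u → c u ⟫ return (g u)) p refl)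
    (cong (λ k → single (s ℕ.+ k) (g u)) (ℕ.+-identityʳ (c u)))

  >>=-return₂ : ∀ {A B C : Set} {m : Run A} {m′ : Run B} {s t u v} (c : A → B → ℕ) (g : A → B → C) →
                m ≡ single s u → m′ ≡ single t v →
                (m >>= λ u → m′ >>= λ v → c u v ⟫ return (g u v)) ≡ single (s ℕ.+ (t ℕ.+ c u v)) (g u v)
  >>=-return₂ {m′ = m′} {u = u} c g p q =
    >>=-single (λ u → m′ >>= λ v → c u v ⟫ return (g u v)) p (>>=-return (c u) (g u) q)

  eval-det : ∀ {Γ τ} (t : Term Γ τ) → FlipFree t → ∀ ρ → eval t ρ ≡ single (time t ρ) (det t ρ)
  eval-det (var i)      _       ρ = refl
  eval-det (let′ s t)   (p , q) ρ = >>=-single (λ u → 1 ⟫ eval t (u ∷ ρ)) (eval-det s p ρ) (⟫-single 1 (eval-det t q _))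
  eval-det unit         _       ρ = refl
  eval-det (pair s t)   (p , q) ρ = >>=-return₂ (λ _ _ → 1) _,_ (eval-det s p ρ) (eval-det t q ρ)
  eval-det (fst t)      p       ρ = >>=-return (λ _ → 1) proj₁ (eval-det t p ρ)
  eval-det (snd t)      p       ρ = >>=-return (λ _ → 1) proj₂ (eval-det t p ρ)
  eval-det (inl t)      p       ρ = >>=-return (λ _ → 1) inj₁ (eval-det t p ρ)
  eval-det (inr t)      p       ρ = >>=-return (λ _ → 1) inj₂ (eval-det t p ρ)
  eval-det (case r s t) (p , q , o) ρ with det r ρ | eval-det r p ρ
  ... | inj₁ u | eq = trans (single->>= _ eq) (⟫-single (time r ρ) (⟫-single 1 (eval-det s q (u ∷ ρ))))
  ... | inj₂ v | eq = trans (single->>= _ eq) (⟫-single (time r ρ) (⟫-single 1 (eval-det t o (v ∷ ρ))))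
  eval-det nil          _       ρ = refl
  eval-det (cons s t)   (p , q) ρ = >>=-return₂ (λ _ _ → 1) _∷_ (eval-det s p ρ) (eval-det t q ρ)
  eval-det (uncons t)   p       ρ with det t ρ | eval-det t p ρ
  ... | []    | eq = single->>= _ eq
  ... | _ ∷ _ | eq = single->>= _ eq
  eval-det (fold r s t) (p , q , o) ρ =
      >>=-single (λ xs → eval s ρ >>= λ b → 1 ⟫ foldM f b xs) (eval-det r p ρ)
        (>>=-single (λ b → 1 ⟫ foldM f b (det r ρ)) (eval-det s q ρ) (⟫-single 1 (go (det r ρ))))
    where
    f = λ x b → eval t (x ∷ b ∷ ρ)
    go : ∀ xs → foldM f (det s ρ) xs
                ≡ single (foldTime (λ x b → time t (x ∷ b ∷ ρ)) (λ x b → det t (x ∷ b ∷ ρ)) (det s ρ) xs)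
                         (List.foldr (λ x b → det t (x ∷ b ∷ ρ)) (det s ρ) xs)
    go []       = refl
    go (x ∷ xs) = >>=-single (λ b → 1 ⟫ f x b) (go xs) (⟫-single 1 (eval-det t o _))
  eval-det zero#        _       ρ = refl
  eval-det one#         _       ρ = refl
  eval-det (add s t)    (p , q) ρ = >>=-return₂ (λ x y → suc (height x ℕ.+ height y)) _+_ (eval-det s p ρ) (eval-det t q ρ)
  eval-det (mul s t)    (p , q) ρ = >>=-return₂ (λ x y → suc (height x ℕ.+ height y)) _*_ (eval-det s p ρ) (eval-det t q ρ)
  eval-det (neg t)      p       ρ = >>=-return (suc ∘ height) -_ (eval-det t p ρ)
  eval-det (inv t)      p       ρ = >>=-return (suc ∘ height) _⁻¹ (eval-det t p ρ)
  eval-det (leq s t)    (p , q) ρ = >>=-return₂ (λ x y → suc (height x ℕ.+ height y)) (λ x y → toVal (does (x ≤? y))) (eval-det s p ρ) (eval-det t q ρ)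
  eval-det (same s t)   (p , q) ρ = >>=-return₂ (λ _ _ → 1) (λ d e → toVal (does (d Fin.≟ e))) (eval-det s p ρ) (eval-det t q ρ)
  eval-det (indep t)    p       ρ = >>=-return (suc ∘ length) (λ es → toVal (does (independent? (toSet es)))) (eval-det t p ρ)

  -- Field-valued, in contrast to `expectation`, and hence linear without side conditions. The two
  -- are connected by `expectation-finite`.
  Ex : ∀ {A : Set} → (A → Carrier) → Run A → Carrier
  Ex f []                = 0#
  Ex f ((p , _ , v) ∷ m) = p * f v + Ex f m

  Ex-ext : ∀ {A : Set} {f g : A → Carrier} → (∀ v → f v ≡ g v) → ∀ m → Ex f m ≡ Ex g m
  Ex-ext f≡g []                = refl
  Ex-ext f≡g ((p , _ , v) ∷ m) = cong₂ _+_ (cong (p *_) (f≡g v)) (Ex-ext f≡g m)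

  Ex-++ : ∀ {A : Set} (f : A → Carrier) m m′ → Ex f (m ++ m′) ≡ Ex f m + Ex f m′
  Ex-++ f []                m′ = sym (+-identityˡ _)
  Ex-++ f ((p , _ , v) ∷ m) m′ = trans (cong (p * f v +_) (Ex-++ f m m′)) (sym (+-assoc _ _ _))

  Ex-⟫ : ∀ {A : Set} (f : A → Carrier) s m → Ex f (s ⟫ m) ≡ Ex f m
  Ex-⟫ f s []                = refl
  Ex-⟫ f s ((p , _ , v) ∷ m) = cong (p * f v +_) (Ex-⟫ f s m)

  Ex-single : ∀ {A : Set} (f : A → Carrier) {m s v} → m ≡ single s v → Ex f m ≡ f v
  Ex-single f {v = v} refl = trans (+-identityʳ _) (*-identityˡ (f v))

  Ex-scale : ∀ {A : Set} (f : A → Carrier) p s m →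
             Ex f (List.map (λ (q , t , v) → p * q , s ℕ.+ t , v) m) ≡ p * Ex f m
  Ex-scale f p s []                = sym (zeroʳ p)
  Ex-scale f p s ((q , t , v) ∷ m) = trans (cong₂ _+_ (*-assoc p q (f v)) (Ex-scale f p s m))
                                           (sym (distribˡ p _ _))

  Ex->>= : ∀ {A B : Set} (f : B → Carrier) m (k : A → Run B) → Ex f (m >>= k) ≡ Ex (λ u → Ex f (k u)) m
  Ex->>= f []                k = refl
  Ex->>= f ((p , s , u) ∷ m) k = trans (Ex-++ f (List.map (λ (q , t , v) → p * q , s ℕ.+ t , v) (k u)) (m >>= k))
    (cong₂ _+_ (Ex-scale f p s (k u)) (Ex->>= f m k))

  Ex-bernoulli : ∀ (f : Val bool → Carrier) x →
    Ex f (bernoulli x) ≡ clip x * f (inj₁ tt) + (1# - clip x) * f (inj₂ tt)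
  Ex-bernoulli f x = cong (clip x * f (inj₁ tt) +_) (+-identityʳ _)

  Ex-+ : ∀ {A : Set} (f g : A → Carrier) m → Ex (λ v → f v + g v) m ≡ Ex f m + Ex g m
  Ex-+ f g []                = sym (+-identityˡ 0#)
  Ex-+ f g ((p , _ , v) ∷ m) = trans (cong (p * (f v + g v) +_) (Ex-+ f g m))
    (solve 5 (λ p a b c d → p :* (a :+ b) :+ (c :+ d) := p :* a :+ c :+ (p :* b :+ d)) refl p (f v) (g v) (Ex f m) (Ex g m))

  Ex-* : ∀ {A : Set} c (f : A → Carrier) m → Ex (λ v → c * f v) m ≡ c * Ex f m
  Ex-* c f []                = sym (zeroʳ c)
  Ex-* c f ((p , _ , v) ∷ m) = trans (cong (p * (c * f v) +_) (Ex-* c f m))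
    (solve 4 (λ p c a b → p :* (c :* a) :+ c :* b := c :* (p :* a :+ b)) refl p c (f v) (Ex f m))

  -- Every listed outcome is constrained, those of probability zero included, so that composing runs
  -- needs no case distinction on probabilities. Nonnegative probabilities make `Ex` monotone, and
  -- `mass` gives the expectation of constants.
  record Spec {A : Set} (m : Run A) (b : ℕ) (Q : A → Set) : Set where
    constructor spec
    field
      outcomes : All (λ (p , s , v) → 0# ≤ p × s ℕ.≤ b × Q v) m
      mass     : Ex (λ _ → 1#) m ≡ 1#
  open Spec public

  spec-single : ∀ {A : Set} {m : Run A} {b s v} {Q : A → Set} → m ≡ single s v → s ℕ.≤ b → Q v → Spec m b Q
  spec-single {s = s} {v} refl s≤b q = spec ((0≤1 , s≤b , q) ∷ []) (Ex-single (λ _ → 1#) {single s v} refl)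

  spec-⟫ : ∀ {A : Set} {m : Run A} {b} {Q : A → Set} s → Spec m b Q → Spec (s ⟫ m) (s ℕ.+ b) Q
  spec-⟫ {m = m} s (spec o μ) =
    spec (All.map⁺ (All.map (λ (p , q , r) → p , ℕ.+-monoʳ-≤ s q , r) o)) (trans (Ex-⟫ (λ _ → 1#) s m) μ)

  spec-weaken : ∀ {A : Set} {m : Run A} {b c} {P Q : A → Set} → b ℕ.≤ c → (∀ {v} → P v → Q v) →
                Spec m b P → Spec m c Q
  spec-weaken b≤c P⇒Q (spec o μ) = spec (All.map (λ (p , q , r) → p , ℕ.≤-trans q b≤c , P⇒Q r) o) μ

  Ex-mono : ∀ {A : Set} {m : Run A} {b} {Q : A → Set} {f g : A → Carrier} → Spec m b Q →
            (∀ {v} → Q v → f v ≤ g v) → Ex f m ≤ Ex g m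
  Ex-mono {Q = Q} {f} {g} (spec o _) f≤g = go o
    where
    go : ∀ {m} {b} → All (λ (p , s , v) → 0# ≤ p × s ℕ.≤ b × Q v) m → Ex f m ≤ Ex g m
    go []                  = ≤-refl
    go ((p , _ , q) ∷ o) = +-mono-≤ (*-monoˡ-≤ p (f≤g q)) (go o)

  Ex-cong : ∀ {A : Set} {m : Run A} {b} {Q : A → Set} {f g : A → Carrier} → Spec m b Q →
            (∀ {v} → Q v → f v ≡ g v) → Ex f m ≡ Ex g m
  Ex-cong S f≡g = antisym (Ex-mono S (≤-reflexive ∘ f≡g)) (Ex-mono S (≤-reflexive ∘ sym ∘ f≡g))

  Ex-const : ∀ {A : Set} {m : Run A} {b} {Q : A → Set} → Spec m b Q → ∀ c → Ex (λ _ → c) m ≡ c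
  Ex-const {m = m} S c = begin
    Ex (λ _ → c) m       ≡⟨ Ex-cong S (λ _ → sym (*-identityʳ c)) ⟩
    Ex (λ _ → c * 1#) m  ≡⟨ Ex-* c _ m ⟩
    c * Ex (λ _ → 1#) m  ≡⟨ cong (c *_) (mass S) ⟩
    c * 1#               ≡⟨ *-identityʳ c ⟩
    c                    ∎
    where open ≡-Reasoning

  spec->>= : ∀ {A B : Set} {m : Run A} (k : A → Run B) {b c} {P : A → Set} {Q : B → Set} →
             Spec m b P → (∀ {u} → P u → Spec (k u) c Q) → Spec (m >>= k) (b ℕ.+ c) Q
  spec->>= {m = m} k {b} {c} {P} {Q} S K = spec (go (outcomes S))
      (trans (Ex->>= (λ _ → 1#) m k) (trans (Ex-cong {f = λ u → Ex (λ _ → 1#) (k u)} S (λ q → mass (K q))) (mass S)))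
    where
    go : ∀ {m} → All (λ (p , s , v) → 0# ≤ p × s ℕ.≤ b × P v) m →
         All (λ (p , s , v) → 0# ≤ p × s ℕ.≤ b ℕ.+ c × Q v) (m >>= k)
    go []                  = []
    go ((p , s , q) ∷ o) = All.++⁺
      (All.map⁺ (All.map (λ (p′ , s′ , q′) → *-nonNeg p p′ , ℕ.+-mono-≤ s s′ , q′) (outcomes (K q))))
      (go o)

  spec-bernoulli : ∀ {Q : Val bool → Set} x → (∀ b → Q b) → Spec (bernoulli x) 0 Q
  spec-bernoulli x q = spec
    ((clip-nonNeg x , z≤n , q _) ∷ (x≤y⇒0≤y-x (clip-≤1 x) , z≤n , q _) ∷ [])
    (trans (Ex-bernoulli (λ _ → 1#) x) (trans (cong₂ _+_ (*-identityʳ _) (*-identityʳ _)) (x+[1-x]≡1 _)))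

  -- Folding starts at the end of the list, so `P xs b` describes the accumulator once the suffix
  -- `xs` is processed. `W` is a condition on lists that passes to tails, such as the constraints
  -- between consecutive rows.
  spec-foldM : ∀ {A B : Set} {f : A → B → Run B} {b₀ c} (W : List A → Set) (P : List A → B → Set) →
               (∀ {x xs} → W (x ∷ xs) → W xs) → P [] b₀ →
               (∀ {x xs b} → W (x ∷ xs) → P xs b → Spec (f x b) c (P (x ∷ xs))) →
               ∀ xs → W xs → Spec (foldM f b₀ xs) (length xs ℕ.* (suc c)) (P xs)
  spec-foldM W P tail base step []       w = spec-single refl z≤n base
  spec-foldM {f = f} {c = c} W P tail base step (x ∷ xs) w = spec-weaken
    (ℕ.≤-reflexive (ℕ.+-comm (length xs ℕ.* suc c) (suc c))) (λ q → q)
    (spec->>= (λ b → 1 ⟫ f x b) (spec-foldM W P tail base step xs (tail w)) (λ q → spec-⟫ 1 (step w q)))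

  Ex-foldM-∷ : ∀ {A B : Set} (f : A → B → Run B) b₀ x xs (g : B → Carrier) →
    Ex g (foldM f b₀ (x ∷ xs)) ≡ Ex (λ b → Ex g (f x b)) (foldM f b₀ xs)
  Ex-foldM-∷ f b₀ x xs g = trans (Ex->>= g (foldM f b₀ xs) (λ b → 1 ⟫ f x b))
    (Ex-ext (λ b → Ex-⟫ g 1 (f x b)) (foldM f b₀ xs))

  foldr-spec : ∀ {A B : Set} {τ : A → B → ℕ} {f : A → B → B} {b₀ c} (W : List A → Set) (P : List A → B → Set) →
               (∀ {x xs} → W (x ∷ xs) → W xs) → P [] b₀ →
               (∀ {x xs b} → W (x ∷ xs) → P xs b → τ x b ℕ.≤ c × P (x ∷ xs) (f x b)) →
               ∀ xs → W xs → foldTime τ f b₀ xs ℕ.≤ length xs ℕ.* suc c × P xs (List.foldr f b₀ xs)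
  foldr-spec W P tail base step []       w = z≤n , base
  foldr-spec {c = c} W P tail base step (x ∷ xs) w with foldr-spec W P tail base step xs (tail w)
  ... | t , p with step w p
  ...   | t′ , p′ = ℕ.≤-trans (ℕ.+-mono-≤ t (s≤s t′)) (ℕ.≤-reflexive (ℕ.+-comm _ (suc c))) , p′

-- The rounding program.

EntryTy RowTy SlotTy StateTy : Ty
EntryTy = elt ⊗ cost∞ ⊗ num ⊗ num
RowTy   = list EntryTy
-- A row of the input with the set chosen so far for its time step.
SlotTy  = RowTy ⊗ list elt
-- The state of the walk of one element: whether it is chosen at the following time step, its mass
-- there, and the slots already updated.
StateTy = bool ⊗ num ⊗ list SlotTy

v0 : ∀ {Γ a} → Term (a ∷ Γ) a
v0 = var (here refl)
v1 : ∀ {Γ a b} → Term (a ∷ b ∷ Γ) b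
v1 = var (there (here refl))
v2 : ∀ {Γ a b c} → Term (a ∷ b ∷ c ∷ Γ) c
v2 = var (there (there (here refl)))
v3 : ∀ {Γ a b c d} → Term (a ∷ b ∷ c ∷ d ∷ Γ) d
v3 = var (there (there (there (here refl))))
v4 : ∀ {Γ a b c d e} → Term (a ∷ b ∷ c ∷ d ∷ e ∷ Γ) e
v4 = var (there (there (there (there (here refl)))))
v5 : ∀ {Γ a b c d e f} → Term (a ∷ b ∷ c ∷ d ∷ e ∷ f ∷ Γ) f
v5 = var (there (there (there (there (there (here refl))))))
v6 : ∀ {Γ a b c d e f g} → Term (a ∷ b ∷ c ∷ d ∷ e ∷ f ∷ g ∷ Γ) g
v6 = var (there (there (there (there (there (there (here refl)))))))

-- Rows are lists, so the entry of an element is found by scanning; `i` points to the element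
-- sought. The default, reached only if the row lacks the element, has mass zero and infinite cost.
findT : ∀ {Γ} → (elt ⊗ num) ∈ₗ Γ → Term Γ RowTy → Term Γ EntryTy
findT i row = fold row (pair (fst (var i)) (pair (inl unit) (pair zero# zero#)))
  (case (same (fst v0) (fst (var (there (there i))))) v1 v2)

greedyT : ∀ {Γ} → Term Γ (list elt) → Term Γ (list elt)
greedyT xs = fold xs nil (case (indep (cons v0 v1)) (cons v1 v2) v2)

-- The bit tells whether the number of entries seen is odd, and every second entry is kept.
halveT : ∀ {Γ σ} → Term Γ (list σ) → Term Γ (bool ⊗ list σ)
halveT xs = fold xs (pair (inr unit) nil)
  (case (fst v1) (pair (inr unit) (cons v1 (snd v2))) (pair (inl unit) (snd v2)))

bitsStepT : ∀ {Γ a σ} → Term (a ∷ (list σ ⊗ list 𝟙) ∷ Γ) (list σ ⊗ list 𝟙)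
bitsStepT = case (uncons (fst v1)) v2 (pair (snd (halveT (fst v2))) (cons unit (snd v2)))

-- A list of length 1 + ⌊log₂ m⌋ from a list of length m ≥ 1.
bitsT : ∀ {Γ σ} → Term Γ (list σ) → Term Γ (list 𝟙)
bitsT xs = let′ xs (snd (fold v0 (pair v0 nil) bitsStepT))

elementsT : Term (InputTy ∷ []) (list elt)
elementsT = fold (fst v0) nil (cons (fst v0) v1)

-- Counters are lists, and only their lengths matter. The greedy base has length r and the rows
-- number T, so concatenating the two logarithms yields L with rT ≤ 2 ^ L ≤ 4rT.
roundsT : Term (InputTy ∷ []) (list 𝟙)
roundsT = fold (bitsT (greedyT elementsT)) (bitsT (snd v0)) (cons v0 v1)

-- The probability that an element is chosen at time t - 1, given whether it is
-- chosen at time t: consecutive choices are coupled so as to agree as often as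
-- their marginals allow.  Arbitrary under a condition of probability zero.
coinT : ∀ {Γ} → Term (SlotTy ∷ StateTy ∷ (elt ⊗ num) ∷ Γ) num
coinT = let′ (snd (snd (snd (findT (there (there (here refl))) (fst v0)))))
  (case (fst v2)
    (mul v1 (inv (fst (snd v3))))
    (mul (add v1 (neg (fst (snd v3)))) (inv (add one# (neg (fst (snd v3)))))))

-- An element of mass zero is rejected even in the outcomes of probability zero, so
-- that no chosen set contains an element of infinite cost if the LP value is finite.
updateT : ∀ {Γ} → Term (bool ∷ SlotTy ∷ StateTy ∷ (elt ⊗ num) ∷ Γ) StateTy
updateT = let′ (snd (snd (snd (findT (there (there (there (here refl)))) (fst v1)))))
  (let′ (case (leq v0 zero#) (inr unit) v2)
    (pair v0 (pair v1 (cons (pair (fst v3) (case v0 (cons (fst v6) (snd v4)) (snd v4))) (snd (snd v4))))))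

-- The walk begins at the fictitious step after the last one, with mass zero and the element not
-- chosen, and proceeds towards the first time step.
chainT : ∀ {Γ} → Term ((elt ⊗ num) ∷ list SlotTy ∷ Γ) (list SlotTy)
chainT = snd (snd (fold v1 (pair (inr unit) (pair zero# nil)) (let′ (flip coinT) updateT)))

slotsT : ∀ {Γ} → Term (list 𝟙 ∷ InputTy ∷ Γ) (list SlotTy)
slotsT = fold (snd v1) nil (cons (pair v0 nil) v1)

sampleT : ∀ {Γ} → Term (list 𝟙 ∷ InputTy ∷ Γ) (list SlotTy)
sampleT = fold v0 slotsT (fold (fst v3) v1 chainT)

-- An infinite cost counts as 0. In the budget it is multiplied by the mass, and `augmentT` skips
-- mass zero; so it can matter only for an element of positive mass and infinite cost, which makes
-- the linear program infinite.
weightT : ∀ {Γ} → Term Γ EntryTy → Term Γ (elt ⊗ num) → Term Γ num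
weightT x e = add (snd e) (case (fst (snd x)) zero# v0)

budgetT : ∀ {Γ a b c} → Term (SlotTy ∷ a ∷ b ∷ c ∷ InputTy ∷ Γ) num
budgetT = fold (fst v4) zero# (let′ (findT (here refl) (fst v2))
  (add (mul (snd (snd (snd v0))) (weightT v0 v1)) v2))

augmentT : ∀ {Γ} → Term ((elt ⊗ num) ∷ list elt ∷ num ∷ SlotTy ∷ Γ) (list elt)
augmentT = let′ (findT (here refl) (fst v3))
  (case (leq (snd (snd (snd v0))) zero#) v3
    (case (leq (weightT v1 v2) v4)
      (case (indep (cons (fst v3) (greedyT v4))) (cons (fst v4) v5) v5)
      v4))

repairT : ∀ {Γ a b c} → Term (SlotTy ∷ a ∷ b ∷ c ∷ InputTy ∷ Γ) (list elt)
repairT = let′ budgetT (fold (fst v5) (snd v1) augmentT)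

repairAllT : Term (list SlotTy ∷ list 𝟙 ∷ InputTy ∷ []) OutputTy
repairAllT = fold v0 nil (cons repairT v1)

rounding : Procedure
rounding = let′ roundsT (let′ sampleT repairAllT)

-- Binary logarithms of list lengths by repeated halving.

halve : ∀ {A : Set} → List A → (⊤ ⊎ ⊤) × List A
halve = List.foldr (λ x (b , ys) → [ (λ _ → inj₂ tt , x ∷ ys) , (λ _ → inj₁ tt , ys) ]′ b) (inj₂ tt , [])

bitsStep : ∀ {A : Set} → List A × List ⊤ → List A × List ⊤
bitsStep ([] , out)         = [] , out
bitsStep (xs@(_ ∷ _) , out) = proj₂ (halve xs) , tt ∷ out

bits : ∀ {A : Set} → List A → List ⊤
bits xs = proj₂ (List.foldr (λ _ → bitsStep) (xs , []) xs)

length-halve : ∀ {A : Set} (xs : List A) →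
  length xs ≡ 2 ℕ.* length (proj₂ (halve xs)) ℕ.+ [ (λ _ → 1) , (λ _ → 0) ]′ (proj₁ (halve xs))
length-halve [] = refl
length-halve (x ∷ xs) with halve xs | length-halve xs
... | inj₁ tt , ys | eq = trans (cong suc eq) (lemma (length ys))
  where
  lemma : ∀ k → suc (2 ℕ.* k ℕ.+ 1) ≡ 2 ℕ.* suc k ℕ.+ 0
  lemma = solve-∀
... | inj₂ tt , ys | eq = trans (cong suc eq) (lemma (length ys))
  where
  lemma : ∀ k → suc (2 ℕ.* k ℕ.+ 0) ≡ 2 ℕ.* k ℕ.+ 1
  lemma = solve-∀

length-halve-lower : ∀ {A : Set} (xs : List A) → 2 ℕ.* length (proj₂ (halve xs)) ℕ.≤ length xs
length-halve-lower xs rewrite length-halve xs = ℕ.m≤m+n _ _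

length-halve-upper : ∀ {A : Set} (xs : List A) → length xs ℕ.< 2 ℕ.* suc (length (proj₂ (halve xs)))
length-halve-upper xs rewrite length-halve xs = ℕ.≤-trans (s≤s (ℕ.+-monoʳ-≤ _ (bit≤1 (proj₁ (halve xs)))))
    (ℕ.≤-reflexive (lemma (length (proj₂ (halve xs)))))
  where
  bit≤1 : ∀ (b : ⊤ ⊎ ⊤) → [ (λ _ → 1) , (λ _ → 0) ]′ b ℕ.≤ 1
  bit≤1 (inj₁ _) = ℕ.≤-refl
  bit≤1 (inj₂ _) = z≤n
  lemma : ∀ k → suc (2 ℕ.* k ℕ.+ 1) ≡ 2 ℕ.* suc k
  lemma = solve-∀

foldr-∷≡map : ∀ {A B : Set} (f : A → B) xs → List.foldr (λ x ys → f x ∷ ys) [] xs ≡ List.map f xs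
foldr-∷≡map f []       = refl
foldr-∷≡map f (x ∷ xs) = cong (f x ∷_) (foldr-∷≡map f xs)

-- After `i` halvings, some of them possibly idle: `lower` and `upper` say that `m` is the integer
-- part of `N / k`. An active step starts from `m` at least 1, hence from `k ≤ N`, and doubles `k`,
-- which gives `log`. It also lowers `m`, so by `fuel` nothing is left after `N` steps; this is why
-- the list itself can serve as the counter.
record BitsInvariant {A : Set} (N i : ℕ) (s : List A × List ⊤) : Set where
  constructor bitsInvariant
  private
    k = 2 ℕ.^ length (proj₂ s)
    m = length (proj₁ s)
  field
    lower : k ℕ.* m ℕ.≤ N
    upper : N ℕ.< k ℕ.* suc m
    log   : k ℕ.≤ 2 ℕ.* N
    fuel  : m ≡ 0 ⊎ m ℕ.+ i ℕ.≤ N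
    short : length (proj₂ s) ℕ.≤ i

bitsStep-invariant : ∀ {A : Set} {N i} {s : List A × List ⊤} →
  BitsInvariant N i s → BitsInvariant N (suc i) (bitsStep s)
bitsStep-invariant {s = [] , out} (bitsInvariant l u g f s) = bitsInvariant l u g (inj₁ refl) (ℕ.m≤n⇒m≤1+n s)
bitsStep-invariant {N = N} {i} {xs@(_ ∷ xs′) , out} (bitsInvariant l u g (inj₂ f) s) = bitsInvariant
    (ℕ.≤-trans (ℕ.≤-reflexive (lemma K h)) (ℕ.≤-trans (ℕ.*-monoʳ-≤ K (length-halve-lower xs)) l))
    (ℕ.<-≤-trans u (ℕ.≤-trans (ℕ.*-monoʳ-≤ K (length-halve-upper xs)) (ℕ.≤-reflexive (sym (lemma K (suc h))))))
    (ℕ.*-monoʳ-≤ 2 (ℕ.≤-trans (ℕ.m≤m*n K (length xs)) l))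
    (inj₂ (ℕ.≤-trans (ℕ.≤-reflexive (ℕ.+-suc h i)) (ℕ.≤-trans (ℕ.+-monoˡ-≤ i h<m) f)))
    (s≤s s)
  where
  K = 2 ℕ.^ length out
  h = length (proj₂ (halve xs))
  lemma : ∀ K h → 2 ℕ.* K ℕ.* h ≡ K ℕ.* (2 ℕ.* h)
  lemma = solve-∀
  h<m : h ℕ.< length xs
  h<m with h | length-halve-lower xs
  ... | zero  | _ = s≤s z≤n
  ... | suc k | p = ℕ.≤-trans (s≤s (s≤s (ℕ.m≤m+n k (k ℕ.+ 0)))) (ℕ.≤-trans (ℕ.≤-reflexive (lemma′ k)) p)
    where
    lemma′ : ∀ k → suc (suc (k ℕ.+ (k ℕ.+ 0))) ≡ 2 ℕ.* suc k
    lemma′ = solve-∀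

bits-invariant : ∀ {A : Set} (xs : List A) → 1 ℕ.≤ length xs → ∀ (ys : List A) →
  BitsInvariant (length xs) (length ys) (List.foldr (λ _ → bitsStep) (xs , []) ys)
bits-invariant xs 1≤ []       = bitsInvariant (ℕ.≤-reflexive (ℕ.*-identityˡ _)) (ℕ.≤-reflexive (sym (ℕ.*-identityˡ _)))
  (ℕ.≤-trans 1≤ (ℕ.m≤m+n _ _)) (inj₂ (ℕ.≤-reflexive (ℕ.+-identityʳ _))) z≤n
bits-invariant xs 1≤ (y ∷ ys) = bitsStep-invariant (bits-invariant xs 1≤ ys)

bits-upper : ∀ {A : Set} (xs : List A) → 1 ℕ.≤ length xs → length xs ℕ.< 2 ℕ.^ length (bits xs)
bits-upper xs 1≤ with List.foldr (λ _ → bitsStep) (xs , []) xs | bits-invariant xs 1≤ xs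
... | [] , out | I = ℕ.<-≤-trans (BitsInvariant.upper I) (ℕ.≤-reflexive (ℕ.*-identityʳ _))
... | _ ∷ _ , out | bitsInvariant _ _ _ (inj₂ f) _ = ⊥-elim (ℕ.m+1+n≰m _ (ℕ.≤-trans (ℕ.≤-reflexive (trans (ℕ.+-suc _ _) (cong suc (ℕ.+-comm (length xs) _)))) f))

bits-lower : ∀ {A : Set} (xs : List A) → 1 ℕ.≤ length xs → 2 ℕ.^ length (bits xs) ℕ.≤ 2 ℕ.* length xs
bits-lower xs 1≤ = BitsInvariant.log (bits-invariant xs 1≤ xs)

length-bits≤ : ∀ {A : Set} (xs : List A) → length (bits xs) ℕ.≤ length xs
length-bits≤ []          = z≤n
length-bits≤ xs@(_ ∷ _) = BitsInvariant.short (bits-invariant xs (s≤s z≤n) xs)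

-- The values computed by the deterministic parts.

module ProgramValues {F : OrderedField} (H : Height F) {n : ℕ} (M : Matroid n) where
  open FieldProperties F
  open Matroid M
  open MatroidProperties M
  open Semantics H M
  open RunProperties H M

  Entry Row Slot : Set
  Entry = Val EntryTy
  Row   = Val RowTy
  Slot  = Val SlotTy

  find : Fin n → Row → Entry
  find e = List.foldr (λ x y → [ (λ _ → x) , (λ _ → y) ]′ (toVal (does (proj₁ x Fin.≟ e)))) (e , inj₁ tt , 0# , 0#)

  zAt : Row → Fin n → Carrier
  zAt row e = proj₂ (proj₂ (proj₂ (find e row)))

  cAt : Row → Fin n → Carrier
  cAt row e = [ (λ _ → 0#) , (λ x → x) ]′ (proj₁ (proj₂ (find e row)))

  newBit : Row → Fin n → Val bool → Val bool
  newBit row e b = [ (λ _ → inj₂ tt) , (λ _ → b) ]′ (toVal (does (zAt row e ≤? 0#)))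

  extend : Val bool → Fin n → List (Fin n) → List (Fin n)
  extend b e S = [ (λ _ → e ∷ S) , (λ _ → S) ]′ b

  -- After clipping these are min(z, z′) / z and max(z′ - z, 0) / (1 - z): the transition
  -- probabilities of the maximal coupling of two Bernoulli variables, where `z` is the mass at the
  -- later time step and `z′` the mass at the earlier one.
  condProb : Val bool → Carrier → Carrier → Carrier
  condProb (inj₁ _) z z′ = z′ * z ⁻¹
  condProb (inj₂ _) z z′ = (z′ - z) * (1# - z) ⁻¹

  det-coin : ∀ {Γ} s b z out e (ρ : Env Γ) →
    det coinT (s ∷ (b , z , out) ∷ e ∷ ρ) ≡ condProb b z (zAt (proj₁ s) (proj₁ e))
  det-coin s (inj₁ _) z out e ρ = refl
  det-coin s (inj₂ _) z out e ρ = refl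

  det-greedy : ∀ {Γ} (t : Term Γ (list elt)) (ρ : Env Γ) → det (greedyT t) ρ ≡ greedy (det t ρ)
  det-greedy t ρ = List.foldr-cong step refl (det t ρ)
    where
    step : ∀ x b → [ (λ _ → x ∷ b) , (λ _ → b) ]′ (toVal (does (independent? (setOf (x ∷ b))))) ≡ greedyStep x b
    step x b with independent? (setOf (x ∷ b))
    ... | yes _ = refl
    ... | no  _ = refl

  det-bitsStep : ∀ {Γ a σ} x s (ρ : Env Γ) → det (bitsStepT {Γ} {a} {σ}) (x ∷ s ∷ ρ) ≡ bitsStep s
  det-bitsStep x ([] , _)    ρ = refl
  det-bitsStep x (_ ∷ _ , _) ρ = refl

  det-bits : ∀ {Γ σ} (t : Term Γ (list σ)) (ρ : Env Γ) → det (bitsT t) ρ ≡ bits (det t ρ)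
  det-bits {Γ} {σ} t ρ = cong proj₂ (List.foldr-cong
    (λ x s → det-bitsStep {list σ ∷ Γ} {σ} {σ} x s (det t ρ ∷ ρ)) refl (det t ρ))

  elements : Val InputTy → List (Fin n)
  elements i = List.map proj₁ (proj₁ i)

  det-elements : ∀ i → det elementsT (i ∷ []) ≡ elements i
  det-elements i = foldr-∷≡map proj₁ (proj₁ i)

  rounds : Val InputTy → List ⊤
  rounds i = bits (greedy (elements i)) ++ bits (proj₂ i)

  det-rounds : ∀ i → det roundsT (i ∷ []) ≡ rounds i
  det-rounds i = trans (sym (List.++-is-foldr (det (bitsT (greedyT elementsT)) (i ∷ [])) _))
    (cong₂ _++_ (trans (det-bits (greedyT elementsT) (i ∷ []))
                  (cong bits (trans (det-greedy elementsT (i ∷ [])) (cong greedy (det-elements i)))))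
                (det-bits {InputTy ∷ []} {RowTy} (snd v0) (i ∷ [])))

  emptySlots : List Row → List Slot
  emptySlots = List.map (_, [])

  det-slots : ∀ {Γ} u i (ρ : Env Γ) → det slotsT (u ∷ i ∷ ρ) ≡ emptySlots (proj₂ i)
  det-slots u i ρ = foldr-∷≡map (_, []) (proj₂ i)

  weight : Row → Fin n × Carrier → Carrier
  weight row (e , a) = a + cAt row e

  budget : List (Fin n × Carrier) → Row → Carrier
  budget es row = List.foldr (λ e b → zAt row (proj₁ e) * weight row e + b) 0# es

  augment : Row → Carrier → Fin n × Carrier → List (Fin n) → List (Fin n)
  augment row V e S =
    if does (zAt row (proj₁ e) ≤? 0#) then S else
    if does (weight row e ≤? V) then
      (if does (independent? (setOf (proj₁ e ∷ greedy S))) then proj₁ e ∷ S else S)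
    else S

  det-augment : ∀ {Γ} e S V s (ρ : Env Γ) → det augmentT (e ∷ S ∷ V ∷ s ∷ ρ) ≡ augment (proj₁ s) V e S
  det-augment {Γ} e S V s ρ with zAt (proj₁ s) (proj₁ e) ≤? 0#
  ... | yes _ = refl
  ... | no _ with weight (proj₁ s) e ≤? V
  ...   | no _ = refl
  ...   | yes _ rewrite det-greedy {𝟙 ∷ 𝟙 ∷ EntryTy ∷ (elt ⊗ num) ∷ list elt ∷ num ∷ SlotTy ∷ Γ} v4 (tt ∷ tt ∷ find (proj₁ e) (proj₁ s) ∷ e ∷ S ∷ V ∷ s ∷ ρ)
          with independent? (setOf (proj₁ e ∷ greedy S))
  ...     | yes _ = refl
  ...     | no _  = refl

  repair : List (Fin n × Carrier) → Slot → List (Fin n)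
  repair es (row , S) = List.foldr (augment row (budget es row)) S es

  det-repair : ∀ {Γ a b c} s u v w i (ρ : Env Γ) →
    det (repairT {Γ} {a} {b} {c}) (s ∷ u ∷ v ∷ w ∷ i ∷ ρ) ≡ repair (proj₁ i) s
  det-repair {Γ} {a} {b} {c} s u v w i ρ = List.foldr-cong
    (λ e S → det-augment {a ∷ b ∷ c ∷ InputTy ∷ Γ} e S (budget (proj₁ i) (proj₁ s)) s (u ∷ v ∷ w ∷ i ∷ ρ)) refl (proj₁ i)

  det-repairAll : ∀ ss u i → det repairAllT (ss ∷ u ∷ i ∷ []) ≡ List.map (repair (proj₁ i)) ss
  det-repairAll ss u i = trans
    (List.foldr-cong (λ s b → cong (_∷ b) (det-repair {[]} {OutputTy} {list SlotTy} {list 𝟙} s b ss u i [])) refl ss) (foldr-∷≡map (repair (proj₁ i)) ss)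

-- Polynomial bounds on the running time.

-- Bounds of the form k * B ^ d, where the coefficient k is left to be computed
-- by unification.
module PowerBounds (B : ℕ) .{{_ : NonZero B}} where
  infix 4 _≼_·B^_
  record _≼_·B^_ (x k d : ℕ) : Set where
    constructor bound
    field
      unbound : x ℕ.≤ k ℕ.* B ℕ.^ d
  open _≼_·B^_ public

  infixr 6 _⊞_
  infixr 7 _⊠_

  below : ∀ {x y k d} → x ℕ.≤ y → y ≼ k ·B^ d → x ≼ k ·B^ d
  below p (bound q) = bound (ℕ.≤-trans p q)

  constant : ∀ {d} c → c ≼ c ·B^ d
  constant {d} c = bound (ℕ.m≤m*n c (B ℕ.^ d) {{ℕ.m^n≢0 B d}})

  _⊞_ : ∀ {d x y k l} → x ≼ k ·B^ d → y ≼ l ·B^ d → x ℕ.+ y ≼ k ℕ.+ l ·B^ d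
  _⊞_ {d} {k = k} {l} (bound p) (bound q) =
    bound (ℕ.≤-trans (ℕ.+-mono-≤ p q) (ℕ.≤-reflexive (sym (ℕ.*-distribʳ-+ (B ℕ.^ d) k l))))

  _⊠_ : ∀ {d e x y k l} → x ≼ k ·B^ d → y ≼ l ·B^ e → x ℕ.* y ≼ k ℕ.* l ·B^ (d ℕ.+ e)
  _⊠_ {d} {e} {k = k} {l} (bound p) (bound q) = bound (ℕ.≤-trans (ℕ.*-mono-≤ p q) (ℕ.≤-reflexive
    (trans (lemma k l (B ℕ.^ d) (B ℕ.^ e)) (cong (k ℕ.* l ℕ.*_) (sym (ℕ.^-distribˡ-+-* B d e))))))
    where
    lemma : ∀ k l x y → k ℕ.* x ℕ.* (l ℕ.* y) ≡ k ℕ.* l ℕ.* (x ℕ.* y)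
    lemma = solve-∀

  base : ∀ {x} → x ℕ.≤ B → x ≼ 1 ·B^ 1
  base p = bound (ℕ.≤-trans p (ℕ.≤-reflexive (sym (trans (ℕ.+-identityʳ _) (ℕ.*-identityʳ B)))))

  -- Both side conditions compare numerals and are decided by evaluation; the coefficients aimed at
  -- are simply rounded up.
  enlarge : ∀ K D {k d x} {_ : T (k ℕ.≤ᵇ K)} {_ : T (d ℕ.≤ᵇ D)} → x ≼ k ·B^ d → x ≼ K ·B^ D
  enlarge K D {k} {d} {_} {k≤K} {d≤D} (bound p) = bound (ℕ.≤-trans p
    (ℕ.*-mono-≤ (ℕ.≤ᵇ⇒≤ k K k≤K) (ℕ.^-monoʳ-≤ B (ℕ.≤ᵇ⇒≤ d D d≤D))))

module TimeBounds {F : OrderedField} (H : Height F) {n : ℕ} (M : Matroid n) (B : ℕ) .{{_ : NonZero B}} where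
  open FieldProperties F
  open Height H
  open Matroid M
  open MatroidProperties M
  open Semantics H M
  open RunProperties H M
  open ProgramValues H M
  open PowerBounds B

  height-- : ∀ {x k d} → height x ≼ k ·B^ d → height (- x) ≼ k ·B^ d
  height-- {x} p = below (height-neg x) p

  height-⁻¹ : ∀ {x k d} → height x ≼ k ·B^ d → height (x ⁻¹) ≼ k ·B^ d
  height-⁻¹ {x} p = below (height-inv x) p

  height-add : ∀ {x y d k l} → height x ≼ k ·B^ d → height y ≼ l ·B^ d →
               height (x + y) ≼ (1 ℕ.+ (k ℕ.+ l)) ·B^ d
  height-add {x} {y} p q = below (height-+ x y) (constant 1 ⊞ p ⊞ q)

  height-mul : ∀ {x y d k l} → height x ≼ k ·B^ d → height y ≼ l ·B^ d →
               height (x * y) ≼ (k ℕ.+ l) ·B^ d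
  height-mul {x} {y} p q = below (height-* x y) (p ⊞ q)

  height-one : ∀ {d} → height 1# ≼ 0 ·B^ d
  height-one = bound (ℕ.≤-reflexive height-1)

  record SmallRow (row : Row) : Set where
    field
      row-length : length row ℕ.≤ B
      z-height   : ∀ e → height (zAt row e) ℕ.≤ B
      c-height   : ∀ e → height (cAt row e) ℕ.≤ B
  open SmallRow public

  []′-≼ : ∀ {A C : Set} {f : A → ℕ} {g : C → ℕ} {k d} x → (∀ u → f u ≼ k ·B^ d) → (∀ v → g v ≼ k ·B^ d) → [ f , g ]′ x ≼ k ·B^ d
  []′-≼ (inj₁ u) p q = p u
  []′-≼ (inj₂ v) p q = q v

  -- A fold over at most `B` entries raises the degree by one. The coefficient keeps the shape that
  -- `_⊠_` produces.
  foldTime-All : ∀ {A C : Set} {τ : A → C → ℕ} {f : A → C → C} {b₀} k d (R : A → Set) (P : List A → C → Set) → P [] b₀ →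
    (∀ {x xs b} → R x → suc (length xs) ℕ.≤ B → P xs b → τ x b ≼ k ·B^ d × P (x ∷ xs) (f x b)) →
    ∀ xs → length xs ℕ.≤ B → All R xs → foldTime τ f b₀ xs ≼ 1 ℕ.* (1 ℕ.+ k) ·B^ (1 ℕ.+ d)
  foldTime-All k d R P base₀ step xs len all = below
    (proj₁ (foldr-spec (λ xs → length xs ℕ.≤ B × All R xs) P (λ (l , a) → ℕ.<⇒≤ l , All.tail a) base₀
      (λ (l , a) p → unbound (proj₁ (step (All.head a) l p)) , proj₂ (step (All.head a) l p)) xs (len , all)))
    (base len ⊠ (constant 1 ⊞ bound ℕ.≤-refl))

  foldTime-≼ : ∀ {A C : Set} {τ : A → C → ℕ} {f : A → C → C} {b₀} k d (P : List A → C → Set) → P [] b₀ →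
    (∀ {x xs b} → suc (length xs) ℕ.≤ B → P xs b → τ x b ≼ k ·B^ d × P (x ∷ xs) (f x b)) →
    ∀ xs → length xs ℕ.≤ B → foldTime τ f b₀ xs ≼ 1 ℕ.* (1 ℕ.+ k) ·B^ (1 ℕ.+ d)
  foldTime-≼ k d P base₀ step xs len =
    foldTime-All k d (λ _ → ⊤) P base₀ (λ _ → step) xs len (All.universal (λ _ → tt) xs)

  foldTime-const : ∀ {A C : Set} {τ : A → C → ℕ} {f : A → C → C} {b₀} k d →
    (∀ x b → τ x b ≼ k ·B^ d) →
    ∀ xs → length xs ℕ.≤ B → foldTime τ f b₀ xs ≼ 1 ℕ.* (1 ℕ.+ k) ·B^ (1 ℕ.+ d)
  foldTime-const k d p = foldTime-≼ k d (λ _ _ → ⊤) tt (λ _ _ → p _ _ , tt)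

  time-find : ∀ {Γ} (i : (elt ⊗ num) ∈ₗ Γ) row ρ → length (det row ρ) ℕ.≤ B → time row ρ ℕ.≤ 2 →
              time (findT i row) ρ ≼ 30 ·B^ 1
  time-find i row ρ len t = enlarge 30 1
    (below t (constant 2) ⊞ constant 10 ⊞ foldTime-const 7 0
      (λ x y → constant 5 ⊞ constant 1 ⊞ []′-≼ (toVal (does (proj₁ x Fin.≟ proj₁ (All.lookup ρ i)))) (λ _ → constant 1) (λ _ → constant 1))
      (det row ρ) len)

  time-coin : ∀ {Γ} s b z out e (ρ : Env Γ) → SmallRow (proj₁ s) → height z ℕ.≤ B →
              time coinT (s ∷ (b , z , out) ∷ e ∷ ρ) ≼ 80 ·B^ 1
  time-coin {Γ} s (inj₁ _) z out e ρ small hz = enlarge 80 1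
    ((((time-find {SlotTy ∷ StateTy ∷ (elt ⊗ num) ∷ Γ} (there (there (here refl))) (fst v0) (s ∷ (inj₁ tt , z , out) ∷ e ∷ ρ) (row-length small) ℕ.≤-refl ⊞ constant 1) ⊞ constant 1) ⊞ constant 1)
     ⊞ constant 1 ⊞ constant 3 ⊞ constant 1 ⊞ (constant 3 ⊞ constant 1 ⊞ base hz)
     ⊞ constant 1 ⊞ base (z-height small (proj₁ e)) ⊞ height-⁻¹ (base hz))
  time-coin {Γ} s (inj₂ _) z out e ρ small hz = enlarge 80 1
    ((((time-find {SlotTy ∷ StateTy ∷ (elt ⊗ num) ∷ Γ} (there (there (here refl))) (fst v0) (s ∷ (inj₂ tt , z , out) ∷ e ∷ ρ) (row-length small) ℕ.≤-refl ⊞ constant 1) ⊞ constant 1) ⊞ constant 1)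
     ⊞ constant 1 ⊞ constant 3
     ⊞ (constant 1 ⊞ (constant 3 ⊞ constant 1 ⊞ base hz) ⊞ constant 1 ⊞ base (z-height small (proj₁ e)) ⊞ height-- (base hz))
     ⊞ ((constant 1 ⊞ (constant 3 ⊞ constant 1 ⊞ base hz) ⊞ constant 1 ⊞ height-one ⊞ height-- (base hz))
        ⊞ constant 1 ⊞ height-add height-one (height-- (base hz)))
     ⊞ constant 1 ⊞ height-add (base (z-height small (proj₁ e))) (height-- (base hz))
     ⊞ height-⁻¹ (height-add height-one (height-- (base hz))))

  -- A coin is computed from masses of the input and never from earlier results, so its height stays
  -- linear in `B` however many coins precede it.
  height-coin : ∀ b {z z′} → height z ℕ.≤ B → height z′ ℕ.≤ B → height (condProb b z z′) ≼ 10 ·B^ 1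
  height-coin (inj₁ _) hz hz′ = enlarge 10 1 (height-mul (base hz′) (height-⁻¹ (base hz)))
  height-coin (inj₂ _) hz hz′ = enlarge 10 1
    (height-mul (height-add (base hz′) (height-- (base hz))) (height-⁻¹ (height-add height-one (height-- (base hz)))))

  height-zero : ∀ {d} → height 0# ≼ 0 ·B^ d
  height-zero = bound (ℕ.≤-reflexive height-0)

  time-update : ∀ {Γ} b s st e (ρ : Env Γ) → SmallRow (proj₁ s) →
                time updateT (b ∷ s ∷ st ∷ e ∷ ρ) ≼ 80 ·B^ 1
  time-update {Γ} b s st e ρ small = enlarge 80 1
    ((((time-find {bool ∷ SlotTy ∷ StateTy ∷ (elt ⊗ num) ∷ Γ} (there (there (there (here refl)))) (fst v1) (b ∷ s ∷ st ∷ e ∷ ρ) (row-length small) ℕ.≤-refl ⊞ constant 1) ⊞ constant 1) ⊞ constant 1)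
     ⊞ constant 1
     ⊞ ((constant 1 ⊞ constant 1 ⊞ constant 1 ⊞ base (z-height small (proj₁ e)) ⊞ height-zero)
        ⊞ constant 1 ⊞ []′-≼ (toVal (does (zAt (proj₁ s) (proj₁ e) ≤? 0#))) (λ _ → constant 2) (λ _ → below (s≤s z≤n) (constant 2)))
     ⊞ constant 1 ⊞ constant 1 ⊞ (constant 1 ⊞ (((constant 2 ⊞ (constant 1 ⊞ constant 1
          ⊞ []′-≼ (newBit (proj₁ s) (proj₁ e) b) (λ _ → constant 5) (λ _ → below (s≤s (s≤s z≤n)) (constant 5))) ⊞ constant 1) ⊞ constant 3 ⊞ constant 1)
       ⊞ constant 1)) ⊞ constant 1)

  length-greedyT : ∀ {Γ} (t : Term Γ (list elt)) ρ → length (det t ρ) ℕ.≤ B → length (det (greedyT t) ρ) ℕ.≤ B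
  length-greedyT t ρ len = subst (λ I → length I ℕ.≤ B) (sym (det-greedy t ρ)) (ℕ.≤-trans (length-greedy≤ (det t ρ)) len)

  time-greedy : ∀ {Γ k} (t : Term Γ (list elt)) ρ → time t ρ ≼ k ·B^ 2 → length (det t ρ) ℕ.≤ B →
                time (greedyT t) ρ ≼ k ℕ.+ 15 ·B^ 2
  time-greedy t ρ p len = p ⊞ constant 2 ⊞ fold-time
    where
    step = λ x b → [ (λ _ → x ∷ b) , (λ _ → b) ]′ (toVal (does (independent? (toSet (x ∷ b)))))
    step-short : ∀ x b → length (step x b) ℕ.≤ suc (length b)
    step-short x b with independent? (setOf (x ∷ b))
    ... | yes _ = ℕ.≤-refl
    ... | no  _ = ℕ.n≤1+n _
    fold-time = foldTime-≼ 12 1 (λ xs b → length b ℕ.≤ length xs) z≤n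
      (λ {x} {xs} {b} w q →
        enlarge 12 1 ((constant 3 ⊞ constant 1 ⊞ constant 1 ⊞ base (ℕ.≤-trans q (ℕ.<⇒≤ w))) ⊞ constant 1
             ⊞ []′-≼ (toVal (does (independent? (toSet (x ∷ b))))) (λ _ → constant 3) (λ _ → below (s≤s z≤n) (constant 3)))
          , ℕ.≤-trans (step-short x b) (s≤s q))
      (det t ρ) len

  length-halve≤ : ∀ {A : Set} (xs : List A) → length (proj₂ (halve xs)) ℕ.≤ length xs
  length-halve≤ xs = ℕ.≤-trans (ℕ.m≤m+n _ _) (length-halve-lower xs)

  time-bitsStep : ∀ {Γ a σ} x s (ρ : Env Γ) → length (proj₁ s) ℕ.≤ B →
    time (bitsStepT {Γ} {a} {σ}) (x ∷ s ∷ ρ) ≼ 32 ·B^ 1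
  time-bitsStep x ([] , out) ρ len = enlarge 32 1 (constant {0} 5)
  time-bitsStep x (y ∷ ys , out) ρ len = enlarge 32 1
    (constant 3 ⊞ constant 1 ⊞ ((constant 2 ⊞ constant 4 ⊞ constant 1 ⊞ foldTime-const 10 0
        (λ x b → constant 2 ⊞ constant 1 ⊞ []′-≼ (proj₁ b) (λ _ → constant 7) (λ _ → below (s≤s (s≤s (s≤s (s≤s (s≤s z≤n))))) (constant 7)))
        (y ∷ ys) len) ⊞ constant 1) ⊞ constant 4 ⊞ constant 1)

  time-bits : ∀ {Γ σ k} (t : Term Γ (list σ)) ρ → time t ρ ≼ k ·B^ 2 → length (det t ρ) ℕ.≤ B →
              time (bitsT t) ρ ≼ k ℕ.+ 40 ·B^ 2
  time-bits {Γ} {σ} t ρ p len = p ⊞ constant 1 ⊞ (constant 1 ⊞ constant 3 ⊞ constant 1 ⊞ foldTime-≼ 32 1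
      (λ _ s → length (proj₁ s) ℕ.≤ B) len
      (λ {x} {_} {s} _ q → time-bitsStep {list σ ∷ Γ} {σ} {σ} x s (det t ρ ∷ ρ) q , step x s q) (det t ρ) len) ⊞ constant 1
    where
    step : ∀ x s → length (proj₁ s) ℕ.≤ B → length (proj₁ (det (bitsStepT {list σ ∷ Γ} {σ} {σ}) (x ∷ s ∷ det t ρ ∷ ρ))) ℕ.≤ B
    step x ([] , out)     q = q
    step x (y ∷ ys , out) q = ℕ.≤-trans (length-halve≤ (y ∷ ys)) q

  time-rounds : ∀ i → length (proj₁ i) ℕ.≤ B → length (proj₂ i) ℕ.≤ B → time roundsT (i ∷ []) ≼ 150 ·B^ 2
  time-rounds i len₁ len₂ = enlarge 150 2
    (time-bits (greedyT elementsT) (i ∷ []) (time-greedy elementsT (i ∷ [])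
        (enlarge 10 2 (constant 2 ⊞ constant 1 ⊞ constant 1 ⊞ foldTime-const 4 0 (λ _ _ → constant 4) (proj₁ i) len₁)) lenᵉ) lenᵍ
     ⊞ time-bits {InputTy ∷ []} {RowTy} (snd v0) (i ∷ []) (constant 2) len₂
     ⊞ constant 1 ⊞ enlarge 4 2 (foldTime-const 3 0 (λ _ _ → constant 3) (det (bitsT (greedyT elementsT)) (i ∷ [])) lenᵇ))
    where
    lenᵉ : length (det elementsT (i ∷ [])) ℕ.≤ B
    lenᵉ rewrite det-elements i | List.length-map proj₁ (proj₁ i) = len₁
    lenᵍ : length (det (greedyT elementsT) (i ∷ [])) ℕ.≤ B
    lenᵍ = length-greedyT elementsT (i ∷ []) lenᵉ
    lenᵇ : length (det (bitsT (greedyT elementsT)) (i ∷ [])) ℕ.≤ B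
    lenᵇ rewrite det-bits (greedyT elementsT) (i ∷ []) = ℕ.≤-trans (length-bits≤ (det (greedyT elementsT) (i ∷ []))) lenᵍ

  time-slots : ∀ {Γ} u i (ρ : Env Γ) → length (proj₂ i) ℕ.≤ B → time slotsT (u ∷ i ∷ ρ) ≼ 20 ·B^ 1
  time-slots u i ρ len = enlarge 20 1
    (constant 2 ⊞ constant 1 ⊞ constant 1 ⊞ foldTime-const 5 0 (λ _ _ → constant 5) (proj₂ i) len)

  SmallCosts : List (Fin n × Carrier) → Set
  SmallCosts = All λ e → height (proj₂ e) ℕ.≤ B

  height-weight : ∀ {row} e → SmallRow row → height (proj₂ e) ℕ.≤ B → height (weight row e) ≼ 3 ·B^ 1
  height-weight e small ha = height-add (base ha) (base (c-height small (proj₁ e)))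

  -- The budget is the one number that accumulates. A summand of height 4B and the addition itself
  -- contribute at most 5B, so the growth is linear in the number of summands, and the budget ends
  -- with height at most 5 B ^ 2.
  height-budget-step : ∀ {x y} m → height x ≼ 4 ·B^ 1 → height y ℕ.≤ m ℕ.* (5 ℕ.* B ℕ.^ 1) →
    height (x + y) ℕ.≤ suc m ℕ.* (5 ℕ.* B ℕ.^ 1)
  height-budget-step {x} {y} m hx hy = ℕ.≤-trans (height-+ x y)
    (ℕ.≤-trans (s≤s (ℕ.+-mono-≤ (unbound hx) hy)) (ℕ.+-monoˡ-≤ (m ℕ.* (5 ℕ.* B ℕ.^ 1)) (unbound (constant {1} 1 ⊞ four))))
    where
    four : 4 ℕ.* B ℕ.^ 1 ≼ 4 ·B^ 1
    four = bound ℕ.≤-refl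

  height-term : ∀ {row} e → SmallRow row → height (proj₂ e) ℕ.≤ B → height (zAt row (proj₁ e) * weight row e) ≼ 4 ·B^ 1
  height-term e small ha = height-mul (base (z-height small (proj₁ e))) (height-weight e small ha)

  height-budget : ∀ {row es} → SmallRow row → SmallCosts es →
    height (budget es row) ℕ.≤ length es ℕ.* (5 ℕ.* B ℕ.^ 1)
  height-budget small [] = ℕ.≤-reflexive height-0
  height-budget {row} {e ∷ es} small (ha ∷ has) =
    height-budget-step (length es) (height-term e small ha) (height-budget small has)

  time-weight : ∀ {Γ} (x : Term Γ EntryTy) (e : Term Γ (elt ⊗ num)) ρ row → SmallRow row →
    det x ρ ≡ find (proj₁ (det e ρ)) row → height (proj₂ (det e ρ)) ℕ.≤ B → time x ρ ≼ 1 ·B^ 1 → time e ρ ≼ 1 ·B^ 1 →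
    time (weightT x e) ρ ≼ 10 ·B^ 1
  time-weight x e ρ row small eq ha tx te = enlarge 10 1
    ((te ⊞ constant 1) ⊞ (((tx ⊞ constant 1) ⊞ constant 1) ⊞ constant 1 ⊞ []′-≼ (proj₁ (proj₂ (det x ρ))) (λ _ → constant 1) (λ _ → constant 1))
     ⊞ constant 1 ⊞ base ha ⊞ base (subst (λ w → height ([ (λ _ → 0#) , (λ v → v) ]′ (proj₁ (proj₂ w))) ℕ.≤ B) (sym eq) (c-height small (proj₁ (det e ρ)))))

  time-budget : ∀ {Γ a b c} s u v w i (ρ : Env Γ) → SmallRow (proj₁ s) → length (proj₁ i) ℕ.≤ B → SmallCosts (proj₁ i) →
    time (budgetT {Γ} {a} {b} {c}) (s ∷ u ∷ v ∷ w ∷ i ∷ ρ) ≼ 110 ·B^ 3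
  time-budget {Γ} {a} {b} {c} s u v w i ρ small len costs = enlarge 110 3
    (constant 2 ⊞ constant 1 ⊞ constant 1 ⊞
      foldTime-All 100 2 (λ e → height (proj₂ e) ℕ.≤ B) (λ es V → height V ℕ.≤ length es ℕ.* (5 ℕ.* B ℕ.^ 1))
        (ℕ.≤-reflexive height-0)
        (λ {e} {es} {V} ha len′ hV →
          enlarge 100 2
            (enlarge 30 2 (time-find {(elt ⊗ num) ∷ num ∷ SlotTy ∷ a ∷ b ∷ c ∷ InputTy ∷ Γ} (here refl) (fst v2)
                (e ∷ V ∷ s ∷ u ∷ v ∷ w ∷ i ∷ ρ) (row-length small) ℕ.≤-refl)
             ⊞ constant 1
             ⊞ ((constant 4 ⊞ enlarge 10 2 (time-weight {EntryTy ∷ (elt ⊗ num) ∷ num ∷ SlotTy ∷ a ∷ b ∷ c ∷ InputTy ∷ Γ} v0 v1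
                     (entry e ∷ e ∷ V ∷ s ∷ u ∷ v ∷ w ∷ i ∷ ρ) (proj₁ s) small refl ha (constant 1) (constant 1))
                   ⊞ constant 1 ⊞ enlarge 1 2 (base (z-height small (proj₁ e))) ⊞ enlarge 3 2 (height-weight e small ha))
                ⊞ constant 1 ⊞ constant 1
                ⊞ enlarge 4 2 (height-term e small ha)
                ⊞ below hV (base (ℕ.<⇒≤ len′) ⊠ five)))
          , height-budget-step (length es) (height-term e small ha) hV)
        (proj₁ i) len costs)
    where
    entry : Fin n × Carrier → Entry
    entry e = find (proj₁ e) (proj₁ s)
    five : 5 ℕ.* B ℕ.^ 1 ≼ 5 ·B^ 1
    five = bound ℕ.≤-refl

  time-augment : ∀ {Γ} e S V s (ρ : Env Γ) → SmallRow (proj₁ s) → height (proj₂ e) ℕ.≤ B → length S ℕ.≤ B →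
    height V ≼ 5 ·B^ 2 → time augmentT (e ∷ S ∷ V ∷ s ∷ ρ) ≼ 120 ·B^ 2
  time-augment {Γ} e S V s ρ small ha len hV = enlarge 120 2
    (enlarge 30 2 (time-find {(elt ⊗ num) ∷ list elt ∷ num ∷ SlotTy ∷ Γ} (here refl) (fst v3)
        (e ∷ S ∷ V ∷ s ∷ ρ) (row-length small) ℕ.≤-refl)
     ⊞ constant 1 ⊞ (constant 4 ⊞ constant 1 ⊞ constant 1 ⊞ enlarge 1 2 (base (z-height small (proj₁ e))) ⊞ height-zero)
     ⊞ constant 1 ⊞ []′-≼ (toVal (does (zAt (proj₁ s) (proj₁ e) ≤? 0#))) (λ _ → below (s≤s z≤n) big) λ _ → heavy)
    where
    big : 1 ≼ 70 ·B^ 2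
    big = enlarge 70 2 (constant {0} 1)
    entry = find (proj₁ e) (proj₁ s)
    env = tt ∷ tt ∷ entry ∷ e ∷ S ∷ V ∷ s ∷ ρ
    heavy : _ ≼ 70 ·B^ 2
    heavy = enlarge 70 2
      ((enlarge 10 2 (time-weight {𝟙 ∷ EntryTy ∷ (elt ⊗ num) ∷ list elt ∷ num ∷ SlotTy ∷ Γ} v1 v2
            (tt ∷ entry ∷ e ∷ S ∷ V ∷ s ∷ ρ) (proj₁ s) small refl ha (constant 1) (constant 1))
          ⊞ constant 1 ⊞ constant 1 ⊞ enlarge 3 2 (height-weight e small ha) ⊞ hV)
       ⊞ constant 1
       ⊞ []′-≼ (toVal (does (weight (proj₁ s) e ≤? V)))
           (λ _ → enlarge 40 2 ((((constant 2 ⊞ time-greedy {𝟙 ∷ 𝟙 ∷ EntryTy ∷ (elt ⊗ num) ∷ list elt ∷ num ∷ SlotTy ∷ Γ} v4 env (constant 1) len ⊞ constant 1)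
               ⊞ constant 1 ⊞ constant 1 ⊞ enlarge 1 2 (base (length-greedyT {𝟙 ∷ 𝟙 ∷ EntryTy ∷ (elt ⊗ num) ∷ list elt ∷ num ∷ SlotTy ∷ Γ} v4 env len)))
             ⊞ constant 1 ⊞ []′-≼ (toVal (does (independent? (toSet (proj₁ e ∷ det (greedyT v4) env))))) (λ _ → constant 4) (λ _ → below (s≤s z≤n) (constant 4)))))
           (λ _ → enlarge 40 2 (constant {0} 1)))

  length-augment : ∀ row V e S → length (augment row V e S) ℕ.≤ suc (length S)
  length-augment row V e S with zAt row (proj₁ e) ≤? 0#
  ... | yes _ = ℕ.n≤1+n _
  ... | no _ with weight row e ≤? V
  ...   | no _ = ℕ.n≤1+n _
  ...   | yes _ with independent? (setOf (proj₁ e ∷ greedy S))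
  ...     | yes _ = ℕ.≤-refl
  ...     | no _  = ℕ.n≤1+n _

  -- Each element lengthens the set by at most one entry. The last hypothesis leaves room for all of
  -- them, so every greedy test works on a list of at most `B` entries.
  time-repair : ∀ {Γ a b c} s u v w i (ρ : Env Γ) → SmallRow (proj₁ s) → SmallCosts (proj₁ i) →
    length (proj₁ i) ℕ.+ length (proj₂ s) ℕ.≤ B →
    time (repairT {Γ} {a} {b} {c}) (s ∷ u ∷ v ∷ w ∷ i ∷ ρ) ≼ 250 ·B^ 3
  time-repair {Γ} {a} {b} {c} s u v w i ρ small costs room = enlarge 250 3
    (time-budget {Γ} {a} {b} {c} s u v w i ρ small len costs ⊞ constant 1 ⊞ constant 2 ⊞ constant 2 ⊞ constant 1
     ⊞ below (proj₁ (foldr-spec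
           (λ es → length es ℕ.+ length (proj₂ s) ℕ.≤ B × SmallCosts es)
           (λ es S → length S ℕ.≤ length es ℕ.+ length (proj₂ s))
           (λ (l , a) → ℕ.<⇒≤ l , All.tail a) ℕ.≤-refl
           (λ {e} {es} {S} (l , q) p →
             unbound (time-augment {a ∷ b ∷ c ∷ InputTy ∷ Γ} e S V s (u ∷ v ∷ w ∷ i ∷ ρ) small (All.head q) (ℕ.≤-trans p (ℕ.<⇒≤ l)) hV)
             , ℕ.≤-trans (ℕ.≤-reflexive (cong length (det-augment {a ∷ b ∷ c ∷ InputTy ∷ Γ} e S V s (u ∷ v ∷ w ∷ i ∷ ρ))))
                 (ℕ.≤-trans (length-augment (proj₁ s) V e S) (s≤s p)))
           (proj₁ i) (room , costs)))
         (base len ⊠ (constant 1 ⊞ self)))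
    where
    len : length (proj₁ i) ℕ.≤ B
    len = ℕ.≤-trans (ℕ.m≤m+n _ _) room
    V = budget (proj₁ i) (proj₁ s)
    five : 5 ℕ.* B ℕ.^ 1 ≼ 5 ·B^ 1
    five = bound ℕ.≤-refl
    self : 120 ℕ.* B ℕ.^ 2 ≼ 120 ·B^ 2
    self = bound ℕ.≤-refl
    hV : height V ≼ 5 ·B^ 2
    hV = below (height-budget small costs) (base len ⊠ five)

  time-repairAll : ∀ ss u i → length ss ℕ.≤ B → SmallCosts (proj₁ i) →
    All (λ s → SmallRow (proj₁ s) × length (proj₁ i) ℕ.+ length (proj₂ s) ℕ.≤ B) ss →
    time repairAllT (ss ∷ u ∷ i ∷ []) ≼ 260 ·B^ 4
  time-repairAll ss u i len costs ok = enlarge 260 4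
    (constant 1 ⊞ constant 1 ⊞ constant 1 ⊞ foldTime-All 252 3 _ (λ _ _ → ⊤) tt
      (λ {s} {_} {b} (small , room) _ _ →
        (time-repair {[]} {OutputTy} {list SlotTy} {list 𝟙} s b ss u i [] small costs room ⊞ constant 2) , tt)
      ss len ok)

-- The maximal coupling of two Bernoulli choices.

module Coupling (F : OrderedField) where
  open FieldProperties F

  private
    0≤1-z : ∀ {z} → z ≤ 1# → 0# ≤ 1# - z
    0≤1-z = x≤y⇒0≤y-x

    -- The probability of being chosen at both time steps is min(z, z′). Each case records the
    -- inequality that decides the minimum.
    stay : ∀ {z z′} → 0# ≤ z → 0# ≤ z′ →
           (z * clip (z′ * z ⁻¹) ≡ z × z ≤ z′) ⊎ (z * clip (z′ * z ⁻¹) ≡ z′ × z′ ≤ z)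
    stay {z} {z′} 0≤z 0≤z′ with *-clip z′ 0≤z
    ... | inj₁ (z′≤0 , eq) = inj₂ (trans eq (antisym 0≤z′ z′≤0) , ≤-trans z′≤0 0≤z)
    ... | inj₂ (inj₁ (z≤z′ , eq)) = inj₁ (eq , z≤z′)
    ... | inj₂ (inj₂ (_ , z′≤z , eq)) = inj₂ (eq , z′≤z)

    -- The probability of being chosen at the earlier time step only is max(z′ - z, 0).
    enter : ∀ {z z′} → z ≤ 1# → z′ ≤ 1# →
            ((1# - z) * clip ((z′ - z) * (1# - z) ⁻¹) ≡ z′ - z × z ≤ z′)
            ⊎ ((1# - z) * clip ((z′ - z) * (1# - z) ⁻¹) ≡ 0# × z′ ≤ z)
    enter {z} {z′} z≤1 z′≤1 with *-clip (z′ - z) (0≤1-z z≤1)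
    ... | inj₁ (p , eq) = inj₂ (eq , subst (z′ ≤_) (+-identityˡ z) (x-z≤y⇒x≤y+z p))
    ... | inj₂ (inj₁ (p , eq)) = inj₁ (trans eq (cong (_- z) (antisym 1≤z′ z′≤1)) , ≤-trans z≤1 1≤z′)
      where
      1≤z′ : 1# ≤ z′
      1≤z′ = +-cancelʳ-≤ (- z) p
    ... | inj₂ (inj₂ (p , _ , eq)) = inj₁ (eq , 0≤y-x⇒x≤y p)

  -- This is min(z, z′) + max(z′ - z, 0) = z′. Where `stay` and `enter` decide the comparison
  -- differently, the two masses are equal.
  coupling-marginal : ∀ {z z′} → 0# ≤ z → z ≤ 1# → 0# ≤ z′ → z′ ≤ 1# →
    z * clip (z′ * z ⁻¹) + (1# - z) * clip ((z′ - z) * (1# - z) ⁻¹) ≡ z′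
  coupling-marginal {z} {z′} 0≤z z≤1 0≤z′ z′≤1 with stay 0≤z 0≤z′ | enter z≤1 z′≤1
  ... | inj₁ (p , _)    | inj₁ (q , _)    = trans (cong₂ _+_ p q) (trans (+-comm z _) (x-y+y≡x z′ z))
  ... | inj₁ (p , z≤z′) | inj₂ (q , z′≤z) = trans (cong₂ _+_ p q) (trans (+-identityʳ z) (antisym z≤z′ z′≤z))
  ... | inj₂ (p , z′≤z) | inj₁ (q , z≤z′) = trans (cong₂ _+_ p q)
          (trans (cong (λ w → z′ + (w - z)) (antisym z′≤z z≤z′)) (trans (cong (z′ +_) (-‿inverseʳ z)) (+-identityʳ z′)))
  ... | inj₂ (p , _)    | inj₂ (q , _)    = trans (cong₂ _+_ p q) (+-identityʳ z′)

  -- The left side is z - min(z, z′), the probability of being chosen at the later time step only.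
  -- With the constraint of the linear program on `y` it bounds the expected acquisitions.
  coupling-drop : ∀ {z z′ y} → 0# ≤ z → 0# ≤ z′ → 0# ≤ y → z ≤ z′ + y →
    z * (1# - clip (z′ * z ⁻¹)) ≤ y
  coupling-drop {z} {z′} {y} 0≤z 0≤z′ 0≤y z≤z′+y = +-cancelʳ-≤ (z * κ) (begin
      z * (1# - κ) + z * κ  ≡⟨ sym (distribˡ z _ κ) ⟩
      z * (1# - κ + κ)      ≡⟨ cong (z *_) (x-y+y≡x 1# κ) ⟩
      z * 1#                ≡⟨ *-identityʳ z ⟩
      z                     ≤⟨ bound′ ⟩
      y + z * κ             ∎)
    where
    open ≤-Reasoning
    κ = clip (z′ * z ⁻¹)
    bound′ : z ≤ y + z * κ
    bound′ with stay 0≤z 0≤z′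
    ... | inj₁ (p , _) = ≤-trans (x≤y+x 0≤y) (≤-reflexive (cong (y +_) (sym p)))
    ... | inj₂ (p , _) = ≤-trans z≤z′+y (≤-reflexive (trans (+-comm z′ y) (cong (y +_) (sym p))))

  mixture-const : ∀ κ x → κ * x + (1# - κ) * x ≡ x
  mixture-const κ x = trans (sym (distribʳ x κ (1# - κ))) (trans (cong (_* x) (x+[1-x]≡1 κ)) (*-identityˡ x))

  -- Total probability: a coin whose bias is itself drawn at random is a coin with the mean bias.
  two-stage : ∀ z κ₁ κ₂ a b → z * (κ₁ * a + (1# - κ₁) * b) + (1# - z) * (κ₂ * a + (1# - κ₂) * b)
    ≡ (z * κ₁ + (1# - z) * κ₂) * a + (1# - (z * κ₁ + (1# - z) * κ₂)) * b
  two-stage z κ₁ κ₂ a b = begin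
      z * (κ₁ * a + κ₁′ * b) + z′ * (κ₂ * a + κ₂′ * b)
        ≡⟨ solve 8 (λ z z′ k k′ l l′ a b → z :* (k :* a :+ k′ :* b) :+ z′ :* (l :* a :+ l′ :* b)
                     := (z :* k :+ z′ :* l) :* a :+ (z :* k′ :+ z′ :* l′) :* b) refl z z′ κ₁ κ₁′ κ₂ κ₂′ a b ⟩
      m * a + m′ * b
        ≡⟨ cong (λ w → m * a + w * b) (trans (sym (x+y-y≡x m′ m)) (cong (_- m) complement)) ⟩
      m * a + (1# - m) * b  ∎
    where
    open ≡-Reasoning
    z′ = 1# - z
    κ₁′ = 1# - κ₁
    κ₂′ = 1# - κ₂
    m  = z * κ₁ + z′ * κ₂
    m′ = z * κ₁′ + z′ * κ₂′
    complement : m′ + m ≡ 1#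
    complement = begin
      m′ + m
        ≡⟨ solve 6 (λ z z′ k k′ l l′ → z :* k′ :+ z′ :* l′ :+ (z :* k :+ z′ :* l) := z :* (k :+ k′) :+ z′ :* (l :+ l′))
             refl z z′ κ₁ κ₁′ κ₂ κ₂′ ⟩
      z * (κ₁ + κ₁′) + z′ * (κ₂ + κ₂′)
        ≡⟨ cong₂ (λ x y → z * x + z′ * y) (x+[1-x]≡1 κ₁) (x+[1-x]≡1 κ₂) ⟩
      z * 1# + z′ * 1#  ≡⟨ mixture-const z 1# ⟩
      1#                ∎

  mixture-0 : ∀ a b → 0# * a + (1# - 0#) * b ≡ b
  mixture-0 a b = trans (cong₂ _+_ (zeroˡ a) (trans (cong (_* b) (trans (cong (1# +_) -0#≈0#) (+-identityʳ 1#))) (*-identityˡ b)))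
                        (+-identityˡ b)

  mixture-+ : ∀ κ x y t → κ * (x + t) + (1# - κ) * (y + t) ≡ (κ * x + (1# - κ) * y) + t
  mixture-+ κ x y t = trans
    (solve 5 (λ κ κ′ x y t → κ :* (x :+ t) :+ κ′ :* (y :+ t) := κ :* x :+ κ′ :* y :+ (κ :* t :+ κ′ :* t)) refl κ (1# - κ) x y t)
    (cong (κ * x + (1# - κ) * y +_) (mixture-const κ t))

-- Sums over lists and subsets.

module ListSums (F : OrderedField) where
  open FieldProperties F

  sumL : ∀ {A : Set} → (A → Carrier) → List A → Carrier
  sumL f = List.foldr (λ x s → f x + s) 0#

  sumL-mono : ∀ {A : Set} {P : A → Set} {f g : A → Carrier} {xs} → All P xs → (∀ {x} → P x → f x ≤ g x) → sumL f xs ≤ sumL g xs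
  sumL-mono []       f≤g = ≤-refl
  sumL-mono (p ∷ ps) f≤g = +-mono-≤ (f≤g p) (sumL-mono ps f≤g)

  sumL-nonNeg : ∀ {A : Set} {P : A → Set} {f : A → Carrier} {xs} → All P xs → (∀ {x} → P x → 0# ≤ f x) → 0# ≤ sumL f xs
  sumL-nonNeg []       0≤f = ≤-refl
  sumL-nonNeg (p ∷ ps) 0≤f = 0≤+ (0≤f p) (sumL-nonNeg ps 0≤f)

  sumL-+ : ∀ {A : Set} (f g : A → Carrier) xs → sumL (λ x → f x + g x) xs ≡ sumL f xs + sumL g xs
  sumL-+ f g []       = sym (+-identityˡ 0#)
  sumL-+ f g (x ∷ xs) = trans (cong (f x + g x +_) (sumL-+ f g xs))
    (solve 4 (λ a b c d → a :+ b :+ (c :+ d) := a :+ c :+ (b :+ d)) refl (f x) (g x) (sumL f xs) (sumL g xs))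

  sumL-* : ∀ {A : Set} c (f : A → Carrier) xs → sumL (λ x → c * f x) xs ≡ c * sumL f xs
  sumL-* c f []       = sym (zeroʳ c)
  sumL-* c f (x ∷ xs) = trans (cong (c * f x +_) (sumL-* c f xs)) (sym (distribˡ c _ _))

  sumL-tabulate : ∀ {A : Set} {n} (f : A → Carrier) (g : Fin n → A) → sumL f (List.tabulate g) ≡ sum (f ∘ g)
  sumL-tabulate {n = zero}  f g = refl
  sumL-tabulate {n = suc n} f g = cong (f (g zero) +_) (sumL-tabulate f (g ∘ suc))

x∈p─q⇒x∉q : ∀ {n} {x : Fin n} (p q : Subset n) → x ∈ p ─ q → x ∉ q
x∈p─q⇒x∉q (_ Vec.∷ p) (_ Vec.∷ q) (Vec.there x∈) (Vec.there x∈q) = x∈p─q⇒x∉q p q x∈ x∈q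
x∈p─q⇒x∉q (_ Vec.∷ p) (true Vec.∷ q) () Vec.here

─-mono : ∀ {n} {p p′ q q′ : Subset n} → (∀ {x} → x ∈ p → x ∉ q → x ∈ p′) → q′ ⊆ q → p ─ q ⊆ p′ ─ q′
─-mono {p = p} {q = q} f g x∈ = x∈p∧x∉q⇒x∈p─q (f (p─q⊆p p q x∈) (x∈p─q⇒x∉q p q x∈)) (x∈p─q⇒x∉q p q x∈ ∘ g)

module SumOver (F : OrderedField) {n : ℕ} where
  open FieldProperties F
  open Problem F using (sumOver)

  private
    if-mono : ∀ {x} b c → 0# ≤ x → (b ≡ true → c ≡ true) → (if b then x else 0#) ≤ (if c then x else 0#)
    if-mono false false 0≤x p = ≤-refl
    if-mono false true  0≤x p = 0≤x
    if-mono true  false 0≤x p = contradiction (p refl) λ ()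
    if-mono true  true  0≤x p = ≤-refl

  sumOver-mono : ∀ {x : Fin n → Carrier} {S S′} → (∀ e → 0# ≤ x e) → S ⊆ S′ → sumOver x S ≤ sumOver x S′
  sumOver-mono {x} {S} {S′} 0≤x S⊆S′ = sum-mono λ e → if-mono (Vec.lookup S e) (Vec.lookup S′ e) (0≤x e)
    λ eq → Vec.[]=⇒lookup (S⊆S′ (Vec.lookup⇒[]= e S eq))

  sumOver-nonNeg : ∀ {x : Fin n → Carrier} S → (∀ e → 0# ≤ x e) → 0# ≤ sumOver x S
  sumOver-nonNeg {x} S 0≤x = sum-nonNeg λ e → lemma (Vec.lookup S e) (0≤x e)
    where
    lemma : ∀ {y} b → 0# ≤ y → 0# ≤ (if b then y else 0#)
    lemma true  p = p
    lemma false p = ≤-refl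

  sumOver-∅ : ∀ (x : Fin n → Carrier) → sumOver x ∅ ≡ 0#
  sumOver-∅ x = trans (sum-cong λ e → cong (if_then x e else 0#) (Vec.lookup-replicate e false)) (sum-zero n)

  sumOver-full : ∀ (x : Fin n → Carrier) → sumOver x full ≡ sum x
  sumOver-full x = sum-cong λ e → cong (if_then x e else 0#) (Vec.lookup-replicate e true)

  sumOver-∪ : ∀ {x : Fin n → Carrier} S S′ → (∀ e → 0# ≤ x e) → sumOver x (S ∪ S′) ≤ sumOver x S + sumOver x S′
  sumOver-∪ {x} S S′ 0≤x = ≤-trans
      (sum-mono λ e → subst (λ b → (if b then x e else 0#) ≤ (if Vec.lookup S e then x e else 0#) + (if Vec.lookup S′ e then x e else 0#)) (sym (Vec.lookup-zipWith _ e S S′))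
                            (lemma (Vec.lookup S e) (Vec.lookup S′ e) (0≤x e)))
      (≤-reflexive (sum-+ (λ e → if Vec.lookup S e then x e else 0#) (λ e → if Vec.lookup S′ e then x e else 0#)))
    where
    lemma : ∀ {y} b c → 0# ≤ y → (if b ∨ c then y else 0#) ≤ (if b then y else 0#) + (if c then y else 0#)
    lemma false c     p = x≤y+x ≤-refl
    lemma true  false p = x≤x+y ≤-refl
    lemma true  true  p = x≤x+y p

sumOver-⁅⁆ : ∀ (F : OrderedField) {n} (x : Fin n → OrderedField.Carrier F) e → Problem.sumOver F x ⁅ e ⁆ ≡ x e
sumOver-⁅⁆ F {suc n} x zero    = trans (cong (x zero +_) (SumOver.sumOver-∅ F (x ∘ suc))) (+-identityʳ _)
  where open FieldProperties F
sumOver-⁅⁆ F {suc n} x (suc e) = trans (+-identityˡ _) (sumOver-⁅⁆ F (x ∘ suc) e)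
  where open FieldProperties F

-- Expectations and specifications of lets, coins and folds.

module FlipLet {F : OrderedField} (H : Height F) {n : ℕ} (M : Matroid n) where
  open FieldProperties F
  open Height H
  open Semantics H M
  open RunProperties H M

  Ex-let : ∀ {Γ σ τ} (s : Term Γ σ) (t : Term (σ ∷ Γ) τ) (ρ : Env Γ) (f : Val τ → Carrier) →
    Ex f (eval (let′ s t) ρ) ≡ Ex (λ u → Ex f (eval t (u ∷ ρ))) (eval s ρ)
  Ex-let s t ρ f = trans (Ex->>= f (eval s ρ) (λ u → 1 ⟫ eval t (u ∷ ρ))) (Ex-ext (λ u → Ex-⟫ f 1 (eval t (u ∷ ρ))) (eval s ρ))

  Ex-flip : ∀ {Γ} (q : Term Γ num) → FlipFree q → ∀ (ρ : Env Γ) (f : Val bool → Carrier) →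
    Ex f (eval (flip q) ρ) ≡ clip (det q ρ) * f (inj₁ tt) + (1# - clip (det q ρ)) * f (inj₂ tt)
  Ex-flip q qf ρ f = begin
    Ex f (eval (flip q) ρ)                                     ≡⟨ Ex->>= f (eval q ρ) (λ x → suc (height x) ⟫ bernoulli x) ⟩
    Ex (λ x → Ex f (suc (height x) ⟫ bernoulli x)) (eval q ρ)  ≡⟨ Ex-single (λ x → Ex f (suc (height x) ⟫ bernoulli x)) (eval-det q qf ρ) ⟩
    Ex f (suc (height (det q ρ)) ⟫ bernoulli (det q ρ))        ≡⟨ Ex-⟫ f (suc (height (det q ρ))) (bernoulli (det q ρ)) ⟩
    Ex f (bernoulli (det q ρ))                                 ≡⟨ Ex-bernoulli f (det q ρ) ⟩
    _                                                          ∎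
    where open ≡-Reasoning

  Ex-flip-let : ∀ {Γ τ} (q : Term Γ num) (t : Term (bool ∷ Γ) τ) → FlipFree q → FlipFree t → ∀ (ρ : Env Γ) (f : Val τ → Carrier) →
    Ex f (eval (let′ (flip q) t) ρ) ≡
      clip (det q ρ) * f (det t (inj₁ tt ∷ ρ)) + (1# - clip (det q ρ)) * f (det t (inj₂ tt ∷ ρ))
  Ex-flip-let q t qf tf ρ f = trans (Ex-let (flip q) t ρ f)
    (trans (Ex-ext (λ u → Ex-single f (eval-det t tf (u ∷ ρ))) (eval (flip q) ρ)) (Ex-flip q qf ρ (λ u → f (det t (u ∷ ρ)))))

  spec-det : ∀ {Γ τ} (t : Term Γ τ) → FlipFree t → ∀ (ρ : Env Γ) → Spec (eval t ρ) (time t ρ) (_≡ det t ρ)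
  spec-det t tf ρ = spec-single (eval-det t tf ρ) ℕ.≤-refl refl

  spec-flip-let : ∀ {Γ τ c} (q : Term Γ num) (t : Term (bool ∷ Γ) τ) {Q : Val τ → Set} → FlipFree q → FlipFree t → ∀ (ρ : Env Γ) →
    (∀ b → time t (b ∷ ρ) ℕ.≤ c) → (∀ b → Q (det t (b ∷ ρ))) →
    Spec (eval (let′ (flip q) t) ρ) ((time q ρ ℕ.+ (suc (height (det q ρ)) ℕ.+ 0)) ℕ.+ (1 ℕ.+ c)) Q
  spec-flip-let q t qf tf ρ tc tq = spec->>= (λ u → 1 ⟫ eval t (u ∷ ρ))
    (spec->>= (λ x → suc (height x) ⟫ bernoulli x) {P = _≡ det q ρ} (spec-det q qf ρ) (λ where refl → spec-⟫ _ (spec-bernoulli {Q = λ _ → ⊤} (det q ρ) (λ _ → tt))))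
    (λ {u} _ → spec-⟫ 1 (spec-single (eval-det t tf (u ∷ ρ)) (tc u) (tq u)))

  spec-let : ∀ {Γ σ τ b c} (s : Term Γ σ) (t : Term (σ ∷ Γ) τ) (ρ : Env Γ) {P : Val σ → Set} {Q : Val τ → Set} →
    Spec (eval s ρ) b P → (∀ {u} → P u → Spec (eval t (u ∷ ρ)) c Q) → Spec (eval (let′ s t) ρ) (b ℕ.+ (1 ℕ.+ c)) Q
  spec-let s t ρ S K = spec->>= (λ u → 1 ⟫ eval t (u ∷ ρ)) S (λ p → spec-⟫ 1 (K p))

  Ex-fold : ∀ {Γ σ τ} (r : Term Γ (list σ)) (s : Term Γ τ) (t : Term (σ ∷ τ ∷ Γ) τ) → FlipFree r → FlipFree s → ∀ (ρ : Env Γ) (f : Val τ → Carrier) →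
    Ex f (eval (fold r s t) ρ) ≡ Ex f (foldM (λ x b → eval t (x ∷ b ∷ ρ)) (det s ρ) (det r ρ))
  Ex-fold {Γ} {σ} {τ} r s t rf sf ρ f = begin
      Ex f (eval (fold r s t) ρ)                        ≡⟨ Ex->>= f (eval r ρ) k ⟩
      Ex (λ xs → Ex f (k xs)) (eval r ρ)                ≡⟨ Ex-single (λ xs → Ex f (k xs)) (eval-det r rf ρ) ⟩
      Ex f (k (det r ρ))                                ≡⟨ Ex->>= f (eval s ρ) (λ b → 1 ⟫ body b (det r ρ)) ⟩
      Ex (λ b → Ex f (1 ⟫ body b (det r ρ))) (eval s ρ)  ≡⟨ Ex-single (λ b → Ex f (1 ⟫ body b (det r ρ))) (eval-det s sf ρ) ⟩
      Ex f (1 ⟫ body (det s ρ) (det r ρ))               ≡⟨ Ex-⟫ f 1 (body (det s ρ) (det r ρ)) ⟩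
      Ex f (body (det s ρ) (det r ρ))                   ∎
    where
    open ≡-Reasoning
    body : Val τ → List (Val σ) → Run (Val τ)
    body = foldM (λ x b → eval t (x ∷ b ∷ ρ))
    k : List (Val σ) → Run (Val τ)
    k xs = eval s ρ >>= λ b → 1 ⟫ body b xs

  spec-fold : ∀ {Γ σ τ c} (r : Term Γ (list σ)) (s : Term Γ τ) (t : Term (σ ∷ τ ∷ Γ) τ) → FlipFree r → FlipFree s → ∀ (ρ : Env Γ) {Q : Val τ → Set} →
    Spec (foldM (λ x b → eval t (x ∷ b ∷ ρ)) (det s ρ) (det r ρ)) c Q →
    Spec (eval (fold r s t) ρ) (time r ρ ℕ.+ (time s ρ ℕ.+ (1 ℕ.+ c))) Q
  spec-fold {Γ} {σ} {τ} r s t rf sf ρ S = spec->>= (λ xs → eval s ρ >>= λ b → 1 ⟫ body b xs) {P = _≡ det r ρ} (spec-det r rf ρ)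
    (λ where refl → spec->>= (λ b → 1 ⟫ body b (det r ρ)) {P = _≡ det s ρ} (spec-det s sf ρ) (λ where refl → spec-⟫ 1 S))
    where
    body : Val τ → List (Val σ) → Run (Val τ)
    body = foldM (λ x b → eval t (x ∷ b ∷ ρ))

-- Rows, slots and their costs.

module Slots {F : OrderedField} (H : Height F) {n : ℕ} (M : Matroid n) (B : ℕ) .{{_ : NonZero B}} where
  open FieldProperties F
  open Semantics H M
  open ProgramValues H M
  open TimeBounds H M B
  open ListSums F

  yAt : Row → Fin n → Carrier
  yAt row e = proj₁ (proj₂ (proj₂ (find e row)))

  -- Along the backward walk, the first of the remaining rows is the time step visited just before.
  -- Zero on the empty list stands for the fictitious step after the last.
  zHead yHead : List Row → Fin n → Carrier
  zHead []        e = 0#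
  zHead (row ∷ _) e = zAt row e
  yHead []        e = 0#
  yHead (row ∷ _) e = yAt row e

  record GoodRow (row : Row) : Set where
    field
      small    : SmallRow row
      z-nonNeg : ∀ e → 0# ≤ zAt row e
      z-≤1     : ∀ e → zAt row e ≤ 1#
      y-nonNeg : ∀ e → 0# ≤ yAt row e
      c-nonNeg : ∀ e → 0# ≤ cAt row e
  open GoodRow public

  -- The inequality is the constraint of the linear program between a row and its successor,
  -- attached to the earlier of the two because the walk reaches that one last. The constraint of
  -- the first time step, which compares with z_0, is supplied separately.
  data GoodRows : List Row → Set where
    []     : GoodRows []
    step : ∀ {row rows} → GoodRow row → (∀ e → zHead rows e ≤ zAt row e + yHead rows e) →
             GoodRows rows → GoodRows (row ∷ rows)

  rowsOf : List Slot → List Row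
  rowsOf = List.map proj₁

  -- The slots after adding e at the times where the sampled trajectory chooses
  -- it, together with the choice at the first of these times.
  data Extension (e : Fin n) : List Slot → Val bool → List Slot → Set where
    []   : Extension e [] (inj₂ tt) []
    take : ∀ {row S ss b ss′} → ¬ zAt row e ≤ 0# → Extension e ss b ss′ →
           Extension e ((row , S) ∷ ss) (inj₁ tt) ((row , e ∷ S) ∷ ss′)
    skip : ∀ {row S ss b ss′} → Extension e ss b ss′ →
           Extension e ((row , S) ∷ ss) (inj₂ tt) ((row , S) ∷ ss′)

  extension-rows : ∀ {e ss b ss′} → Extension e ss b ss′ → rowsOf ss′ ≡ rowsOf ss
  extension-rows []         = refl
  extension-rows (take _ x) = cong (_ ∷_) (extension-rows x)
  extension-rows (skip x)   = cong (_ ∷_) (extension-rows x)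

  record GoodSlot (k : ℕ) (s : Slot) : Set where
    field
      short     : length (proj₂ s) ℕ.≤ k
      supported : All (λ e → ¬ zAt (proj₁ s) e ≤ 0#) (proj₂ s)
  open GoodSlot public

  extension-good : ∀ {e ss b ss′ k} → Extension e ss b ss′ → All (GoodSlot k) ss → All (GoodSlot (suc k)) ss′
  extension-good []         []       = []
  extension-good (take p x) (g ∷ gs) = record { short = s≤s (short g) ; supported = p ∷ supported g } ∷ extension-good x gs
  extension-good (skip x)   (g ∷ gs) = record { short = ℕ.m≤n⇒m≤1+n (short g) ; supported = supported g } ∷ extension-good x gs

  headSet : List Slot → Subset n
  headSet []            = ∅
  headSet ((_ , S) ∷ _) = setOf S

  open Problem F using (sumOver)

  -- The cost of the slots without the acquisitions at the first of them.
  tailCost : (Fin n → Carrier) → List Slot → Carrier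
  tailCost a []               = 0#
  tailCost a ((row , S) ∷ ss) = (sumOver (cAt row) (setOf S) + sumOver a (headSet ss ─ setOf S)) + tailCost a ss

  -- The counterpart of `tailCost` in the linear program: the contribution of one element without
  -- its acquisition at the first row. What is acquired there depends on a set that the backward
  -- walk has not reached.
  tailShare : (Fin n → Carrier) → Fin n → List Row → Carrier
  tailShare a e []           = 0#
  tailShare a e (row ∷ rows) = (cAt row e * zAt row e + a e * yHead rows e) + tailShare a e rows

  slotsCost : (Fin n → Carrier) → List Slot → Carrier
  slotsCost a ss = sumOver a (headSet ss) + tailCost a ss

  share : (Fin n → Carrier) → List Row → Fin n → Carrier
  share a rows e = a e * yHead rows e + tailShare a e rows

  sumSlots : (Row → List (Fin n) → Carrier) → List Slot → Carrier
  sumSlots g = sumL λ s → g (proj₁ s) (proj₂ s)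

-- The walk of one element: law, marginals and expected cost.

module Chain {F : OrderedField} (H : Height F) {n : ℕ} (M : Matroid n) (B : ℕ) .{{_ : NonZero B}} where
  open FieldProperties F
  open Height H
  open Semantics H M
  open RunProperties H M
  open ProgramValues H M
  open PowerBounds B
  open TimeBounds H M B
  open FlipLet H M
  open Slots H M B
  open Coupling F
  open SumOver F {n}
  open Problem F using (sumOver)

  stepT : ∀ {Γ} → Term (SlotTy ∷ StateTy ∷ (elt ⊗ num) ∷ Γ) StateTy
  stepT = let′ (flip coinT) updateT

  module _ (e : Fin n × Carrier) {Γ : List Ty} (ρ : Env Γ) where
    private
      d = proj₁ e

    run : List Slot → Run (Val StateTy)
    run = foldM (λ s st → eval stepT (s ∷ st ∷ e ∷ ρ)) (inj₂ tt , 0# , [])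

    κ : Val bool → List Slot → Row → Carrier
    κ b ss row = clip (condProb b (zHead (rowsOf ss) d) (zAt row d))

    Reachable : List Slot → Val StateTy → Set
    Reachable ss (b , z , out) = z ≡ zHead (rowsOf ss) d × Extension d ss b out

    update : Slot → Val StateTy → Val bool → Val StateTy
    update s st b = det updateT (b ∷ s ∷ st ∷ e ∷ ρ)

    Ex-step : ∀ {row S ss st} (f : Val StateTy → Carrier) → Reachable ss st →
      Ex f (eval stepT ((row , S) ∷ st ∷ e ∷ ρ)) ≡
        κ (proj₁ st) ss row * f (update (row , S) st (inj₁ tt)) + (1# - κ (proj₁ st) ss row) * f (update (row , S) st (inj₂ tt))
    Ex-step {row} {S} {ss} {b , _ , out} f (refl , _) = trans (Ex-flip-let coinT updateT _ _ ((row , S) ∷ (b , zHead (rowsOf ss) d , out) ∷ e ∷ ρ) f)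
      (cong (λ x → clip x * f (update (row , S) (b , zHead (rowsOf ss) d , out) (inj₁ tt)) + (1# - clip x) * f (update (row , S) (b , zHead (rowsOf ss) d , out) (inj₂ tt)))
        (det-coin (row , S) b (zHead (rowsOf ss) d) out e ρ))

    update-reachable : ∀ {row S ss st} → Reachable ss st → ∀ b → Reachable ((row , S) ∷ ss) (update (row , S) st b)
    update-reachable {row} (_ , x) b = refl , lemma b x
      where
      lemma : ∀ {row S ss b₀ out} b → Extension d ss b₀ out →
        Extension d ((row , S) ∷ ss) (newBit row d b) ((row , extend (newBit row d b) d S) ∷ out)
      lemma {row} b x with zAt row d ≤? 0#
      lemma b         x | yes _ = skip x
      lemma (inj₁ tt) x | no z≰0 = take z≰0 x
      lemma (inj₂ tt) x | no _ = skip x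

    private
      goodTail : ∀ {s ss} → GoodRows (rowsOf (s ∷ ss)) → GoodRows (rowsOf ss)
      goodTail (step _ _ g) = g

      zHead-height : ∀ {rows} → GoodRows rows → height (zHead rows d) ℕ.≤ B
      zHead-height []            = ℕ.≤-trans (ℕ.≤-reflexive height-0) z≤n
      zHead-height (step g _ _) = z-height (small g) d

      zHead-nonNeg : ∀ {rows} → GoodRows rows → 0# ≤ zHead rows d
      zHead-nonNeg []            = ≤-refl
      zHead-nonNeg (step g _ _) = z-nonNeg g d

      zHead-≤1 : ∀ {rows} → GoodRows rows → zHead rows d ≤ 1#
      zHead-≤1 []            = 0≤1
      zHead-≤1 (step g _ _) = z-≤1 g d

      yHead-nonNeg : ∀ {rows} → GoodRows rows → 0# ≤ yHead rows d
      yHead-nonNeg []            = ≤-refl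
      yHead-nonNeg (step g _ _) = y-nonNeg g d

    spec-run : ∀ ss → GoodRows (rowsOf ss) → Spec (run ss) (length ss ℕ.* suc (200 ℕ.* B ℕ.^ 1)) (Reachable ss)
    spec-run = spec-foldM (GoodRows ∘ rowsOf) Reachable (λ {s} {ss} → goodTail {s} {ss}) (refl , []) one-step
      where
      one-step : ∀ {s ss st} → GoodRows (rowsOf (s ∷ ss)) → Reachable ss st →
             Spec (eval stepT (s ∷ st ∷ e ∷ ρ)) (200 ℕ.* B ℕ.^ 1) (Reachable (s ∷ ss))
      one-step {s} {ss} {b , _ , out} (step g _ gs) r@(refl , _) = spec-weaken
        (unbound (enlarge 200 1 ((time-coin s b z out e ρ (small g) hz
           ⊞ (constant 1 ⊞ subst (λ x → height x ≼ 10 ·B^ 1) (sym (det-coin s b z out e ρ))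
                 (height-coin b hz (z-height (small g) d))) ⊞ constant 0)
           ⊞ constant 1 ⊞ self)))
        id
        (spec-flip-let coinT updateT _ _ (s ∷ (b , z , out) ∷ e ∷ ρ)
          (λ b′ → unbound (time-update b′ s (b , z , out) e ρ (small g))) (update-reachable r))
        where
        z = zHead (rowsOf ss) d
        hz = zHead-height gs
        self : 80 ℕ.* B ℕ.^ 1 ≼ 80 ·B^ 1
        self = bound ℕ.≤-refl

    Ex-run-∷ : ∀ {row S ss} (f : Val StateTy → Carrier) → GoodRows (rowsOf ss) →
      Ex f (run ((row , S) ∷ ss)) ≡
      Ex (λ st → κ (proj₁ st) ss row * f (update (row , S) st (inj₁ tt))
               + (1# - κ (proj₁ st) ss row) * f (update (row , S) st (inj₂ tt))) (run ss)
    Ex-run-∷ {row} {S} {ss} f g = trans (Ex-foldM-∷ (λ s st → eval stepT (s ∷ st ∷ e ∷ ρ)) (inj₂ tt , 0# , []) (row , S) ss f)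
      (Ex-cong (spec-run ss g) (Ex-step {row} {S} f))

    -- The transition operator of the chain: the conditional expectation, given the choice `b` at
    -- the later time step, of `h` applied to `b` and the choice at the earlier one. The rejection
    -- of mass zero is included.
    mixed : (Val bool → Val bool → Carrier) → List Slot → Row → Val bool → Carrier
    mixed h ss row b = κ b ss row * h b (newBit row d (inj₁ tt)) + (1# - κ b ss row) * h b (newBit row d (inj₂ tt))

    -- One transition carries the Bernoulli law of the later mass to that of the earlier one. If the
    -- earlier mass is not positive, it is zero, and the rejection of every choice agrees with it.
    mixed-marginal : ∀ {row ss} → GoodRow row → GoodRows (rowsOf ss) → ∀ (h : Val bool → Carrier) →
      (let z = zHead (rowsOf ss) d ; h′ = mixed (λ _ → h) ss row in
      z * h′ (inj₁ tt) + (1# - z) * h′ (inj₂ tt) ≡ zAt row d * h (inj₁ tt) + (1# - zAt row d) * h (inj₂ tt))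
    mixed-marginal {row} {ss} g gs h with zAt row d ≤? 0#
    ... | yes z′≤0 = trans (cong₂ (λ x y → z * x + (1# - z) * y) (mixture-const _ _) (mixture-const _ _))
                       (trans (mixture-const z _) (trans (sym (mixture-0 _ _))
                         (cong (λ w → w * h (inj₁ tt) + (1# - w) * h (inj₂ tt)) (antisym (z-nonNeg g d) z′≤0))))
      where z = zHead (rowsOf ss) d
    ... | no _ = trans (two-stage (zHead (rowsOf ss) d) (κ (inj₁ tt) ss row) (κ (inj₂ tt) ss row) (h (inj₁ tt)) (h (inj₂ tt)))
                   (cong (λ w → w * h (inj₁ tt) + (1# - w) * h (inj₂ tt))
                     (coupling-marginal (zHead-nonNeg gs) (zHead-≤1 gs) (z-nonNeg g d) (z-≤1 g d)))

    law : ∀ ss → GoodRows (rowsOf ss) → ∀ (h : Val bool → Carrier) →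
          Ex (h ∘ proj₁) (run ss) ≡ zHead (rowsOf ss) d * h (inj₁ tt) + (1# - zHead (rowsOf ss) d) * h (inj₂ tt)
    law [] [] h = trans (Ex-single (h ∘ proj₁) {run []} refl) (sym (mixture-0 _ _))
    law ((row , S) ∷ ss) (step g _ gs) h = begin
        Ex (h ∘ proj₁) (run ((row , S) ∷ ss))            ≡⟨ Ex-run-∷ {row} {S} {ss} (h ∘ proj₁) gs ⟩
        Ex (mixed (λ _ → h) ss row ∘ proj₁) (run ss)     ≡⟨ law ss gs (mixed (λ _ → h) ss row) ⟩
        _                                                ≡⟨ mixed-marginal {row} {ss} g gs h ⟩
        zAt row d * h (inj₁ tt) + (1# - zAt row d) * h (inj₂ tt) ∎
      where open ≡-Reasoning

    out : Val StateTy → List Slot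
    out = proj₂ ∘ proj₂

    -- The choices at different time steps are dependent, but a sum of functions of single slots
    -- sees only the marginals.
    Ex-sumSlots : ∀ (g : Row → List (Fin n) → Carrier) ss → GoodRows (rowsOf ss) →
      Ex (sumSlots g ∘ out) (run ss) ≡ sumSlots (λ row S → zAt row d * g row (d ∷ S) + (1# - zAt row d) * g row S) ss
    Ex-sumSlots g [] [] = Ex-single (sumSlots g ∘ out) {run []} refl
    Ex-sumSlots g ((row , S) ∷ ss) (step gr _ gs) = begin
        Ex (sumSlots g ∘ out) (run ((row , S) ∷ ss))
          ≡⟨ Ex-run-∷ {row} {S} {ss} (sumSlots g ∘ out) gs ⟩
        Ex (λ st → κ (proj₁ st) ss row * (h (newBit row d (inj₁ tt)) + sumSlots g (out st))
                 + (1# - κ (proj₁ st) ss row) * (h (newBit row d (inj₂ tt)) + sumSlots g (out st))) (run ss)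
          ≡⟨ Ex-ext (λ st → mixture-+ (κ (proj₁ st) ss row) _ _ (sumSlots g (out st))) (run ss) ⟩
        Ex (λ st → mixed (λ _ → h) ss row (proj₁ st) + sumSlots g (out st)) (run ss)
          ≡⟨ Ex-+ (mixed (λ _ → h) ss row ∘ proj₁) (sumSlots g ∘ out) (run ss) ⟩
        Ex (mixed (λ _ → h) ss row ∘ proj₁) (run ss) + Ex (sumSlots g ∘ out) (run ss)
          ≡⟨ cong₂ _+_ (trans (law ss gs (mixed (λ _ → h) ss row)) (mixed-marginal {row} {ss} gr gs h)) (Ex-sumSlots g ss gs) ⟩
        _ ∎
      where
      open ≡-Reasoning
      h : Val bool → Carrier
      h b = g row (extend b d S)

    module _ (a : Fin n → Carrier) (a-nonNeg : ∀ e → 0# ≤ a e) where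
      chosen : Val bool → Carrier
      chosen (inj₁ _) = 1#
      chosen (inj₂ _) = 0#

      -- The first argument is the choice at the later time step, so an acquisition means chosen
      -- there and not at the earlier one.
      acquired : Val bool → Val bool → Carrier
      acquired (inj₁ _) (inj₂ _) = 1#
      acquired _        _        = 0#

      holding-extend : ∀ {row} → GoodRow row → ∀ b S →
        sumOver (cAt row) (setOf (extend b d S)) ≤ sumOver (cAt row) (setOf S) + cAt row d * chosen b
      holding-extend {row} g (inj₂ _) S = ≤-reflexive (sym (x+y*0≡x (sumOver (cAt row) (setOf S)) (cAt row d)))
      holding-extend {row} g (inj₁ _) S = ≤-trans (sumOver-∪ ⁅ d ⁆ (setOf S) (c-nonNeg g)) (≤-reflexive (trans (+-comm _ _)
        (cong (sumOver (cAt row) (setOf S) +_) (trans (sumOver-⁅⁆ F (cAt row) d) (sym (*-identityʳ _))))))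

      headSet-extension : ∀ {ss b ss′} → Extension d ss b ss′ → headSet ss′ ⊆ [ (λ _ → ⁅ d ⁆ ∪ headSet ss) , (λ _ → headSet ss) ]′ b
      headSet-extension []         = id
      headSet-extension (take _ _) = id
      headSet-extension (skip _)   = id

      -- Adding the element to the earlier set can only shrink the difference. The difference gains
      -- it only if it joins the later set and not the earlier one.
      acquisition-extend : ∀ {ss b ss′} → Extension d ss b ss′ → ∀ b′ S →
        sumOver a (headSet ss′ ─ setOf (extend b′ d S)) ≤ sumOver a (headSet ss ─ setOf S) + a d * acquired b b′
      acquisition-extend {ss} {inj₂ _} {ss′} x b′ S = ≤-trans
        (sumOver-mono a-nonNeg (─-mono {p = headSet ss′} {headSet ss} {setOf (extend b′ d S)} {setOf S} (λ p _ → headSet-extension x p) (mono b′)))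
        (≤-reflexive (sym (x+y*0≡x (sumOver a (headSet ss ─ setOf S)) (a d))))
        where
        mono : ∀ b′ → setOf S ⊆ setOf (extend b′ d S)
        mono (inj₁ _) = p⊆⁅x⁆∪p d (setOf S)
        mono (inj₂ _) = id
      acquisition-extend {ss} {inj₁ _} {ss′} x (inj₁ _) S = ≤-trans
        (sumOver-mono a-nonNeg (─-mono {p = headSet ss′} {headSet ss} {⁅ d ⁆ ∪ setOf S} {setOf S} kept (p⊆⁅x⁆∪p d (setOf S))))
        (≤-reflexive (sym (x+y*0≡x (sumOver a (headSet ss ─ setOf S)) (a d))))
        where
        kept : ∀ {f} → f ∈ headSet ss′ → f ∉ ⁅ d ⁆ ∪ setOf S → f ∈ headSet ss
        kept {f} p q with x∈p∪q⁻ ⁅ d ⁆ (headSet ss) (headSet-extension x p)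
        ... | inj₁ f∈d = contradiction (p⊆p∪q (setOf S) f∈d) q
        ... | inj₂ f∈  = f∈
      acquisition-extend {ss} {inj₁ _} {ss′} x (inj₂ _) S = ≤-trans
        (sumOver-mono a-nonNeg new)
        (≤-trans (sumOver-∪ (headSet ss ─ setOf S) ⁅ d ⁆ a-nonNeg)
          (≤-reflexive (cong (sumOver a (headSet ss ─ setOf S) +_) (trans (sumOver-⁅⁆ F a d) (sym (*-identityʳ _))))))
        where
        new : headSet ss′ ─ setOf S ⊆ (headSet ss ─ setOf S) ∪ ⁅ d ⁆
        new {f} p with x∈p∪q⁻ ⁅ d ⁆ (headSet ss) (headSet-extension x (p─q⊆p (headSet ss′) (setOf S) p))
        ... | inj₁ f∈d = q⊆p∪q (headSet ss ─ setOf S) ⁅ d ⁆ f∈d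
        ... | inj₂ f∈  = p⊆p∪q ⁅ d ⁆ (x∈p∧x∉q⇒x∈p─q f∈ (x∈p─q⇒x∉q (headSet ss′) (setOf S) p))

      charge : Row → Val bool → Val bool → Carrier
      charge row b b′ = cAt row d * chosen b′ + a d * acquired b b′

      tailCost-extension : ∀ {row S ss b ss′} → GoodRow row → Extension d ss b ss′ → ∀ b′ →
        tailCost a ((row , extend b′ d S) ∷ ss′) ≤
        charge row b b′ + ((sumOver (cAt row) (setOf S) + sumOver a (headSet ss ─ setOf S)) + tailCost a ss′)
      tailCost-extension {row} {S} {ss} {b} {ss′} g x b′ = ≤-trans
        (+-monoˡ-≤ (tailCost a ss′) (+-mono-≤ (holding-extend g b′ S) (acquisition-extend x b′ S)))
        (≤-reflexive (solve 5 (λ p q r s t → p :+ q :+ (r :+ s) :+ t := q :+ s :+ (p :+ r :+ t)) refl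
          (sumOver (cAt row) (setOf S)) (cAt row d * chosen b′) (sumOver a (headSet ss ─ setOf S)) (a d * acquired b b′) (tailCost a ss′)))

      -- Only the state in which the element is chosen contributes, with the probability bounded in
      -- `coupling-drop`. At an earlier mass of zero the element is always rejected, and the
      -- contribution is the whole later mass, which is then at most `y` by the constraint itself.
      mixed-acquired : ∀ {row ss} → GoodRow row → GoodRows (rowsOf ss) →
        zHead (rowsOf ss) d ≤ zAt row d + yHead (rowsOf ss) d →
        (let z = zHead (rowsOf ss) d in
         z * mixed acquired ss row (inj₁ tt) + (1# - z) * mixed acquired ss row (inj₂ tt) ≤ yHead (rowsOf ss) d)
      mixed-acquired {row} {ss} g gs z≤ = ≤-trans (≤-reflexive (trans (cong (λ w → z * mixed acquired ss row (inj₁ tt) + w)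
            (trans (cong ((1# - z) *_) (mixture-const (κ (inj₂ tt) ss row) 0#)) (zeroʳ _))) (+-identityʳ _))) drop
        where
        z = zHead (rowsOf ss) d
        y = yHead (rowsOf ss) d
        drop : z * mixed acquired ss row (inj₁ tt) ≤ y
        drop with zAt row d ≤? 0#
        ... | yes z′≤0 = ≤-trans (≤-reflexive (trans (cong (z *_) (mixture-const _ _)) (*-identityʳ z)))
                (≤-trans z≤ (≤-trans (+-monoˡ-≤ y z′≤0) (≤-reflexive (+-identityˡ y))))
        ... | no _ = ≤-trans (≤-reflexive (cong (z *_) (trans (cong₂ _+_ (zeroʳ _) (*-identityʳ _)) (+-identityˡ _))))
                (coupling-drop (zHead-nonNeg gs) (z-nonNeg g d) (yHead-nonNeg gs) z≤)

      mixed-charge : ∀ {row ss} → GoodRow row → GoodRows (rowsOf ss) →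
        zHead (rowsOf ss) d ≤ zAt row d + yHead (rowsOf ss) d →
        (let z = zHead (rowsOf ss) d in
         z * mixed (charge row) ss row (inj₁ tt) + (1# - z) * mixed (charge row) ss row (inj₂ tt)
           ≤ cAt row d * zAt row d + a d * yHead (rowsOf ss) d)
      mixed-charge {row} {ss} g gs z≤ = begin
          z * mixed (charge row) ss row t + z̄ * mixed (charge row) ss row f
            ≡⟨ cong₂ (λ x y → z * x + z̄ * y) (split t) (split f) ⟩
          z * (c * u t + a d * v t) + z̄ * (c * u f + a d * v f)
            ≡⟨ solve 8 (λ z z̄ c a p q r s → z :* (c :* p :+ a :* q) :+ z̄ :* (c :* r :+ a :* s) := c :* (z :* p :+ z̄ :* r) :+ a :* (z :* q :+ z̄ :* s))
                 refl z z̄ c (a d) (u t) (v t) (u f) (v f) ⟩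
          c * (z * u t + z̄ * u f) + a d * (z * v t + z̄ * v f)
            ≤⟨ +-mono-≤ (≤-reflexive (cong (c *_) (trans (mixed-marginal {row} {ss} g gs chosen)
                           (trans (cong₂ _+_ (*-identityʳ _) (zeroʳ _)) (+-identityʳ _)))))
                        (*-monoˡ-≤ (a-nonNeg d) (mixed-acquired {row} {ss} g gs z≤)) ⟩
          c * zAt row d + a d * yHead (rowsOf ss) d ∎
        where
        open ≤-Reasoning
        t f : Val bool
        t = inj₁ tt
        f = inj₂ tt
        z = zHead (rowsOf ss) d
        z̄ = 1# - z
        c = cAt row d
        u v : Val bool → Carrier
        u = mixed (λ _ → chosen) ss row
        v = mixed acquired ss row
        split : ∀ b → mixed (charge row) ss row b ≡ c * u b + a d * v b
        split b = solve 8 (λ k k̄ c a p q r s → k :* (c :* p :+ a :* q) :+ k̄ :* (c :* r :+ a :* s) := c :* (k :* p :+ k̄ :* r) :+ a :* (k :* q :+ k̄ :* s))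
          refl (κ b ss row) (1# - κ b ss row) c (a d) (chosen (newBit row d t)) (acquired b (newBit row d t)) (chosen (newBit row d f)) (acquired b (newBit row d f))

      -- The existing sets are arbitrary, left by other elements and rounds. Adding one element
      -- changes each cost by at most a charge that depends only on its consecutive choices, so the
      -- law of its walk suffices; it is an inequality because the element may already be present.
      Ex-tailCost : ∀ ss → GoodRows (rowsOf ss) → Ex (tailCost a ∘ out) (run ss) ≤ tailCost a ss + tailShare a d (rowsOf ss)
      Ex-tailCost [] [] = ≤-reflexive (trans (Ex-single (tailCost a ∘ out) {run []} refl) (sym (+-identityˡ 0#)))
      Ex-tailCost ((row , S) ∷ ss) (step g z≤ gs) = begin
          Ex (tailCost a ∘ out) (run ((row , S) ∷ ss))
            ≡⟨ Ex-run-∷ {row} {S} {ss} (tailCost a ∘ out) gs ⟩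
          Ex (λ st → κ (proj₁ st) ss row * tailCost a (out (update (row , S) st (inj₁ tt)))
                   + (1# - κ (proj₁ st) ss row) * tailCost a (out (update (row , S) st (inj₂ tt)))) (run ss)
            ≤⟨ Ex-mono (spec-run ss gs) pointwise ⟩
          Ex (λ st → mixed (charge row) ss row (proj₁ st) + (K + tailCost a (out st))) (run ss)
            ≡⟨ Ex-+ (mixed (charge row) ss row ∘ proj₁) (λ st → K + tailCost a (out st)) (run ss) ⟩
          Ex (mixed (charge row) ss row ∘ proj₁) (run ss) + Ex (λ st → K + tailCost a (out st)) (run ss)
            ≡⟨ cong₂ _+_ (law ss gs (mixed (charge row) ss row))
                 (trans (Ex-+ (λ _ → K) (tailCost a ∘ out) (run ss)) (cong (_+ Ex (tailCost a ∘ out) (run ss)) (Ex-const (spec-run ss gs) K))) ⟩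
          _ + (K + Ex (tailCost a ∘ out) (run ss))
            ≤⟨ +-mono-≤ (mixed-charge {row} {ss} g gs (z≤ d)) (+-monoʳ-≤ K (Ex-tailCost ss gs)) ⟩
          σ + (K + (tailCost a ss + tailShare a d (rowsOf ss)))
            ≡⟨ solve 4 (λ s k t u → s :+ (k :+ (t :+ u)) := k :+ t :+ (s :+ u)) refl σ K (tailCost a ss) (tailShare a d (rowsOf ss)) ⟩
          (K + tailCost a ss) + (σ + tailShare a d (rowsOf ss)) ∎
        where
        open ≤-Reasoning
        K = sumOver (cAt row) (setOf S) + sumOver a (headSet ss ─ setOf S)
        σ = cAt row d * zAt row d + a d * yHead (rowsOf ss) d
        pointwise : ∀ {st} → Reachable ss st →
          κ (proj₁ st) ss row * tailCost a (out (update (row , S) st (inj₁ tt)))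
            + (1# - κ (proj₁ st) ss row) * tailCost a (out (update (row , S) st (inj₂ tt)))
          ≤ mixed (charge row) ss row (proj₁ st) + (K + tailCost a (out st))
        pointwise {st} (_ , x) = ≤-trans
          (+-mono-≤ (*-monoˡ-≤ (clip-nonNeg _) (tailCost-extension g x (newBit row d (inj₁ tt))))
                    (*-monoˡ-≤ (x≤y⇒0≤y-x (clip-≤1 _)) (tailCost-extension g x (newBit row d (inj₂ tt)))))
          (≤-reflexive (mixture-+ (κ (proj₁ st) ss row) _ _ (K + tailCost a (out st))))

      Ex-headCost : ∀ ss → GoodRows (rowsOf ss) → Ex (sumOver a ∘ headSet ∘ out) (run ss) ≤ sumOver a (headSet ss) + a d * zHead (rowsOf ss) d
      Ex-headCost ss gs = begin
          Ex (sumOver a ∘ headSet ∘ out) (run ss)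
            ≤⟨ Ex-mono (spec-run ss gs) pointwise ⟩
          Ex (λ st → sumOver a (headSet ss) + a d * chosen (proj₁ st)) (run ss)
            ≡⟨ Ex-+ (λ _ → sumOver a (headSet ss)) (λ st → a d * chosen (proj₁ st)) (run ss) ⟩
          Ex (λ _ → sumOver a (headSet ss)) (run ss) + Ex (λ st → a d * chosen (proj₁ st)) (run ss)
            ≡⟨ cong₂ _+_ (Ex-const (spec-run ss gs) _) (trans (Ex-* (a d) (chosen ∘ proj₁) (run ss)) (cong (a d *_)
                 (trans (law ss gs chosen) (trans (cong₂ _+_ (*-identityʳ _) (zeroʳ _)) (+-identityʳ _))))) ⟩
          sumOver a (headSet ss) + a d * zHead (rowsOf ss) d ∎
        where
        open ≤-Reasoning
        pointwise : ∀ {st} → Reachable ss st → sumOver a (headSet (out st)) ≤ sumOver a (headSet ss) + a d * chosen (proj₁ st)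
        pointwise {inj₁ _ , _ , ss′} (_ , x) = ≤-trans (sumOver-mono {S = headSet ss′} a-nonNeg (headSet-extension x))
          (≤-trans (sumOver-∪ ⁅ d ⁆ (headSet ss) a-nonNeg) (≤-reflexive (trans (+-comm _ _)
            (cong (sumOver a (headSet ss) +_) (trans (sumOver-⁅⁆ F a d) (sym (*-identityʳ _)))))))
        pointwise {inj₂ _ , _ , ss′} (_ , x) = ≤-trans (sumOver-mono {S = headSet ss′} a-nonNeg (headSet-extension x))
          (≤-reflexive (sym (x+y*0≡x (sumOver a (headSet ss)) (a d))))

      -- At the first time step every chosen element counts as acquired, which has probability z_1
      -- and is charged to y_1.
      Ex-slotsCost : ∀ ss → GoodRows (rowsOf ss) → zHead (rowsOf ss) d ≤ yHead (rowsOf ss) d →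
        Ex (slotsCost a ∘ out) (run ss) ≤ slotsCost a ss + share a (rowsOf ss) d
      Ex-slotsCost ss gs z≤y = begin
        Ex (slotsCost a ∘ out) (run ss)
          ≡⟨ Ex-+ (sumOver a ∘ headSet ∘ out) (tailCost a ∘ out) (run ss) ⟩
        Ex (sumOver a ∘ headSet ∘ out) (run ss) + Ex (tailCost a ∘ out) (run ss)
          ≤⟨ +-mono-≤ (Ex-headCost ss gs) (Ex-tailCost ss gs) ⟩
        (sumOver a (headSet ss) + a d * zHead (rowsOf ss) d) + (tailCost a ss + tailShare a d (rowsOf ss))
          ≤⟨ +-monoˡ-≤ _ (+-monoʳ-≤ _ (*-monoˡ-≤ (a-nonNeg d) z≤y)) ⟩
        (sumOver a (headSet ss) + a d * yHead (rowsOf ss) d) + (tailCost a ss + tailShare a d (rowsOf ss))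
          ≡⟨ solve 4 (λ p q r s → p :+ q :+ (r :+ s) := p :+ r :+ (q :+ s)) refl (sumOver a (headSet ss)) (a d * yHead (rowsOf ss) d) (tailCost a ss) (tailShare a d (rowsOf ss)) ⟩
        slotsCost a ss + share a (rowsOf ss) d ∎
        where open ≤-Reasoning

-- One round: halving the deficit and paying the linear program.

module Sampling {F : OrderedField} (H : Height F) {n : ℕ} (M : Matroid n) (B : ℕ) .{{_ : NonZero B}} where
  open FieldProperties F
  open Semantics H M
  open MatroidProperties M
  open RunProperties H M
  open ProgramValues H M
  open PowerBounds B
  open FlipLet H M
  open ListSums F
  open Slots H M B
  open Chain H M B
  open Coupling F
  open Problem F using (sumOver)

  Ex-snd : ∀ {Γ σ τ} (t : Term Γ (σ ⊗ τ)) (ρ : Env Γ) (f : Val τ → Carrier) → Ex f (eval (snd t) ρ) ≡ Ex (f ∘ proj₂) (eval t ρ)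
  Ex-snd t ρ f = trans (Ex->>= f (eval t ρ) (λ v → 1 ⟫ return (proj₂ v)))
    (Ex-ext (λ v → trans (Ex-⟫ f 1 (return (proj₂ v))) (Ex-single f {return (proj₂ v)} refl)) (eval t ρ))

  spec-snd : ∀ {Γ σ τ b} (t : Term Γ (σ ⊗ τ)) (ρ : Env Γ) {Q : Val τ → Set} →
    Spec (eval t ρ) b (Q ∘ proj₂) → Spec (eval (snd t) ρ) (b ℕ.+ 1) Q
  spec-snd t ρ S = spec->>= (λ v → 1 ⟫ return (proj₂ v)) S (λ q → spec-⟫ 1 (spec-single refl z≤n q))

  record Inv (rows : List Row) (k : ℕ) (ss : List Slot) : Set where
    constructor inv
    field
      same-rows  : rowsOf ss ≡ rows
      good-slots : All (GoodSlot k) ss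
  open Inv public

  length-rowsOf : ∀ {rows k ss} → Inv rows k ss → length ss ≡ length rows
  length-rowsOf {ss = ss} (inv refl _) = sym (List.length-map proj₁ ss)

  good-rows : ∀ {rows k ss} → GoodRows rows → Inv rows k ss → GoodRows (rowsOf ss)
  good-rows g (inv refl _) = g

  chainFoldT : ∀ {Γ} → Term ((elt ⊗ num) ∷ list SlotTy ∷ Γ) StateTy
  chainFoldT = fold v1 (pair (inr unit) (pair zero# nil)) stepT

  Ex-chain : ∀ {Γ} e ss (ρ : Env Γ) (f : List Slot → Carrier) →
    Ex f (eval chainT (e ∷ ss ∷ ρ)) ≡ Ex (f ∘ proj₂ ∘ proj₂) (run e (ss ∷ ρ) ss)
  Ex-chain e ss ρ f = trans (Ex-snd (snd chainFoldT) (e ∷ ss ∷ ρ) f)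
    (trans (Ex-snd chainFoldT (e ∷ ss ∷ ρ) (f ∘ proj₂))
      (Ex-fold v1 (pair (inr unit) (pair zero# nil)) stepT _ _ (e ∷ ss ∷ ρ) (f ∘ proj₂ ∘ proj₂)))

  spec-chain : ∀ {Γ rows k} e ss (ρ : Env Γ) → GoodRows rows → length rows ℕ.≤ B → Inv rows k ss →
    Spec (eval chainT (e ∷ ss ∷ ρ)) (220 ℕ.* B ℕ.^ 2) (Inv rows (suc k))
  spec-chain {rows = rows} {k} e ss ρ g len I@(inv refl gs) = spec-weaken
    (unbound (enlarge 220 2 (((constant 1 ⊞ constant 6 ⊞ constant 1 ⊞ (base len′ ⊠ (constant 1 ⊞ self))) ⊞ constant 1) ⊞ constant 1)))
    id
    (spec-snd (snd chainFoldT) (e ∷ ss ∷ ρ) (spec-snd chainFoldT (e ∷ ss ∷ ρ)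
      (spec-fold v1 (pair (inr unit) (pair zero# nil)) stepT _ _ (e ∷ ss ∷ ρ)
        (spec-weaken ℕ.≤-refl (λ (_ , x) → inv (extension-rows x) (extension-good x gs))
          (spec-run e (ss ∷ ρ) ss g)))))
    where
    len′ : length ss ℕ.≤ B
    len′ = ℕ.≤-trans (ℕ.≤-reflexive (length-rowsOf I)) len
    self : 200 ℕ.* B ℕ.^ 1 ≼ 200 ·B^ 1
    self = bound ℕ.≤-refl

  deficit : List (Fin n) → Carrier
  deficit S = fromℕ (rk full) - fromℕ (rk (setOf S))

  unspanned : List (Fin n) → Fin n → Carrier
  unspanned S e = if does (spanned? (setOf S) e) then 0# else 1#

  missing : List (Fin n × Carrier) → Row → List (Fin n) → Carrier
  missing es row S = sumL (λ e → zAt row (proj₁ e) * unspanned S (proj₁ e)) es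

  -- Its expectation does not increase when a further element is processed.
  potential : List (Fin n × Carrier) → Row → List (Fin n) → Carrier
  potential es row S = deficit S + missing es row S

  unspanned-nonNeg : ∀ S e → 0# ≤ unspanned S e
  unspanned-nonNeg S e with does (spanned? (setOf S) e)
  ... | true  = ≤-refl
  ... | false = 0≤1

  unspanned-∈ : ∀ {S e} → e ∈ setOf S → unspanned S e ≡ 0#
  unspanned-∈ {S} {e} e∈ with spanned? (setOf S) e
  ... | yes _ = refl
  ... | no ¬p = contradiction (∈⇒spanned e∈) ¬p

  unspanned-anti : ∀ d S e → unspanned (d ∷ S) e ≤ unspanned S e
  unspanned-anti d S e with spanned? (setOf (d ∷ S)) e | spanned? (setOf S) e
  ... | yes _ | yes _ = ≤-refl
  ... | yes _ | no _  = 0≤1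
  ... | no ¬p | yes p = contradiction (spanned-mono (p⊆⁅x⁆∪p d (setOf S)) p) ¬p
  ... | no _  | no _  = ≤-refl

  deficit-nonNeg : ∀ S → 0# ≤ deficit S
  deficit-nonNeg S = x≤y⇒0≤y-x (fromℕ-mono (rank≤rank-full (setOf S)))

  deficit-∷ : ∀ d S → deficit (d ∷ S) + unspanned S d ≤ deficit S
  deficit-∷ d S = begin
      (R - fromℕ r′) + u                ≡⟨ +-comm _ u ⟩
      u + (R - fromℕ r′)                ≡⟨ solve 3 (λ u R m → u :+ (R :+ m) := R :+ (u :+ m)) refl u R (- fromℕ r′) ⟩
      R + (u - fromℕ r′)                ≤⟨ +-monoʳ-≤ R lemma ⟩
      R + (- fromℕ r)                   ∎
    where
    open ≤-Reasoning
    R = fromℕ (rk full)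
    r = rk (setOf S)
    r′ = rk (setOf (d ∷ S))
    u = unspanned S d
    step-up : fromℕ r + u ≤ fromℕ r′
    step-up with spanned? (setOf S) d
    ... | yes p = ≤-reflexive (trans (+-identityʳ _) (cong fromℕ (sym p)))
    ... | no ¬p = ≤-trans (≤-reflexive (+-comm _ 1#)) (fromℕ-mono (unspanned⇒rank< ¬p))
    lemma : u - fromℕ r′ ≤ - fromℕ r
    lemma = x≤y+z⇒x-z≤y (+-cancelʳ-≤ (fromℕ r) (≤-trans (≤-reflexive (+-comm u (fromℕ r)))
      (≤-trans step-up (≤-reflexive (sym (trans (cong (_+ fromℕ r) (+-comm _ (fromℕ r′))) (x-y+y≡x (fromℕ r′) (fromℕ r))))))))

  missing-anti : ∀ row d S es → (∀ e → 0# ≤ zAt row e) → missing es row (d ∷ S) ≤ missing es row S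
  missing-anti row d S []       0≤z = ≤-refl
  missing-anti row d S (e ∷ es) 0≤z = +-mono-≤ (*-monoˡ-≤ (0≤z (proj₁ e)) (unspanned-anti d S (proj₁ e))) (missing-anti row d S es 0≤z)

  -- Here `es` are the elements already processed in this round. If ν is 1 when `S` does not span
  -- `e` and 0 otherwise, choosing `e`, with probability z, lowers the deficit by at least ν, while
  -- rejecting it, with probability 1 - z, adds the term zν. The expected gain zν outweighs the
  -- expected loss z (1 - z) ν, and the older terms only shrink because spans grow.
  potential-step : ∀ {row} → GoodRow row → ∀ e es S →
    (let z = zAt row (proj₁ e) in
    z * potential (e ∷ es) row (proj₁ e ∷ S) + (1# - z) * potential (e ∷ es) row S ≤ potential es row S)
  potential-step {row} g e es S = begin
      z * (D′ + (z * ν′ + W′)) + z̄ * (D + (z * ν + W))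
        ≤⟨ +-monoˡ-≤ _ (*-monoˡ-≤ 0≤z (+-monoʳ-≤ D′ (+-mono-≤ (≤-reflexive (trans (cong (z *_) ν′≡0) (zeroʳ z))) W′≤W))) ⟩
      z * (D′ + (0# + W)) + z̄ * (D + (z * ν + W))
        ≡⟨ trans (cong (λ w → z * (D′ + w) + z̄ * (D + (z * ν + W))) (+-identityˡ W))
             (solve 6 (λ z z̄ D D′ ν W → z :* (D′ :+ W) :+ z̄ :* (D :+ (z :* ν :+ W)) := z :* (D′ :+ z̄ :* ν :+ W) :+ z̄ :* (D :+ W)) refl z z̄ D D′ ν W) ⟩
      z * (D′ + z̄ * ν + W) + z̄ * (D + W)
        ≤⟨ +-monoˡ-≤ _ (*-monoˡ-≤ 0≤z (+-monoˡ-≤ W (≤-trans (+-monoʳ-≤ D′ z̄ν≤ν) (deficit-∷ (proj₁ e) S)))) ⟩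
      z * (D + W) + z̄ * (D + W)
        ≡⟨ mixture-const z (D + W) ⟩
      D + W ∎
    where
    open ≤-Reasoning
    z = zAt row (proj₁ e)
    z̄ = 1# - z
    D = deficit S
    D′ = deficit (proj₁ e ∷ S)
    ν = unspanned S (proj₁ e)
    ν′ = unspanned (proj₁ e ∷ S) (proj₁ e)
    W = missing es row S
    W′ = missing es row (proj₁ e ∷ S)
    0≤z = z-nonNeg g (proj₁ e)
    ν′≡0 : ν′ ≡ 0#
    ν′≡0 = unspanned-∈ {proj₁ e ∷ S} (x∈⁅x⁆∪p (proj₁ e) (setOf S))
    W′≤W : W′ ≤ W
    W′≤W = missing-anti row (proj₁ e) S es (z-nonNeg g)
    z̄ν≤ν : z̄ * ν ≤ ν
    z̄ν≤ν = ≤-trans (*-monoʳ-≤ (unspanned-nonNeg S (proj₁ e)) z̄≤1) (≤-reflexive (*-identityˡ ν))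
      where
      z̄≤1 : z̄ ≤ 1#
      z̄≤1 = x≤y+z⇒x-z≤y (x≤x+y 0≤z)

  sumSlots-mono : ∀ {Q : Row → Set} {g h : Row → List (Fin n) → Carrier} ss → All Q (rowsOf ss) →
    (∀ {row} S → Q row → g row S ≤ h row S) → sumSlots g ss ≤ sumSlots h ss
  sumSlots-mono []             []       p = ≤-refl
  sumSlots-mono ((_ , S) ∷ ss) (q ∷ qs) p = +-mono-≤ (p S q) (sumSlots-mono ss qs p)

  all-good : ∀ {rows} → GoodRows rows → All GoodRow rows
  all-good []            = []
  all-good (step g _ gs) = g ∷ all-good gs

  module Pass (rows : List Row) (good : GoodRows rows) (len : length rows ℕ.≤ B) {Γ : List Ty} (ρ : Env Γ) where

    pass : List (Fin n × Carrier) → List Slot → Run (List Slot)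
    pass es ss = foldM (λ e b → eval chainT (e ∷ b ∷ ρ)) ss es

    spec-pass : ∀ {k ss} es → Inv rows k ss → Spec (pass es ss) (length es ℕ.* suc (220 ℕ.* B ℕ.^ 2)) (Inv rows (length es ℕ.+ k))
    spec-pass {k} es I = spec-foldM (λ _ → ⊤) (λ es → Inv rows (length es ℕ.+ k)) (λ _ → tt) I
      (λ {e} {_} {b} _ J → spec-chain e b ρ good len J) es tt

    Ex-potential : ∀ {k ss} es → Inv rows k ss →
      Ex (sumSlots (potential es)) (pass es ss) ≤ sumSlots (potential []) ss
    Ex-potential {ss = ss} [] I = ≤-reflexive (Ex-single (sumSlots (potential [])) {pass [] ss} refl)
    Ex-potential {k} {ss} (e ∷ es) I = begin
        Ex (sumSlots (potential (e ∷ es))) (pass (e ∷ es) ss)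
          ≡⟨ Ex-foldM-∷ (λ e b → eval chainT (e ∷ b ∷ ρ)) ss e es (sumSlots (potential (e ∷ es))) ⟩
        Ex (λ b → Ex (sumSlots (potential (e ∷ es))) (eval chainT (e ∷ b ∷ ρ))) (pass es ss)
          ≤⟨ Ex-mono (spec-pass es I) (λ {b} J → ≤-trans
               (≤-reflexive (trans (Ex-chain e b ρ (sumSlots (potential (e ∷ es)))) (Ex-sumSlots e (b ∷ ρ) (potential (e ∷ es)) b (good-rows good J))))
               (sumSlots-mono b (all-good (good-rows good J)) (λ S g → potential-step g e es S))) ⟩
        Ex (sumSlots (potential es)) (pass es ss)
          ≤⟨ Ex-potential es I ⟩
        sumSlots (potential []) ss ∎
      where open ≤-Reasoning

    -- At the start of a round the potential is the deficit; at its end the cover condition makes it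
    -- at least twice the deficit. The sum of two equal terms replaces a division by 2.
    Ex-halving : ∀ {k ss} es → Inv rows k ss →
      All (λ row → ∀ S → deficit S ≤ missing es row S) rows →
      Ex (sumSlots (λ _ → deficit)) (pass es ss) + Ex (sumSlots (λ _ → deficit)) (pass es ss) ≤ sumSlots (λ _ → deficit) ss
    Ex-halving {k} {ss} es I cover = begin
        Ex (sumSlots (λ _ → deficit)) (pass es ss) + Ex (sumSlots (λ _ → deficit)) (pass es ss)
          ≡⟨ sym (Ex-+ (sumSlots (λ _ → deficit)) (sumSlots (λ _ → deficit)) (pass es ss)) ⟩
        Ex (λ b → sumSlots (λ _ → deficit) b + sumSlots (λ _ → deficit) b) (pass es ss)
          ≤⟨ Ex-mono (spec-pass es I) (λ {b} J → ≤-trans (≤-reflexive (sym (sumL-+ (deficit ∘ proj₂) (deficit ∘ proj₂) b)))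
               (sumSlots-mono b (subst (All _) (sym (same-rows J)) cover) (λ S c → +-monoʳ-≤ (deficit S) (c S)))) ⟩
        Ex (sumSlots (potential es)) (pass es ss)
          ≤⟨ Ex-potential es I ⟩
        sumSlots (potential []) ss
          ≤⟨ sumSlots-mono ss (all-good (good-rows good I)) (λ S g → ≤-reflexive (+-identityʳ (deficit S))) ⟩
        sumSlots (λ _ → deficit) ss ∎
      where open ≤-Reasoning

    Ex-pass-cost : ∀ {k ss} (a : Fin n → Carrier) → (∀ e → 0# ≤ a e) → (∀ e → zHead rows e ≤ yHead rows e) → ∀ es → Inv rows k ss →
      Ex (slotsCost a) (pass es ss) ≤ slotsCost a ss + sumL (share a rows ∘ proj₁) es
    Ex-pass-cost {ss = ss} a 0≤a z≤y [] I = ≤-reflexive (trans (Ex-single (slotsCost a) {pass [] ss} refl) (sym (+-identityʳ _)))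
    Ex-pass-cost {k} {ss} a 0≤a z≤y (e ∷ es) I = begin
        Ex (slotsCost a) (pass (e ∷ es) ss)
          ≡⟨ Ex-foldM-∷ (λ e b → eval chainT (e ∷ b ∷ ρ)) ss e es (slotsCost a) ⟩
        Ex (λ b → Ex (slotsCost a) (eval chainT (e ∷ b ∷ ρ))) (pass es ss)
          ≤⟨ Ex-mono (spec-pass es I) pointwise ⟩
        Ex (λ b → slotsCost a b + share a rows (proj₁ e)) (pass es ss)
          ≡⟨ trans (Ex-+ (slotsCost a) (λ _ → share a rows (proj₁ e)) (pass es ss))
                   (cong (Ex (slotsCost a) (pass es ss) +_) (Ex-const (spec-pass es I) _)) ⟩
        Ex (slotsCost a) (pass es ss) + share a rows (proj₁ e)
          ≤⟨ +-monoˡ-≤ _ (Ex-pass-cost a 0≤a z≤y es I) ⟩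
        (slotsCost a ss + sumL (share a rows ∘ proj₁) es) + share a rows (proj₁ e)
          ≡⟨ trans (+-assoc _ _ _) (cong (slotsCost a ss +_) (+-comm _ _)) ⟩
        slotsCost a ss + sumL (share a rows ∘ proj₁) (e ∷ es) ∎
      where
      open ≤-Reasoning
      pointwise : ∀ {b} → Inv rows (length es ℕ.+ k) b → Ex (slotsCost a) (eval chainT (e ∷ b ∷ ρ)) ≤ slotsCost a b + share a rows (proj₁ e)
      pointwise {b} (inv refl _) = ≤-trans (≤-reflexive (Ex-chain e b ρ (slotsCost a)))
        (Ex-slotsCost e (b ∷ ρ) a 0≤a b good (z≤y (proj₁ e)))

-- Iterating the rounds.

module Rounds {F : OrderedField} (H : Height F) {n : ℕ} (M : Matroid n) (B : ℕ) .{{_ : NonZero B}}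
  (rows : List (Semantics.Val H M RowTy)) (good : Slots.GoodRows H M B rows) (len : length rows ℕ.≤ B)
  (i : Semantics.Val H M InputTy) (len-es : length (proj₁ i) ℕ.≤ B) (u : List ⊤) where
  open FieldProperties F
  open Semantics H M
  open RunProperties H M
  open ProgramValues H M
  open PowerBounds B
  open FlipLet H M
  open ListSums F
  open Slots H M B
  open Sampling H M B

  es : List (Fin n × Carrier)
  es = proj₁ i

  roundT : Term (𝟙 ∷ list SlotTy ∷ list 𝟙 ∷ InputTy ∷ []) (list SlotTy)
  roundT = fold (fst v3) v1 chainT

  roundEnv : ⊤ → List Slot → Env (𝟙 ∷ list SlotTy ∷ list 𝟙 ∷ InputTy ∷ [])
  roundEnv x b = x ∷ b ∷ u ∷ i ∷ []

  round : ⊤ → List Slot → Run (List Slot)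
  round x b = eval roundT (roundEnv x b)

  sampling : List ⊤ → List Slot → Run (List Slot)
  sampling us ss = foldM round ss us

  Ex-round : ∀ x b (f : List Slot → Carrier) → Ex f (round x b) ≡ Ex f (Pass.pass rows good len (roundEnv x b) es b)
  Ex-round x b f = Ex-fold (fst v3) v1 chainT _ _ (roundEnv x b) f

  spec-round : ∀ {k} x b → Inv rows k b → Spec (round x b) (240 ℕ.* B ℕ.^ 3) (Inv rows (length es ℕ.+ k))
  spec-round x b I = spec-weaken
    (unbound (enlarge 240 3 (constant 2 ⊞ constant 1 ⊞ constant 1 ⊞ (base len-es ⊠ (constant 1 ⊞ self))))) id
    (spec-fold (fst v3) v1 chainT _ _ (roundEnv x b) (Pass.spec-pass rows good len (roundEnv x b) es I))
    where
    self : 220 ℕ.* B ℕ.^ 2 ≼ 220 ·B^ 2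
    self = bound ℕ.≤-refl

  spec-sampling : ∀ {k ss} us → Inv rows k ss →
    Spec (sampling us ss) (length us ℕ.* suc (240 ℕ.* B ℕ.^ 3)) (Inv rows (length us ℕ.* length es ℕ.+ k))
  spec-sampling {k} us I = spec-foldM (λ _ → ⊤) (λ us → Inv rows (length us ℕ.* length es ℕ.+ k)) (λ _ → tt) I
    (λ {x} {us} {b} _ J → spec-weaken ℕ.≤-refl
      (λ {v} → subst (λ m → Inv rows m v) (sym (ℕ.+-assoc (length es) (length us ℕ.* length es) k))) (spec-round x b J)) us tt

  totalDeficit : List Slot → Carrier
  totalDeficit = sumSlots (λ _ → deficit)

  -- The powers of 2 stay on the left, so the induction multiplies and never divides. `Ex-halving`
  -- holds from any slots satisfying the invariant, hence also after averaging over the earlier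
  -- rounds.
  Ex-deficit : ∀ {k ss} → All (λ row → ∀ S → deficit S ≤ missing es row S) rows → ∀ us → Inv rows k ss →
    fromℕ (2 ℕ.^ length us) * Ex totalDeficit (sampling us ss) ≤ totalDeficit ss
  Ex-deficit {ss = ss} cover [] I = ≤-reflexive (trans (cong (_* Ex totalDeficit (sampling [] ss)) (+-identityʳ 1#))
    (trans (*-identityˡ (Ex totalDeficit (sampling [] ss))) (Ex-single totalDeficit {sampling [] ss} refl)))
  Ex-deficit {ss = ss} cover (x ∷ us) I = begin
      fromℕ (m ℕ.+ (m ℕ.+ 0)) * E′
        ≡⟨ trans (cong (_* E′) (trans (cong (λ j → fromℕ (m ℕ.+ j)) (ℕ.+-identityʳ m)) (fromℕ-+ m m)))
             (solve 2 (λ p q → (p :+ p) :* q := p :* (q :+ q)) refl (fromℕ m) E′) ⟩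
      fromℕ m * (E′ + E′)
        ≤⟨ *-monoˡ-≤ (fromℕ-nonNeg m) halved ⟩
      fromℕ m * Ex totalDeficit (sampling us ss)
        ≤⟨ Ex-deficit cover us I ⟩
      totalDeficit ss ∎
    where
    open ≤-Reasoning
    m = 2 ℕ.^ length us
    E′ = Ex totalDeficit (sampling (x ∷ us) ss)
    E′-eq : E′ ≡ Ex (λ b → Ex totalDeficit (round x b)) (sampling us ss)
    E′-eq = Ex-foldM-∷ round ss x us totalDeficit
    halved : E′ + E′ ≤ Ex totalDeficit (sampling us ss)
    halved = ≤-trans (≤-reflexive (trans (cong₂ _+_ E′-eq E′-eq)
        (sym (Ex-+ (λ b → Ex totalDeficit (round x b)) (λ b → Ex totalDeficit (round x b)) (sampling us ss)))))
      (Ex-mono (spec-sampling us I) λ {b} J → ≤-trans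
        (≤-reflexive (cong₂ _+_ (Ex-round x b totalDeficit) (Ex-round x b totalDeficit)))
        (Pass.Ex-halving rows good len (roundEnv x b) es J cover))

  Ex-sampling-cost : ∀ {k ss} (a : Fin n → Carrier) → (∀ e → 0# ≤ a e) → (∀ e → zHead rows e ≤ yHead rows e) → ∀ us → Inv rows k ss →
    Ex (slotsCost a) (sampling us ss) ≤ slotsCost a ss + fromℕ (length us) * sumL (share a rows ∘ proj₁) es
  Ex-sampling-cost {ss = ss} a 0≤a z≤y [] I = ≤-reflexive (trans (Ex-single (slotsCost a) {sampling [] ss} refl)
    (sym (trans (cong (slotsCost a ss +_) (zeroˡ _)) (+-identityʳ _))))
  Ex-sampling-cost {ss = ss} a 0≤a z≤y (x ∷ us) I = begin
      Ex (slotsCost a) (sampling (x ∷ us) ss)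
        ≡⟨ Ex-foldM-∷ round ss x us (slotsCost a) ⟩
      Ex (λ b → Ex (slotsCost a) (round x b)) (sampling us ss)
        ≤⟨ Ex-mono (spec-sampling us I) (λ {b} J → ≤-trans (≤-reflexive (Ex-round x b (slotsCost a)))
             (Pass.Ex-pass-cost rows good len (roundEnv x b) a 0≤a z≤y es J)) ⟩
      Ex (λ b → slotsCost a b + σ) (sampling us ss)
        ≡⟨ trans (Ex-+ (slotsCost a) (λ _ → σ) (sampling us ss)) (cong (Ex (slotsCost a) (sampling us ss) +_) (Ex-const (spec-sampling us I) σ)) ⟩
      Ex (slotsCost a) (sampling us ss) + σ
        ≤⟨ +-monoˡ-≤ σ (Ex-sampling-cost a 0≤a z≤y us I) ⟩
      (slotsCost a ss + fromℕ (length us) * σ) + σ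
        ≡⟨ solve 3 (λ c l s → c :+ l :* s :+ s := c :+ (con 1 :+ l) :* s) refl (slotsCost a ss) (fromℕ (length us)) σ ⟩
      slotsCost a ss + fromℕ (length (x ∷ us)) * σ ∎
    where
    open ≤-Reasoning
    σ = sumL (share a rows ∘ proj₁) es

-- The repair: spanning, and its cost.

module Repair {F : OrderedField} (H : Height F) {n : ℕ} (M : Matroid n) (B : ℕ) .{{_ : NonZero B}}
  (a : Fin n → OrderedField.Carrier F) (a-nonNeg : ∀ e → OrderedField._≤_ F (OrderedField.0# F) (a e)) where
  open FieldProperties F
  open MatroidProperties M
  open ProgramValues H M
  open ListSums F
  open Slots H M B
  open Sampling H M B
  open SumOver F {n}
  open Problem F using (sumOver; BasePolytope)

  priced : List (Fin n × Carrier)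
  priced = List.tabulate λ e → e , a e

  weightOf : Row → Fin n → Carrier
  weightOf row e = a e + cAt row e

  budget-sum : ∀ row → budget priced row ≡ sum (λ e → zAt row e * weightOf row e)
  budget-sum row = sumL-tabulate (λ e → zAt row (proj₁ e) * weight row e) (λ e → e , a e)

  costAt : Row → Subset n → Subset n → Carrier
  costAt row P S = sumOver (cAt row) S + sumOver a (S ─ P)

  costAt-∷ : ∀ {row} P e S → GoodRow row → costAt row P (⁅ e ⁆ ∪ S) ≤ costAt row P S + weightOf row e
  costAt-∷ {row} P e S g = ≤-trans (+-mono-≤ holding acquisition)
      (≤-reflexive (solve 4 (λ p q r s → p :+ q :+ (r :+ s) := q :+ s :+ (r :+ p)) refl (cAt row e) (sumOver (cAt row) S) (a e) (sumOver a (S ─ P))))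
    where
    holding : sumOver (cAt row) (⁅ e ⁆ ∪ S) ≤ cAt row e + sumOver (cAt row) S
    holding = ≤-trans (sumOver-∪ ⁅ e ⁆ S (c-nonNeg g)) (≤-reflexive (cong (_+ sumOver (cAt row) S) (sumOver-⁅⁆ F (cAt row) e)))
    sub : (⁅ e ⁆ ∪ S) ─ P ⊆ ⁅ e ⁆ ∪ (S ─ P)
    sub {f} p with x∈p∪q⁻ ⁅ e ⁆ S (p─q⊆p (⁅ e ⁆ ∪ S) P p)
    ... | inj₁ f∈e = p⊆p∪q (S ─ P) f∈e
    ... | inj₂ f∈S = q⊆p∪q ⁅ e ⁆ (S ─ P) (x∈p∧x∉q⇒x∈p─q f∈S (x∈p─q⇒x∉q (⁅ e ⁆ ∪ S) P p))
    acquisition : sumOver a ((⁅ e ⁆ ∪ S) ─ P) ≤ a e + sumOver a (S ─ P)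
    acquisition = ≤-trans (sumOver-mono {S = (⁅ e ⁆ ∪ S) ─ P} a-nonNeg sub)
      (≤-trans (sumOver-∪ ⁅ e ⁆ (S ─ P) a-nonNeg) (≤-reflexive (cong (_+ sumOver a (S ─ P)) (sumOver-⁅⁆ F a e))))

  -- The term `V * deficit` is a prepayment. An element that really enlarges the set weighs at most
  -- `V` and raises the rank, so the prepayment falls by at least `V`.
  augment-potential : ∀ {row V} P e S → GoodRow row → 0# ≤ V →
    costAt row P (setOf (augment row V (e , a e) S)) + V * deficit (augment row V (e , a e) S) ≤ costAt row P (setOf S) + V * deficit S
  augment-potential {row} {V} P e S g 0≤V with zAt row e ≤? 0#
  ... | yes _ = ≤-refl
  ... | no _ with weight row (e , a e) ≤? V
  ...   | no _ = ≤-refl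
  ...   | yes w≤V with Matroid.independent? M (setOf (e ∷ greedy S))
  ...     | no _ = ≤-refl
  ...     | yes p with greedy-test-yes e S p
  ...       | inj₁ unchanged = ≤-reflexive (cong (λ X → costAt row P X + V * (fromℕ (rk full) - fromℕ (rk X))) unchanged)
  ...       | inj₂ up = begin
      costAt row P (setOf (e ∷ S)) + V * deficit (e ∷ S)
        ≤⟨ +-monoˡ-≤ _ (≤-trans (costAt-∷ P e (setOf S) g) (+-monoʳ-≤ (costAt row P (setOf S)) w≤V)) ⟩
      (costAt row P (setOf S) + V) + V * deficit (e ∷ S)
        ≡⟨ solve 3 (λ c v d → c :+ v :+ v :* d := c :+ v :* (d :+ con 1)) refl (costAt row P (setOf S)) V (deficit (e ∷ S)) ⟩
      costAt row P (setOf S) + V * (deficit (e ∷ S) + 1#)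
        ≤⟨ +-monoʳ-≤ _ (*-monoˡ-≤ 0≤V (≤-trans (+-monoʳ-≤ (deficit (e ∷ S)) (≤-reflexive one)) (deficit-∷ e S))) ⟩
      costAt row P (setOf S) + V * deficit S ∎
    where
    open ≤-Reasoning
    one : 1# ≡ unspanned S e
    one with spanned? (setOf S) e
    ... | yes q = contradiction q (ℕ.>⇒≢ up)
    ... | no _  = refl

  augmentAll : Row → Carrier → List (Fin n) → List (Fin n × Carrier) → List (Fin n)
  augmentAll row V S = List.foldr (augment row V) S

  Priced : List (Fin n × Carrier) → Set
  Priced = All λ e → proj₂ e ≡ a (proj₁ e)

  priced-All : Priced priced
  priced-All = All.tabulate⁺ (λ _ → refl)

  augmentAll-potential : ∀ {row V} P S es → GoodRow row → 0# ≤ V → Priced es →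
    costAt row P (setOf (augmentAll row V S es)) + V * deficit (augmentAll row V S es) ≤ costAt row P (setOf S) + V * deficit S
  augmentAll-potential {row} {V} P S []             g 0≤V [] = ≤-refl
  augmentAll-potential {row} {V} P S ((e , _) ∷ es) g 0≤V (refl ∷ ps) =
    ≤-trans (augment-potential P e (augmentAll row V S es) g 0≤V) (augmentAll-potential {row} {V} P S es g 0≤V ps)

  augment-⊇ : ∀ row V e S → setOf S ⊆ setOf (augment row V e S)
  augment-⊇ row V e S with zAt row (proj₁ e) ≤? 0#
  ... | yes _ = id
  ... | no _ with weight row e ≤? V
  ...   | no _ = id
  ...   | yes _ with Matroid.independent? M (setOf (proj₁ e ∷ greedy S))
  ...     | yes _ = p⊆⁅x⁆∪p (proj₁ e) (setOf S)
  ...     | no _  = id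

  augmentAll-⊇ : ∀ row V S es → setOf S ⊆ setOf (augmentAll row V S es)
  augmentAll-⊇ row V S []       = id
  augmentAll-⊇ row V S (e ∷ es) = augment-⊇ row V e (augmentAll row V S es) ∘ augmentAll-⊇ row V S es

  augment-spans : ∀ row V e S → ¬ zAt row (proj₁ e) ≤ 0# → weight row e ≤ V → Spanned (setOf (augment row V e S)) (proj₁ e)
  augment-spans row V e S z≰0 w≤V with zAt row (proj₁ e) ≤? 0#
  ... | yes z≤0 = contradiction z≤0 z≰0
  ... | no _ with weight row e ≤? V
  ...   | no w≰V = contradiction w≤V w≰V
  ...   | yes _ with Matroid.independent? M (setOf (proj₁ e ∷ greedy S))
  ...     | yes _ = ∈⇒spanned (x∈⁅x⁆∪p (proj₁ e) (setOf S))
  ...     | no ¬p = greedy-test-no (proj₁ e) S ¬p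

  augmentAll-spans : ∀ row V S es {e} → e ∈ₗ es → ¬ zAt row (proj₁ e) ≤ 0# → weight row e ≤ V → Spanned (setOf (augmentAll row V S es)) (proj₁ e)
  augmentAll-spans row V S (e ∷ es) (here refl) z≰0 w≤V = augment-spans row V e (augmentAll row V S es) z≰0 w≤V
  augmentAll-spans row V S (d ∷ es) (there e∈)  z≰0 w≤V =
    spanned-mono (augment-⊇ row V d (augmentAll row V S es)) (augmentAll-spans row V S es e∈ z≰0 w≤V)

  augmentAll-supported : ∀ row V S es → All (λ e → ¬ zAt row e ≤ 0#) S → All (λ e → ¬ zAt row e ≤ 0#) (augmentAll row V S es)
  augmentAll-supported row V S []       p = p
  augmentAll-supported row V S (e ∷ es) p with zAt row (proj₁ e) ≤? 0# | augmentAll-supported row V S es p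
  ... | yes _  | q = q
  ... | no z≰0 | q with weight row e ≤? V
  ...   | no _ = q
  ...   | yes _ with Matroid.independent? M (setOf (proj₁ e ∷ greedy (augmentAll row V S es)))
  ...     | yes _ = z≰0 ∷ q
  ...     | no _  = q

  module _ {row : Row} (g : GoodRow row) (polytope : BasePolytope M (zAt row)) where
    open BasePolytope polytope

    private
      V = budget priced row
      z = zAt row
      w = weightOf row

      z-total : sum z ≡ fromℕ (rk full)
      z-total = trans (sym (sumOver-full z)) rank-≡

    weight-nonNeg : ∀ e → 0# ≤ w e
    weight-nonNeg e = 0≤+ (a-nonNeg e) (c-nonNeg g e)

    budget-nonNeg : 0# ≤ V
    budget-nonNeg = subst (0# ≤_) (sym (budget-sum row)) (sum-nonNeg λ e → *-nonNeg (z-nonNeg g e) (weight-nonNeg e))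

    Light : Fin n → Set
    Light e = ¬ z e ≤ 0# × w e ≤ V

    opaque
      light? : ∀ e → Dec (Light e)
      light? e = ¬? (z e ≤? 0#) ×-dec (w e ≤? V)

    light : Subset n
    light = Vec.tabulate (does ∘ light?)

    private
      zᴸ : Fin n → Carrier
      zᴸ e = if Vec.lookup light e then z e else 0#

      lookup-light : ∀ e → Vec.lookup light e ≡ does (light? e)
      lookup-light = Vec.lookup∘tabulate (does ∘ light?)

      zᴸ-cases : ∀ e → (zᴸ e ≡ z e) ⊎ (¬ Light e × zᴸ e ≡ 0#)
      zᴸ-cases e with light? e | lookup-light e
      ... | yes _ | eq = inj₁ (cong (if_then z e else 0#) eq)
      ... | no ¬l | eq = inj₂ (¬l , cong (if_then z e else 0#) eq)

      -- For a light element this is z w, otherwise z (w - V), so it is never negative. It sums to V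
      -- (1 + z(light) - r), which is at most 0 if the light elements have rank below r.
      slack : Fin n → Carrier
      slack e = (z e * w e + V * zᴸ e) - V * z e

      slack-nonNeg : ∀ e → 0# ≤ slack e
      slack-nonNeg e = x≤y⇒0≤y-x (lemma (zᴸ-cases e))
        where
        lemma : (zᴸ e ≡ z e) ⊎ (¬ Light e × zᴸ e ≡ 0#) → V * z e ≤ z e * w e + V * zᴸ e
        lemma (inj₁ eq) = ≤-trans (x≤y+x (*-nonNeg (z-nonNeg g e) (weight-nonNeg e))) (≤-reflexive (cong (λ x → z e * w e + V * x) (sym eq)))
        lemma (inj₂ (¬l , eq)) = ≤-trans heavy (≤-reflexive (sym (trans (cong (λ x → z e * w e + V * x) eq) (x+y*0≡x _ V))))
          where
          heavy : V * z e ≤ z e * w e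
          heavy with z e ≤? 0# | w e ≤? V
          ... | yes z≤0 | _       = ≤-reflexive (trans (trans (cong (V *_) z≡0) (zeroʳ V)) (sym (trans (cong (_* w e) z≡0) (zeroˡ _))))
            where
            z≡0 : z e ≡ 0#
            z≡0 = antisym z≤0 (z-nonNeg g e)
          ... | no z≰0  | yes w≤V = contradiction (z≰0 , w≤V) ¬l
          ... | no _    | no w≰V  = ≤-trans (≤-reflexive (*-comm V (z e))) (*-monoˡ-≤ (z-nonNeg g e) (≰⇒≥ w≰V))

      slack-total : rk light ℕ.< rk full → sum slack ≤ 0#
      slack-total < = begin
          sum slack
            ≡⟨ sum-cong (λ e → cong (z e * w e + V * zᴸ e +_) (-‿distribˡ-* V (z e))) ⟩
          sum (λ e → (z e * w e + V * zᴸ e) + - V * z e)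
            ≡⟨ trans (sum-+ (λ e → z e * w e + V * zᴸ e) (λ e → - V * z e))
                 (cong₂ _+_ (trans (sum-+ (λ e → z e * w e) (λ e → V * zᴸ e)) (cong₂ _+_ (sym (budget-sum row)) (sum-* V zᴸ))) (sum-* (- V) z)) ⟩
          (V + V * sum zᴸ) + - V * sum z
            ≤⟨ +-mono-≤ (+-monoʳ-≤ V (*-monoˡ-≤ budget-nonNeg (rank-≤ light))) (≤-reflexive (cong (- V *_) z-total)) ⟩
          (V + V * fromℕ (rk light)) + - V * fromℕ (rk full)
            ≡⟨ cong (_+ - V * fromℕ (rk full)) (trans (cong (_+ V * fromℕ (rk light)) (sym (*-identityʳ V))) (sym (distribˡ V 1# _))) ⟩
          V * fromℕ (suc (rk light)) + - V * fromℕ (rk full)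
            ≤⟨ +-monoˡ-≤ _ (*-monoˡ-≤ budget-nonNeg (fromℕ-mono <)) ⟩
          V * fromℕ (rk full) + - V * fromℕ (rk full)
            ≡⟨ trans (cong (V * fromℕ (rk full) +_) (sym (-‿distribˡ-* V _))) (-‿inverseʳ _) ⟩
          0# ∎
        where open ≤-Reasoning

    -- Otherwise all slacks vanish, being nonnegative with a sum of at most 0. An element of
    -- positive mass that is not light would then satisfy z w ≤ z V, hence w ≤ V, and be light after
    -- all. So the light elements carry the whole mass r, against their rank. Going through the
    -- slacks covers the borderline of mass exactly 1 on heavier elements, where averaging alone
    -- gives no strict inequality.
    rank-light : rk light ≡ rk full
    rank-light with rk light ℕ.<? rk full
    ... | no ≮ = ℕ.≤-antisym (rank≤rank-full light) (ℕ.≮⇒≥ ≮)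
    ... | yes < = contradiction too-small ¬1≤0
      where
      z≤zᴸ : ∀ e → z e ≤ zᴸ e
      z≤zᴸ e with zᴸ-cases e
      ... | inj₁ eq = ≤-reflexive (sym eq)
      ... | inj₂ (¬l , eq) with z e ≤? 0#
      ...   | yes z≤0 = ≤-trans z≤0 (≤-reflexive (sym eq))
      ...   | no z≰0 = contradiction (z≰0 , *-cancelˡ-≤ (z-nonNeg g e) (z≰0 ∘ ≤-reflexive) zw≤zV) ¬l
        where
        zw≤zV : z e * w e ≤ z e * V
        zw≤zV = begin
          z e * w e               ≡⟨ sym (trans (cong (λ x → z e * w e + V * x) eq) (x+y*0≡x _ V)) ⟩
          z e * w e + V * zᴸ e    ≤⟨ x-z≤y⇒x≤y+z (≤-trans (term≤sum slack-nonNeg e) (slack-total <)) ⟩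
          0# + V * z e            ≡⟨ trans (+-identityˡ _) (*-comm V (z e)) ⟩
          z e * V                 ∎
          where open ≤-Reasoning
      too-small : 1# ≤ 0#
      too-small = +-cancelʳ-≤ (fromℕ (rk light)) (begin
        fromℕ (suc (rk light))  ≤⟨ fromℕ-mono < ⟩
        fromℕ (rk full)         ≡⟨ sym z-total ⟩
        sum z                   ≤⟨ sum-mono z≤zᴸ ⟩
        sum zᴸ                  ≤⟨ rank-≤ light ⟩
        fromℕ (rk light)        ≡⟨ sym (+-identityˡ _) ⟩
        0# + fromℕ (rk light)   ∎)
        where open ≤-Reasoning

    repair-spanning : ∀ S → rk (setOf (repair priced (row , S))) ≡ rk full
    repair-spanning S = ℕ.≤-antisym (rank≤rank-full _)
      (subst (ℕ._≤ rk (setOf (repair priced (row , S)))) rank-light (rank-spanned spanned))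
      where
      spanned : ∀ {e} → e ∈ light → Spanned (setOf (repair priced (row , S))) e
      spanned {e} e∈ with does-true (light? e) (trans (sym (lookup-light e)) (Vec.[]=⇒lookup e∈))
      ... | z≰0 , w≤V = augmentAll-spans row V S priced (List.∈-tabulate⁺ e) z≰0 w≤V

    -- The total mass is r, and the mass inside the closure of `S` is at most the rank of the
    -- closure, which is the rank of `S`. The rest lies outside the span.
    deficit≤missing : ∀ S → deficit S ≤ missing priced row S
    deficit≤missing S = x≤y+z⇒x-z≤y (begin
        fromℕ (rk full)                            ≡⟨ sym z-total ⟩
        sum z                                      ≤⟨ sum-mono split ⟩
        sum (λ e → z e * unspanned S e + zᶜ e)     ≡⟨ sum-+ (λ e → z e * unspanned S e) zᶜ ⟩
        sum (λ e → z e * unspanned S e) + sum zᶜ   ≡⟨ cong (_+ sum zᶜ) (sym (sumL-tabulate (λ e → z (proj₁ e) * unspanned S (proj₁ e)) (λ e → e , a e))) ⟩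
        missing priced row S + sum zᶜ              ≤⟨ +-monoʳ-≤ (missing priced row S) (rank-≤ (closure (setOf S))) ⟩
        missing priced row S + fromℕ (rk (closure (setOf S))) ≡⟨ cong (λ k → missing priced row S + fromℕ k) (rank-closure (setOf S)) ⟩
        missing priced row S + fromℕ (rk (setOf S)) ∎)
      where
      open ≤-Reasoning
      zᶜ : Fin n → Carrier
      zᶜ e = if Vec.lookup (closure (setOf S)) e then z e else 0#
      split : ∀ e → z e ≤ z e * unspanned S e + zᶜ e
      split e with spanned? (setOf S) e | Vec.lookup∘tabulate (does ∘ spanned? (setOf S)) e
      ... | yes _ | eq = ≤-reflexive (sym (trans (cong₂ _+_ (zeroʳ (z e)) (cong (if_then z e else 0#) eq)) (+-identityˡ _)))
      ... | no _  | eq = ≤-reflexive (sym (trans (cong₂ _+_ (*-identityʳ (z e)) (cong (if_then z e else 0#) eq)) (+-identityʳ _)))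

    repair-cost : ∀ P S → costAt row P (setOf (repair priced (row , S))) ≤ costAt row P (setOf S) + V * deficit S
    repair-cost P S = ≤-trans (x≤x+y (*-nonNeg budget-nonNeg (deficit-nonNeg (repair priced (row , S)))))
      (augmentAll-potential P S priced g budget-nonNeg priced-All)

-- The number of rounds against the logarithm.

2^-cancel-≤ : ∀ {m n} → 2 ℕ.^ m ℕ.≤ 2 ℕ.^ n → m ℕ.≤ n
2^-cancel-≤ {m} {n} p with m ℕ.≤? n
... | yes m≤n = m≤n
... | no m≰n  = contradiction p (ℕ.<⇒≱ (ℕ.^-monoʳ-< 2 (s≤s (s≤s z≤n)) (ℕ.≰⇒> m≰n)))

^-distribʳ-* : ∀ q m n → (m ℕ.* n) ℕ.^ q ≡ m ℕ.^ q ℕ.* n ℕ.^ q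
^-distribʳ-* zero    m n = refl
^-distribʳ-* (suc q) m n = trans (cong (m ℕ.* n ℕ.*_) (^-distribʳ-* q m n)) (lemma m n (m ℕ.^ q) (n ℕ.^ q))
  where
  lemma : ∀ m n x y → m ℕ.* n ℕ.* (x ℕ.* y) ≡ m ℕ.* x ℕ.* (n ℕ.* y)
  lemma = solve-∀

previous-suc : ∀ {A : Set} {T} (x₀ : A) (x : Fin (suc T) → A) t → previous x₀ x (suc t) ≡ previous (x zero) (x ∘ suc) t
previous-suc x₀ x zero    = refl
previous-suc x₀ x (suc t) = refl

-- Raising 2 ^ (L₁ + L₂) ≤ 4N to the power q gives (L₁ + L₂) q ≤ 2q + p. One more q pays for the
-- repair, and q ≤ p because N is at least 2, so 3q + p ≤ 4p.
rounds-bound : ∀ N L₁ L₂ r T p q → r ℕ.* T ≡ N → 2 ℕ.≤ N → N ℕ.^ q ℕ.≤ 2 ℕ.^ p →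
  2 ℕ.^ L₁ ℕ.≤ 2 ℕ.* r → 2 ℕ.^ L₂ ℕ.≤ 2 ℕ.* T → q ℕ.* suc (L₁ ℕ.+ L₂) ℕ.≤ 4 ℕ.* p × q ℕ.≤ p
rounds-bound _ L₁ L₂ r T p q refl 2≤N Nq≤2p l₁ l₂ = bound , q≤p
  where
  open ℕ.≤-Reasoning
  q≤p : q ℕ.≤ p
  q≤p = 2^-cancel-≤ (ℕ.≤-trans (ℕ.^-monoˡ-≤ q 2≤N) Nq≤2p)
  Lq≤ : (L₁ ℕ.+ L₂) ℕ.* q ℕ.≤ 2 ℕ.* q ℕ.+ p
  Lq≤ = 2^-cancel-≤ (begin
    2 ℕ.^ ((L₁ ℕ.+ L₂) ℕ.* q)             ≡⟨ ℕ.^-*-assoc 2 (L₁ ℕ.+ L₂) q ⟨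
    (2 ℕ.^ (L₁ ℕ.+ L₂)) ℕ.^ q             ≡⟨ cong (ℕ._^ q) (ℕ.^-distribˡ-+-* 2 L₁ L₂) ⟩
    (2 ℕ.^ L₁ ℕ.* 2 ℕ.^ L₂) ℕ.^ q         ≤⟨ ℕ.^-monoˡ-≤ q (ℕ.*-mono-≤ l₁ l₂) ⟩
    (2 ℕ.* r ℕ.* (2 ℕ.* T)) ℕ.^ q         ≡⟨ cong (ℕ._^ q) (regroup r T) ⟩
    (2 ℕ.^ 2 ℕ.* (r ℕ.* T)) ℕ.^ q         ≡⟨ ^-distribʳ-* q (2 ℕ.^ 2) (r ℕ.* T) ⟩
    (2 ℕ.^ 2) ℕ.^ q ℕ.* (r ℕ.* T) ℕ.^ q   ≤⟨ ℕ.*-monoʳ-≤ ((2 ℕ.^ 2) ℕ.^ q) Nq≤2p ⟩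
    (2 ℕ.^ 2) ℕ.^ q ℕ.* 2 ℕ.^ p           ≡⟨ cong (ℕ._* 2 ℕ.^ p) (ℕ.^-*-assoc 2 2 q) ⟩
    2 ℕ.^ (2 ℕ.* q) ℕ.* 2 ℕ.^ p           ≡⟨ ℕ.^-distribˡ-+-* 2 (2 ℕ.* q) p ⟨
    2 ℕ.^ (2 ℕ.* q ℕ.+ p)                 ∎)
    where
    regroup : ∀ r T → 2 ℕ.* r ℕ.* (2 ℕ.* T) ≡ 4 ℕ.* (r ℕ.* T)
    regroup = solve-∀
  bound : q ℕ.* suc (L₁ ℕ.+ L₂) ℕ.≤ 4 ℕ.* p
  bound = begin
    q ℕ.* suc (L₁ ℕ.+ L₂)       ≡⟨ ℕ.*-comm q _ ⟩
    q ℕ.+ (L₁ ℕ.+ L₂) ℕ.* q     ≤⟨ ℕ.+-monoʳ-≤ q Lq≤ ⟩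
    q ℕ.+ (2 ℕ.* q ℕ.+ p)       ≡⟨ regroup q p ⟩
    3 ℕ.* q ℕ.+ p               ≤⟨ ℕ.+-monoˡ-≤ p (ℕ.*-monoʳ-≤ 3 q≤p) ⟩
    3 ℕ.* p ℕ.+ p               ≡⟨ ℕ.+-comm (3 ℕ.* p) p ⟩
    4 ℕ.* p                     ∎
    where
    regroup : ∀ q p → q ℕ.+ (2 ℕ.* q ℕ.+ p) ≡ 3 ℕ.* q ℕ.+ p
    regroup = solve-∀

-- The cost of the repaired solution against the linear program.

module SolutionCost {F : OrderedField} (H : Height F) {n : ℕ} (M : Matroid n) (B : ℕ) .{{_ : NonZero B}}
  (a : Fin n → OrderedField.Carrier F) (a-nonNeg : ∀ e → OrderedField._≤_ F (OrderedField.0# F) (a e)) where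
  open FieldProperties F
  open MatroidProperties M
  open ProgramValues H M
  open ListSums F
  open Slots H M B
  open Sampling H M B
  open SumOver F {n}
  open Repair H M B a a-nonNeg
  open Problem F using (sumOver; BasePolytope)

  listCost : Subset n → List Slot → Carrier
  listCost P []               = 0#
  listCost P ((row , S) ∷ ss) = costAt row P (setOf S) + listCost (setOf S) ss

  listCost≤tailCost : ∀ P ss → listCost P ss ≤ sumOver a (headSet ss ─ P) + tailCost a ss
  listCost≤tailCost P []               = 0≤+ (sumOver-nonNeg (∅ ─ P) a-nonNeg) ≤-refl
  listCost≤tailCost P ((row , S) ∷ ss) = ≤-trans (+-monoʳ-≤ (costAt row P (setOf S)) (listCost≤tailCost (setOf S) ss))
    (≤-reflexive (solve 4 (λ c p q t → c :+ p :+ (q :+ t) := p :+ (c :+ q :+ t)) refl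
      (sumOver (cAt row) (setOf S)) (sumOver a (setOf S ─ P)) (sumOver a (headSet ss ─ setOf S)) (tailCost a ss)))

  listCost≤slotsCost : ∀ ss → listCost ∅ ss ≤ slotsCost a ss
  listCost≤slotsCost ss = ≤-trans (listCost≤tailCost ∅ ss)
    (+-monoˡ-≤ (tailCost a ss) (sumOver-mono {S = headSet ss ─ ∅} a-nonNeg (p─q⊆p (headSet ss) ∅)))

  slotsCost-empty : ∀ rows → slotsCost a (emptySlots rows) ≤ 0#
  slotsCost-empty rows = ≤-trans (+-mono-≤ (head rows) (tail rows)) (≤-reflexive (+-identityˡ 0#))
    where
    head : ∀ rows → sumOver a (headSet (emptySlots rows)) ≤ 0#
    head []         = ≤-reflexive (sumOver-∅ a)
    head (row ∷ rs) = ≤-reflexive (sumOver-∅ a)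
    tail : ∀ rows → tailCost a (emptySlots rows) ≤ 0#
    tail []         = ≤-refl
    tail (row ∷ rs) = ≤-trans (+-mono-≤ (+-mono-≤ (≤-reflexive (sumOver-∅ (cAt row)))
        (≤-trans (sumOver-mono {S = headSet (emptySlots rs) ─ ∅} a-nonNeg (p─q⊆p (headSet (emptySlots rs)) ∅)) (head rs))) (tail rs))
      (≤-reflexive (trans (+-identityʳ _) (+-identityʳ 0#)))

  deficit-≤ : ∀ S → deficit S ≤ fromℕ (rk full)
  deficit-≤ S = x≤y+z⇒x-z≤y (x≤x+y (fromℕ-nonNeg (rk (setOf S))))

  totalDeficit-empty : ∀ rows → sumSlots (λ _ → deficit) (emptySlots rows) ≤ fromℕ (length rows ℕ.* rk full)
  totalDeficit-empty []         = ≤-refl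
  totalDeficit-empty (row ∷ rs) = ≤-trans (+-mono-≤ (deficit-≤ []) (totalDeficit-empty rs)) (≤-reflexive (sym (fromℕ-+ (rk full) _)))

  repaired : List Slot → List Slot
  repaired = List.map λ s → proj₁ s , repair priced s

  -- The sets `P` and `P′` are those of the preceding time step before and after its repair.
  -- Enlarging the preceding set only removes acquisitions, so the repairs of different time steps
  -- are paid for independently.
  listCost-repaired : ∀ {σ P P′} ss → All (λ row → GoodRow row × BasePolytope M (zAt row) × budget priced row ≤ σ) (rowsOf ss) → P ⊆ P′ →
    listCost P′ (repaired ss) ≤ listCost P ss + σ * sumSlots (λ _ → deficit) ss
  listCost-repaired {σ} []               []                   P⊆P′ = ≤-reflexive (sym (x+y*0≡x 0# σ))
  listCost-repaired {σ} {P} {P′} ((row , S) ∷ ss) ((g , b , V≤σ) ∷ gs) P⊆P′ = begin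
      costAt row P′ S′ + listCost S′ (repaired ss)
        ≤⟨ +-mono-≤ (≤-trans shrink (repair-cost g b P S)) (listCost-repaired ss gs (augmentAll-⊇ row (budget priced row) S priced)) ⟩
      (costAt row P (setOf S) + budget priced row * deficit S) + (listCost (setOf S) ss + σ * sumSlots (λ _ → deficit) ss)
        ≤⟨ +-monoˡ-≤ _ (+-monoʳ-≤ _ (*-monoʳ-≤ (deficit-nonNeg S) V≤σ)) ⟩
      (costAt row P (setOf S) + σ * deficit S) + (listCost (setOf S) ss + σ * sumSlots (λ _ → deficit) ss)
        ≡⟨ solve 5 (λ c s d l t → c :+ s :* d :+ (l :+ s :* t) := c :+ l :+ s :* (d :+ t)) refl
             (costAt row P (setOf S)) σ (deficit S) (listCost (setOf S) ss) (sumSlots (λ _ → deficit) ss) ⟩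
      (costAt row P (setOf S) + listCost (setOf S) ss) + σ * sumSlots (λ _ → deficit) ((row , S) ∷ ss) ∎
    where
    open ≤-Reasoning
    S′ = setOf (repair priced (row , S))
    shrink : costAt row P′ S′ ≤ costAt row P S′
    shrink = +-monoʳ-≤ (sumOver (cAt row) S′) (sumOver-mono {S = S′ ─ P′} a-nonNeg (─-mono {p = S′} {S′} {P′} {P} (λ p _ → p) P⊆P′))

  lpTerm : Row → Fin n → Carrier
  lpTerm row e = a e * yAt row e + cAt row e * zAt row e

  share≡ : ∀ rows e → share a rows e ≡ sumL (λ row → lpTerm row e) rows
  share≡ []         e = trans (+-identityʳ _) (zeroʳ (a e))
  share≡ (row ∷ rs) e = trans
    (solve 4 (λ p q r s → p :+ (q :+ r :+ s) := p :+ q :+ (r :+ s)) refl (a e * yAt row e) (cAt row e * zAt row e) (a e * yHead rs e) (tailShare a e rs))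
    (cong (lpTerm row e +_) (share≡ rs e))

  lpTerm-nonNeg : ∀ {row} → GoodRow row → ∀ e → 0# ≤ lpTerm row e
  lpTerm-nonNeg g e = 0≤+ (*-nonNeg (a-nonNeg e) (y-nonNeg g e)) (*-nonNeg (c-nonNeg g e) (z-nonNeg g e))

  -- Telescopes z_t ≤ z_{t-1} + y_t; x stands for the value of z before the first row.
  weight≤share : ∀ {rows} e {x} → GoodRows rows → 0# ≤ x → zHead rows e ≤ x + yHead rows e →
    All (λ row → zAt row e * weightOf row e ≤ a e * x + share a rows e) rows
  weight≤share e [] 0≤x z≤ = []
  weight≤share {row ∷ rs} e {x} (step g z≤′ gs) 0≤x z≤ =
      head ∷ All.map (λ p → ≤-trans p later) (weight≤share e gs (z-nonNeg g e) (z≤′ e))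
    where
    open ≤-Reasoning
    A = a e
    zc = cAt row e * zAt row e
    rest = sumL (λ row → lpTerm row e) rs
    0≤rest : 0# ≤ rest
    0≤rest = sumL-nonNeg (all-good gs) (λ g → lpTerm-nonNeg g e)
    carried : A * zAt row e ≤ A * x + A * yAt row e
    carried = ≤-trans (*-monoˡ-≤ (a-nonNeg e) z≤) (≤-reflexive (distribˡ A x _))
    head : zAt row e * weightOf row e ≤ A * x + share a (row ∷ rs) e
    head = begin
      zAt row e * (A + cAt row e)                ≡⟨ solve 3 (λ z a c → z :* (a :+ c) := a :* z :+ c :* z) refl (zAt row e) A (cAt row e) ⟩
      A * zAt row e + zc                         ≤⟨ +-monoˡ-≤ zc carried ⟩
      (A * x + A * yAt row e) + zc               ≡⟨ +-assoc _ _ _ ⟩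
      A * x + lpTerm row e                       ≤⟨ +-monoʳ-≤ (A * x) (x≤x+y 0≤rest) ⟩
      A * x + (lpTerm row e + rest)              ≡⟨ cong (A * x +_) (sym (share≡ (row ∷ rs) e)) ⟩
      A * x + share a (row ∷ rs) e               ∎
    later : A * zAt row e + share a rs e ≤ A * x + share a (row ∷ rs) e
    later = begin
      A * zAt row e + share a rs e               ≤⟨ +-mono-≤ (≤-trans carried (x≤x+y (*-nonNeg (c-nonNeg g e) (z-nonNeg g e)))) (≤-reflexive (share≡ rs e)) ⟩
      ((A * x + A * yAt row e) + zc) + rest      ≡⟨ solve 4 (λ p q r s → p :+ q :+ r :+ s := p :+ (q :+ r :+ s)) refl (A * x) (A * yAt row e) zc rest ⟩
      A * x + (lpTerm row e + rest)              ≡⟨ cong (A * x +_) (sym (share≡ (row ∷ rs) e)) ⟩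
      A * x + share a (row ∷ rs) e               ∎

  budget≤share : ∀ {rows} → GoodRows rows → (∀ e → zHead rows e ≤ yHead rows e) →
    All (λ row → budget priced row ≤ sum (share a rows)) rows
  budget≤share {rows} g z≤y = All.tabulate λ {row} row∈ → ≤-trans (≤-reflexive (budget-sum row)) (sum-mono λ e →
    ≤-trans (All.lookup (weight≤share e {0#} g ≤-refl (≤-trans (z≤y e) (≤-reflexive (sym (+-identityˡ _))))) row∈)
      (≤-reflexive (trans (cong (_+ share a rows e) (zeroʳ (a e))) (+-identityˡ _))))

  share-sum : ∀ rows → sumL (share a rows ∘ proj₁) priced ≡ sum (share a rows)
  share-sum rows = sumL-tabulate (share a rows ∘ proj₁) (λ e → e , a e)

-- Infinite costs and the size of the input.

module ExtendedProperties (F : OrderedField) where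
  open FieldProperties F
  open Extended F
  open Problem F using (sumOver; sumOver⁺)

  finitePart : Carrier⁺ → Carrier
  finitePart ⊤⁺    = 0#
  finitePart [ x ] = x

  []-injective : ∀ {x y : Carrier} → _≡_ {A = Carrier⁺} [ x ] [ y ] → x ≡ y
  []-injective refl = refl

  sum⁺-[] : ∀ {m} {f : Fin m → Carrier⁺} {g : Fin m → Carrier} → (∀ i → f i ≡ [ g i ]) → sum⁺ f ≡ [ sum g ]
  sum⁺-[] {zero}  p = refl
  sum⁺-[] {suc m} p = cong₂ _+⁺_ (p zero) (sum⁺-[] (p ∘ suc))

  +⁺-finite : ∀ x y {w} → x +⁺ y ≡ [ w ] → (∃[ u ] x ≡ [ u ]) × (∃[ v ] y ≡ [ v ])
  +⁺-finite [ x ] [ y ] _ = (x , refl) , (y , refl)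

  sum⁺-finite : ∀ {m} (f : Fin m → Carrier⁺) {w} → sum⁺ f ≡ [ w ] → ∀ i → ∃[ x ] f i ≡ [ x ]
  sum⁺-finite {suc m} f eq zero    = proj₁ (+⁺-finite (f zero) (sum⁺ (f ∘ suc)) eq)
  sum⁺-finite {suc m} f eq (suc i) = sum⁺-finite (f ∘ suc) (proj₂ (proj₂ (+⁺-finite (f zero) (sum⁺ (f ∘ suc)) eq))) i

  ·⁺-finite : ∀ z c {x} → z ·⁺ c ≡ [ x ] → z ·⁺ c ≡ [ z * finitePart c ] × (c ≡ ⊤⁺ → z ≡ 0#)
  ·⁺-finite z [ c ] _ = refl , λ ()
  ·⁺-finite z ⊤⁺ eq with z ≟ 0#
  ... | yes z≡0 = cong [_] (sym (zeroʳ z)) , λ _ → z≡0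
  ·⁺-finite z ⊤⁺ () | no _

  sumOver⁺-[] : ∀ {m} (c : Fin m → Carrier⁺) S → (∀ {e} → e ∈ S → c e ≢ ⊤⁺) → sumOver⁺ c S ≡ [ sumOver (finitePart ∘ c) S ]
  sumOver⁺-[] c S fin = sum⁺-[] λ e → lemma e (Vec.lookup S e) (Vec.lookup⇒[]= e S) refl
    where
    lemma : ∀ e b → (Vec.lookup S e ≡ true → e ∈ S) → Vec.lookup S e ≡ b → (if b then c e else [ 0# ]) ≡ [ (if b then finitePart (c e) else 0#) ]
    lemma e false _ _ = refl
    lemma e true  p q with c e | fin (p q)
    ... | [ _ ] | _ = refl
    ... | ⊤⁺    | f = contradiction refl f

module SizeBounds {F : OrderedField} (H : Height F) {n : ℕ} (M : Matroid n) where
  open Semantics H M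

  length≤size : ∀ τ xs → length xs ℕ.≤ size (list τ) xs
  length≤size τ []       = z≤n
  length≤size τ (x ∷ xs) = s≤s (ℕ.m≤n⇒m≤o+n (size τ x) (length≤size τ xs))

  ∈⇒size≤ : ∀ τ {x xs} → x ∈ₗ xs → size τ x ℕ.≤ size (list τ) xs
  ∈⇒size≤ τ (here refl) = ℕ.m≤n⇒m≤1+n (ℕ.m≤m+n _ _)
  ∈⇒size≤ τ {xs = y ∷ ys} (there x∈) = ℕ.m≤n⇒m≤1+n (ℕ.m≤n⇒m≤o+n (size τ y) (∈⇒size≤ τ x∈))

-- The rows of an encoded feasible solution.

module Encoding {F : OrderedField} (H : Height F) {n T : ℕ} (I : Problem.Instance F n T)
                (y z : Fin T → Fin n → OrderedField.Carrier F) where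
  open FieldProperties F
  open Extended F
  open ExtendedProperties F
  open Height H
  open Problem F
  open Instance I
  open Semantics H matroid
  open ProgramValues H matroid
  open SizeBounds H matroid
  open Rounding H I y z

  entryAt : Fin T → Fin n → Entry
  entryAt t e = e , encode⁺ (c t e) , y t e , z t e

  rowAt : Fin T → Row
  rowAt t = List.tabulate (entryAt t)

  rows : List Row
  rows = List.tabulate rowAt

  find-tabulate : ∀ {m} (h : Fin m → Entry) e v → proj₁ v ≡ e → (∀ j → proj₁ (h j) ≡ e → h j ≡ v) → ∀ j → h j ≡ v → find e (List.tabulate h) ≡ v
  find-tabulate {suc m} h e v v≡ unique j eq with proj₁ (h zero) Fin.≟ e
  ... | yes p = unique zero p
  find-tabulate {suc m} h e v v≡ unique zero    eq | no p = contradiction (trans (cong proj₁ eq) v≡) p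
  find-tabulate {suc m} h e v v≡ unique (suc j) eq | no p = find-tabulate (h ∘ suc) e v v≡ (unique ∘ suc) j eq

  find-entry : ∀ t e → find e (rowAt t) ≡ entryAt t e
  find-entry t e = find-tabulate (entryAt t) e (entryAt t e) refl (λ j → cong (entryAt t)) e refl

  zAt≡ : ∀ t e → zAt (rowAt t) e ≡ z t e
  zAt≡ t e = cong (proj₂ ∘ proj₂ ∘ proj₂) (find-entry t e)

  cAt≡ : ∀ t e → cAt (rowAt t) e ≡ finitePart (c t e)
  cAt≡ t e = trans (cong (λ v → [ (λ _ → 0#) , (λ x → x) ]′ (proj₁ (proj₂ v))) (find-entry t e)) (lemma (c t e))
    where
    lemma : ∀ x → [ (λ _ → 0#) , (λ x → x) ]′ (encode⁺ x) ≡ finitePart x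
    lemma ⊤⁺    = refl
    lemma [ _ ] = refl

  rows-size : size (list RowTy) rows ℕ.≤ inputSize
  rows-size = ℕ.m≤n⇒m≤1+n (ℕ.m≤n+m _ _)

  n+T≤inputSize : n ℕ.+ T ℕ.≤ inputSize
  n+T≤inputSize = ℕ.m≤n⇒m≤1+n (ℕ.+-mono-≤
    (subst (ℕ._≤ size (list (elt ⊗ num)) (proj₁ input)) (List.length-tabulate (λ e → e , a e)) (length≤size (elt ⊗ num) (proj₁ input)))
    (subst (ℕ._≤ size (list RowTy) rows) (List.length-tabulate rowAt) (length≤size RowTy rows)))

  a-height : ∀ e → height (a e) ℕ.≤ inputSize
  a-height e = ℕ.m≤n⇒m≤1+n (ℕ.≤-trans
    (ℕ.≤-trans (ℕ.m≤n⇒m≤1+n (ℕ.m≤n⇒m≤1+n (ℕ.n≤1+n _))) (∈⇒size≤ (elt ⊗ num) {xs = proj₁ input} (List.∈-tabulate⁺ e)))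
    (ℕ.m≤m+n _ _))

  entry-size : ∀ t e → size EntryTy (entryAt t e) ℕ.≤ inputSize
  entry-size t e = ℕ.≤-trans (∈⇒size≤ EntryTy {xs = rowAt t} (List.∈-tabulate⁺ e))
    (ℕ.≤-trans (∈⇒size≤ RowTy {xs = rows} (List.∈-tabulate⁺ t)) rows-size)

  z-height≤ : ∀ t e → height (zAt (rowAt t) e) ℕ.≤ inputSize
  z-height≤ t e = subst (λ x → height x ℕ.≤ inputSize) (sym (zAt≡ t e)) (ℕ.≤-trans
    (ℕ.m≤n⇒m≤1+n (ℕ.m≤n⇒m≤1+n (ℕ.m≤n⇒m≤1+n (ℕ.m≤n⇒m≤o+n (size cost∞ (encode⁺ (c t e)))
      (ℕ.m≤n⇒m≤1+n (ℕ.m≤n⇒m≤o+n (suc (height (y t e))) (ℕ.n≤1+n _)))))))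
    (entry-size t e))

  c-height≤ : ∀ t e → height (cAt (rowAt t) e) ℕ.≤ inputSize
  c-height≤ t e = subst (λ x → height x ℕ.≤ inputSize) (sym (cAt≡ t e)) (ℕ.≤-trans
    (ℕ.m≤n⇒m≤1+n (ℕ.m≤n⇒m≤1+n (ℕ.m≤n⇒m≤1+n (ℕ.≤-trans (lemma (c t e)) (ℕ.m≤m+n _ _)))))
    (entry-size t e))
    where
    lemma : ∀ x → height (finitePart x) ℕ.≤ size cost∞ (encode⁺ x)
    lemma ⊤⁺    = ℕ.≤-trans (ℕ.≤-reflexive height-0) z≤n
    lemma [ x ] = ℕ.m≤n⇒m≤1+n (ℕ.n≤1+n _)

  module _ (B : ℕ) .{{_ : NonZero B}} (N≤B : inputSize ℕ.≤ B) (feasible : LPFeasible I y z) where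
    open LPFeasible feasible using (z-base; y-change)
    open TimeBounds H matroid B
    open Slots H matroid B
    open Repair H matroid B a a-nonNeg using (priced)
    open MatroidProperties matroid

    yAt≡ : ∀ t e → yAt (rowAt t) e ≡ y t e
    yAt≡ t e = cong (proj₁ ∘ proj₂ ∘ proj₂) (find-entry t e)

    polytopeAt : ∀ t → BasePolytope matroid (zAt (rowAt t))
    polytopeAt t = record
      { nonNeg = λ e → subst (0# ≤_) (sym (zAt≡ t e)) (LPFeasible.z-nonNeg feasible t e)
      ; rank-≤ = λ S → subst (_≤ fromℕ (rank matroid S)) (sym (over S)) (BasePolytope.rank-≤ (z-base t) S)
      ; rank-≡ = trans (over full) (BasePolytope.rank-≡ (z-base t))
      }
      where
      over : ∀ S → sumOver (zAt (rowAt t)) S ≡ sumOver (z t) S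
      over S = sum-cong λ e → cong (λ x → if Vec.lookup S e then x else 0#) (zAt≡ t e)

    goodRowAt : ∀ t → GoodRow (rowAt t)
    goodRowAt t = record
      { small = record
          { row-length = ℕ.≤-trans (ℕ.≤-reflexive (List.length-tabulate (entryAt t))) (ℕ.≤-trans (ℕ.m≤m+n n T) (ℕ.≤-trans n+T≤inputSize N≤B))
          ; z-height   = λ e → ℕ.≤-trans (z-height≤ t e) N≤B
          ; c-height   = λ e → ℕ.≤-trans (c-height≤ t e) N≤B
          }
      ; z-nonNeg = nonNeg
      ; z-≤1     = λ e → begin
          zAt (rowAt t) e                         ≡⟨ sym (sumOver-⁅⁆ F (zAt (rowAt t)) e) ⟩
          sumOver (zAt (rowAt t)) ⁅ e ⁆           ≤⟨ rank-≤ ⁅ e ⁆ ⟩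
          fromℕ (rk ⁅ e ⁆)                        ≤⟨ fromℕ-mono (rank≤∣∣ ⁅ e ⁆) ⟩
          fromℕ ∣ ⁅ e ⁆ ∣                         ≡⟨ trans (cong fromℕ (∣⁅x⁆∣≡1 e)) (+-identityʳ 1#) ⟩
          1#                                      ∎
      ; y-nonNeg = λ e → subst (0# ≤_) (sym (yAt≡ t e)) (LPFeasible.y-nonNeg feasible t e)
      ; c-nonNeg = λ e → subst (0# ≤_) (sym (cAt≡ t e)) (fin-nonNeg (Instance.c-nonNeg I t e))
      }
      where
      open BasePolytope (polytopeAt t)
      open ≤-Reasoning
      fin-nonNeg : ∀ {x} → [ 0# ] ≤⁺ x → 0# ≤ finitePart x
      fin-nonNeg Supremum.[ p ] = p
      fin-nonNeg (_ Supremum.≤⊤⁺) = ≤-refl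

    -- Stated for any `x₀` before the first row, since dropping the first row makes its masses the
    -- preceding ones.
    goodRows-tabulate : ∀ {T} (R : Fin T → Row) (x₀ : Fin n → Carrier) → (∀ t → GoodRow (R t)) →
      (∀ t e → zAt (R t) e ≤ previous x₀ (zAt ∘ R) t e + yAt (R t) e) → GoodRows (List.tabulate R)
    goodRows-tabulate {zero}  R x₀ g h = []
    goodRows-tabulate {suc T} R x₀ g h = step (g zero) (next R g h) (goodRows-tabulate (R ∘ suc) (zAt (R zero)) (g ∘ suc)
        λ t e → subst (λ x → zAt (R (suc t)) e ≤ x e + yAt (R (suc t)) e) (previous-suc x₀ (zAt ∘ R) t) (h (suc t) e))
      where
      next : ∀ {T} (R : Fin (suc T) → Row) → (∀ t → GoodRow (R t)) →
        (∀ t e → zAt (R t) e ≤ previous x₀ (zAt ∘ R) t e + yAt (R t) e) →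
        ∀ e → zHead (List.tabulate (R ∘ suc)) e ≤ zAt (R zero) e + yHead (List.tabulate (R ∘ suc)) e
      next {zero}  R g h e = 0≤+ (GoodRow.z-nonNeg (g zero) e) ≤-refl
      next {suc T} R g h e = h (suc zero) e

    change : ∀ t e → zAt (rowAt t) e ≤ previous (λ _ → 0#) (zAt ∘ rowAt) t e + yAt (rowAt t) e
    change t e = begin
      zAt (rowAt t) e                                         ≡⟨ zAt≡ t e ⟩
      z t e                                                   ≤⟨ x-z≤y⇒x≤y+z (y-change t e) ⟩
      y t e + previous (λ _ → 0#) z t e                       ≡⟨ +-comm _ _ ⟩
      previous (λ _ → 0#) z t e + y t e                       ≡⟨ cong₂ _+_ (sym (previous≡ t)) (sym (yAt≡ t e)) ⟩
      previous (λ _ → 0#) (zAt ∘ rowAt) t e + yAt (rowAt t) e ∎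
      where
      open ≤-Reasoning
      previous≡ : ∀ t → previous (λ _ → 0#) (zAt ∘ rowAt) t e ≡ previous (λ _ → 0#) z t e
      previous≡ zero    = refl
      previous≡ (suc t) = zAt≡ (inject₁ t) e

    goodRows : GoodRows rows
    goodRows = goodRows-tabulate rowAt (λ _ → 0#) goodRowAt change

    zHead≤yHead : ∀ e → zHead rows e ≤ yHead rows e
    zHead≤yHead e = first rowAt change
      where
      first : ∀ {T} (R : Fin T → Row) → (∀ t e → zAt (R t) e ≤ previous (λ _ → 0#) (zAt ∘ R) t e + yAt (R t) e) →
        zHead (List.tabulate R) e ≤ yHead (List.tabulate R) e
      first {zero}  R h = ≤-refl
      first {suc T} R h = ≤-trans (h zero e) (≤-reflexive (+-identityˡ _))

    smallCosts : SmallCosts priced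
    smallCosts = All.tabulate⁺ λ e → ℕ.≤-trans (a-height e) N≤B

-- Feasibility, running time and expected cost of the program.

module Correctness {F : OrderedField} (H : Height F) {n T : ℕ} (I : Problem.Instance F n T)
    (y z : Fin T → Fin n → OrderedField.Carrier F) (feasible : Problem.LPFeasible F I y z)
    (2≤rT : 2 ℕ.≤ rank (Problem.Instance.matroid I) full ℕ.* T)
    (B : ℕ) .{{_ : NonZero B}} (N²+N≤B : Rounding.inputSize H I y z ℕ.* Rounding.inputSize H I y z ℕ.+ Rounding.inputSize H I y z ℕ.≤ B) where
  open FieldProperties F
  open Extended F
  open ExtendedProperties F
  open Problem F
  open Instance I
  open Semantics H matroid
  open RunProperties H matroid
  open FlipLet H matroid
  open ProgramValues H matroid
  open MatroidProperties matroid
  open ListSums F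
  open PowerBounds B
  open TimeBounds H matroid B
  open Slots H matroid B
  open Sampling H matroid B
  open Repair H matroid B a a-nonNeg
  open SolutionCost H matroid B a a-nonNeg
  open Rounding H I y z
  open Encoding H I y z

  r : ℕ
  r = rk full

  N≤B : inputSize ℕ.≤ B
  N≤B = ℕ.≤-trans (ℕ.m≤n+m inputSize (inputSize ℕ.* inputSize)) N²+N≤B

  good : GoodRows rows
  good = goodRows B N≤B feasible

  n≤N : n ℕ.≤ inputSize
  n≤N = ℕ.≤-trans (ℕ.m≤m+n n T) n+T≤inputSize

  T≤N : T ℕ.≤ inputSize
  T≤N = ℕ.≤-trans (ℕ.m≤n+m T n) n+T≤inputSize

  length-rows : length rows ≡ T
  length-rows = List.length-tabulate rowAt

  length-priced : length priced ≡ n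
  length-priced = List.length-tabulate (λ e → e , a e)

  rows≤B : length rows ℕ.≤ B
  rows≤B = ℕ.≤-trans (ℕ.≤-reflexive length-rows) (ℕ.≤-trans T≤N N≤B)

  priced≤B : length priced ℕ.≤ B
  priced≤B = ℕ.≤-trans (ℕ.≤-reflexive length-priced) (ℕ.≤-trans n≤N N≤B)

  u : List ⊤
  u = det roundsT (input ∷ [])

  open Rounds H matroid B rows good rows≤B input priced≤B u

  1≤r : 1 ℕ.≤ r
  1≤r = ℕ.n≢0⇒n>0 λ r≡0 → contradiction (subst (λ k → 2 ℕ.≤ k ℕ.* T) r≡0 2≤rT) λ ()

  1≤T : 1 ℕ.≤ T
  1≤T = ℕ.n≢0⇒n>0 λ T≡0 → contradiction (subst (2 ℕ.≤_) (trans (cong (r ℕ.*_) T≡0) (ℕ.*-zeroʳ r)) 2≤rT) λ ()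

  length-base : length (greedy (elements input)) ≡ r
  length-base = begin
    length (greedy (elements input))     ≡⟨ cong (length ∘ greedy) (List.map-tabulate (λ e → e , a e) proj₁) ⟩
    length (greedy (List.allFin n))      ≡⟨ length-greedy (Unique.allFin⁺ n) ⟩
    rk (setOf (List.allFin n))           ≡⟨ cong rk (⊆-antisym (⊆-max _) (λ {x} _ → ∈-setOf⁺ (List.∈-allFin x))) ⟩
    rk full                              ∎
    where open ≡-Reasoning

  L₁ L₂ : ℕ
  L₁ = length (bits (greedy (elements input)))
  L₂ = length (bits rows)

  length-u : length u ≡ L₁ ℕ.+ L₂
  length-u = trans (cong length (det-rounds input)) (List.length-++ (bits (greedy (elements input))))

  L₁-upper : r ℕ.≤ 2 ℕ.^ L₁
  L₁-upper = subst (ℕ._≤ 2 ℕ.^ L₁) length-base (ℕ.<⇒≤ (bits-upper (greedy (elements input)) (subst (1 ℕ.≤_) (sym length-base) 1≤r)))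

  L₂-upper : T ℕ.≤ 2 ℕ.^ L₂
  L₂-upper = subst (ℕ._≤ 2 ℕ.^ L₂) length-rows (ℕ.<⇒≤ (bits-upper rows (subst (1 ℕ.≤_) (sym length-rows) 1≤T)))

  L₁-lower : 2 ℕ.^ L₁ ℕ.≤ 2 ℕ.* r
  L₁-lower = subst (λ k → 2 ℕ.^ L₁ ℕ.≤ 2 ℕ.* k) length-base (bits-lower (greedy (elements input)) (subst (1 ℕ.≤_) (sym length-base) 1≤r))

  L₂-lower : 2 ℕ.^ L₂ ℕ.≤ 2 ℕ.* T
  L₂-lower = subst (λ k → 2 ℕ.^ L₂ ℕ.≤ 2 ℕ.* k) length-rows (bits-lower rows (subst (1 ℕ.≤_) (sym length-rows) 1≤T))

  rT≤2^u : r ℕ.* T ℕ.≤ 2 ℕ.^ length u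
  rT≤2^u = ℕ.≤-trans (ℕ.*-mono-≤ L₁-upper L₂-upper)
    (ℕ.≤-reflexive (trans (sym (ℕ.^-distribˡ-+-* 2 L₁ L₂)) (cong (2 ℕ.^_) (sym length-u))))

  u≤N : length u ℕ.≤ inputSize
  u≤N = ℕ.≤-trans (ℕ.≤-reflexive length-u) (ℕ.≤-trans (ℕ.+-mono-≤ L₁≤n L₂≤T) n+T≤inputSize)
    where
    L₁≤n : L₁ ℕ.≤ n
    L₁≤n = ℕ.≤-trans (length-bits≤ (greedy (elements input))) (ℕ.≤-trans (length-greedy≤ (elements input))
      (ℕ.≤-reflexive (trans (List.length-map proj₁ priced) length-priced)))
    L₂≤T : L₂ ℕ.≤ T
    L₂≤T = ℕ.≤-trans (length-bits≤ rows) (ℕ.≤-reflexive length-rows)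

  -- Repetitions are kept, so a slot may receive one entry per round and element, and the repair
  -- adds up to one more per element. Rounds and elements both number at most the input size N,
  -- whence the requirement N² + N ≤ `B`.
  room : length priced ℕ.+ (length u ℕ.* length priced ℕ.+ 0) ℕ.≤ B
  room = begin
    length priced ℕ.+ (length u ℕ.* length priced ℕ.+ 0)  ≡⟨ cong (length priced ℕ.+_) (ℕ.+-identityʳ _) ⟩
    length priced ℕ.+ length u ℕ.* length priced          ≤⟨ ℕ.+-mono-≤ p≤N (ℕ.*-mono-≤ u≤N p≤N) ⟩
    inputSize ℕ.+ inputSize ℕ.* inputSize                 ≡⟨ ℕ.+-comm inputSize _ ⟩
    inputSize ℕ.* inputSize ℕ.+ inputSize                 ≤⟨ N²+N≤B ⟩
    B                                                     ∎
    where
    open ℕ.≤-Reasoning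
    p≤N = ℕ.≤-trans (ℕ.≤-reflexive length-priced) n≤N

  initialSlots : List Slot
  initialSlots = emptySlots rows

  K : ℕ
  K = length u ℕ.* length priced ℕ.+ 0

  start-inv : Inv rows 0 initialSlots
  start-inv = inv (trans (sym (List.map-∘ rows)) (List.map-id rows)) (All.map⁺ (All.universal (λ _ → record { short = z≤n ; supported = [] }) rows))

  sampleEnv : Env (list 𝟙 ∷ InputTy ∷ [])
  sampleEnv = u ∷ input ∷ []

  det-start : det slotsT sampleEnv ≡ initialSlots
  det-start = det-slots u input []

  spec-sample : Spec (eval sampleT sampleEnv) (270 ℕ.* B ℕ.^ 4) (Inv rows K)
  spec-sample = spec-weaken
    (unbound (enlarge 270 4 (constant 1 ⊞ enlarge 20 4 (time-slots u input [] rows≤B) ⊞ constant 1 ⊞ (base (ℕ.≤-trans u≤N N≤B) ⊠ (constant 1 ⊞ self)))))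
    id
    (spec-fold v0 slotsT roundT _ _ sampleEnv
      (subst (λ ss → Spec (sampling u ss) (length u ℕ.* suc (240 ℕ.* B ℕ.^ 3)) (Inv rows K)) (sym det-start) (spec-sampling u start-inv)))
    where
    self : 240 ℕ.* B ℕ.^ 3 ≼ 240 ·B^ 3
    self = bound ℕ.≤-refl

  Ex-sample : ∀ (f : List Slot → Carrier) → Ex f (eval sampleT sampleEnv) ≡ Ex f (sampling u initialSlots)
  Ex-sample f = trans (Ex-fold v0 slotsT roundT _ _ sampleEnv f) (cong (λ ss → Ex f (sampling u ss)) det-start)

  output : List Slot → List (List (Fin n))
  output = List.map (repair priced)

  Output : List (List (Fin n)) → Set
  Output out = Σ[ ss ∈ List Slot ] Inv rows K ss × out ≡ output ss

  spec-rounding : Spec (run rounding) (700 ℕ.* B ℕ.^ 4) Output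
  spec-rounding = spec-weaken
    (unbound (enlarge 700 4 (enlarge 150 4 (time-rounds input priced≤B rows≤B) ⊞ constant 1 ⊞ self 270 ⊞ constant 1 ⊞ self 260)))
    id
    (spec-let roundsT (let′ sampleT repairAllT) (input ∷ []) (spec-det roundsT _ (input ∷ [])) λ where
      refl → spec-let sampleT repairAllT sampleEnv spec-sample λ {ss} J →
        spec-weaken (unbound (time-repairAll ss u input (ℕ.≤-trans (ℕ.≤-reflexive (length-rowsOf J)) rows≤B) (smallCosts B N≤B feasible) (ready ss J)))
          (λ eq → ss , J , trans eq (det-repairAll ss u input))
          (spec-det repairAllT _ (ss ∷ sampleEnv)))
    where
    self : ∀ k → k ℕ.* B ℕ.^ 4 ≼ k ·B^ 4
    self k = bound ℕ.≤-refl
    ready : ∀ ss → Inv rows K ss → All (λ s → SmallRow (proj₁ s) × length priced ℕ.+ length (proj₂ s) ℕ.≤ B) ss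
    ready ss J = All.zipWith (λ (g , s) → GoodRow.small g , ℕ.≤-trans (ℕ.+-monoʳ-≤ (length priced) (GoodSlot.short s)) room)
      (All.map⁻ (all-good (good-rows good J)) , good-slots J)

  Ex-rounding : ∀ (f : List (List (Fin n)) → Carrier) → Ex f (run rounding) ≡ Ex (f ∘ output) (sampling u initialSlots)
  Ex-rounding f = begin
    Ex f (run rounding)                                                    ≡⟨ Ex-let roundsT (let′ sampleT repairAllT) (input ∷ []) f ⟩
    Ex (λ u → Ex f (eval (let′ sampleT repairAllT) (u ∷ input ∷ []))) (eval roundsT (input ∷ []))
      ≡⟨ Ex-single (λ u → Ex f (eval (let′ sampleT repairAllT) (u ∷ input ∷ []))) (eval-det roundsT _ (input ∷ [])) ⟩
    Ex f (eval (let′ sampleT repairAllT) sampleEnv)                        ≡⟨ Ex-let sampleT repairAllT sampleEnv f ⟩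
    Ex (λ ss → Ex f (eval repairAllT (ss ∷ sampleEnv))) (eval sampleT sampleEnv)
      ≡⟨ Ex-ext (λ ss → trans (Ex-single f (eval-det repairAllT _ (ss ∷ sampleEnv))) (cong f (det-repairAll ss u input))) (eval sampleT sampleEnv) ⟩
    Ex (f ∘ output) (eval sampleT sampleEnv)                               ≡⟨ Ex-sample (f ∘ output) ⟩
    Ex (f ∘ output) (sampling u initialSlots)                                     ∎
    where open ≡-Reasoning

  GoodPolytope : Row → Set
  GoodPolytope row = GoodRow row × BasePolytope matroid (zAt row)

  good-polytopes : All GoodPolytope rows
  good-polytopes = All.tabulate⁺ λ t → goodRowAt B N≤B feasible t , polytopeAt B N≤B feasible t

  slot-polytopes : ∀ {ss} → Inv rows K ss → All (GoodPolytope ∘ proj₁) ss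
  slot-polytopes (inv eq _) = All.map⁻ (subst (All GoodPolytope) (sym eq) good-polytopes)

  nth-All : ∀ {P : Subset n → Set} out → All (P ∘ setOf) out → ∀ {T} → length out ≡ T → ∀ t → P (nth out {T} t)
  nth-All         (S ∷ out) (p ∷ ps) refl zero    = p
  nth-All {P = P} (S ∷ out) (p ∷ ps) refl (suc t) = nth-All {P = P} out ps refl t

  length-output : ∀ {ss} → Inv rows K ss → length (output ss) ≡ T
  length-output {ss} J = trans (List.length-map (repair priced) ss) (trans (length-rowsOf J) length-rows)

  output-feasible : ∀ {out} → Output out → Feasible out
  output-feasible (ss , J , refl) = length-output J , nth-All {λ S → rk S ≡ rk full} (output ss)
    (All.map⁺ (All.map (λ {s} (g , b) → repair-spanning g b (proj₂ s)) (slot-polytopes J))) (length-output J)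

  outcome : ∀ {p s out} → (p , s , out) ∈ₗ run rounding → s ℕ.≤ 700 ℕ.* B ℕ.^ 4 × Output out
  outcome o∈ = proj₂ (All.lookup (Spec.outcomes spec-rounding) o∈)

  lpValue : Carrier
  lpValue = sum (share a rows)

  lpValue-nonNeg : 0# ≤ lpValue
  lpValue-nonNeg = sum-nonNeg λ e → subst (0# ≤_) (sym (share≡ rows e)) (sumL-nonNeg (all-good good) (λ g → lpTerm-nonNeg g e))

  finiteCost : List (List (Fin n)) → Carrier
  finiteCost out = sum λ t → sumOver (finitePart ∘ c t) (solution out t) + sumOver a (solution out t ─ previous ∅ (solution out) t)

  -- Stated for any preceding set `P`, because removing the first slot turns its set into the
  -- preceding one.
  listCost≡sum : ∀ {T} (R : Fin T → Row) P ss → rowsOf ss ≡ List.tabulate R →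
    sum (λ t → sumOver (cAt (R t)) (nth (List.map proj₂ ss) t)
             + sumOver a (nth (List.map proj₂ ss) t ─ previous P (nth (List.map proj₂ ss)) t)) ≡ listCost P ss
  listCost≡sum {zero}  R P []               eq = refl
  listCost≡sum {suc T} R P ((row , S) ∷ ss) eq with List.∷-injective eq
  ... | refl , eq′ = cong (costAt row P (setOf S) +_) (trans
      (sum-cong λ t → cong (λ X → sumOver (cAt (R (suc t))) (nth (List.map proj₂ ss) t) + sumOver a (nth (List.map proj₂ ss) t ─ X))
        (previous-suc P (nth (S ∷ List.map proj₂ ss)) t))
      (listCost≡sum (R ∘ suc) (setOf S) ss eq′))

  finiteCost≡ : ∀ {ss} → Inv rows K ss → finiteCost (output ss) ≡ listCost ∅ (repaired ss)
  finiteCost≡ {ss} J = trans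
    (sum-cong λ t → cong₂ _+_
      (trans (sum-cong λ e → cong₂ (λ x S → if Vec.lookup S e then x else 0#) (sym (cAt≡ t e)) (cong (λ out → nth out t) outputs)) refl)
      (cong (λ out → sumOver a (nth out t ─ previous ∅ (nth out) t)) outputs))
    (listCost≡sum rowAt ∅ (repaired ss) (trans (sym (List.map-∘ ss)) (same-rows J)))
    where
    outputs : output ss ≡ List.map proj₂ (repaired ss)
    outputs = List.map-∘ ss

  -- Each round costs at most `lpValue` in expectation. The repairs cost at most `lpValue` times the
  -- deficit summed over all time steps, whose expectation is at most 1; this is the extra 1 in the
  -- factor.
  Ex-finiteCost : Ex finiteCost (run rounding) ≤ fromℕ (suc (length u)) * lpValue
  Ex-finiteCost = begin
      Ex finiteCost (run rounding)
        ≡⟨ Ex-rounding finiteCost ⟩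
      Ex (finiteCost ∘ output) (sampling u initialSlots)
        ≤⟨ Ex-mono (spec-sampling u start-inv) pointwise ⟩
      Ex (λ ss → slotsCost a ss + lpValue * totalDeficit ss) (sampling u initialSlots)
        ≡⟨ trans (Ex-+ (slotsCost a) (λ ss → lpValue * totalDeficit ss) (sampling u initialSlots))
             (cong (Ex (slotsCost a) (sampling u initialSlots) +_) (Ex-* lpValue totalDeficit (sampling u initialSlots))) ⟩
      Ex (slotsCost a) (sampling u initialSlots) + lpValue * Ex totalDeficit (sampling u initialSlots)
        ≤⟨ +-mono-≤ (Ex-sampling-cost a a-nonNeg (zHead≤yHead B N≤B feasible) u start-inv) (*-monoˡ-≤ lpValue-nonNeg deficit≤1) ⟩
      (slotsCost a initialSlots + fromℕ (length u) * sumL (share a rows ∘ proj₁) priced) + lpValue * 1#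
        ≤⟨ +-mono-≤ (+-mono-≤ (slotsCost-empty rows) (≤-reflexive (cong (fromℕ (length u) *_) (share-sum rows)))) (≤-reflexive (trans (*-identityʳ lpValue) (sym (*-identityˡ lpValue)))) ⟩
      (0# + fromℕ (length u) * lpValue) + 1# * lpValue
        ≡⟨ trans (cong (_+ 1# * lpValue) (+-identityˡ _)) (trans (+-comm _ _) (sym (distribʳ lpValue 1# _))) ⟩
      fromℕ (suc (length u)) * lpValue ∎
    where
    open ≤-Reasoning
    pointwise : ∀ {ss} → Inv rows K ss → finiteCost (output ss) ≤ slotsCost a ss + lpValue * totalDeficit ss
    pointwise {ss} J = ≤-trans (≤-reflexive (finiteCost≡ J)) (≤-trans
      (listCost-repaired ss (subst (All _) (sym (same-rows J))
        (All.zipWith (λ ((g , b) , V≤) → g , b , V≤) (good-polytopes , budget≤share good (zHead≤yHead B N≤B feasible)))) id)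
      (+-monoˡ-≤ _ (listCost≤slotsCost ss)))
    E = Ex totalDeficit (sampling u initialSlots)
    0≤E : 0# ≤ E
    0≤E = ≤-trans (≤-reflexive (sym (Ex-const (spec-sampling u start-inv) 0#)))
      (Ex-mono (spec-sampling u start-inv) (λ {ss} _ → sumL-nonNeg (All.universal (λ _ → tt) ss) (λ {s} _ → deficit-nonNeg (proj₂ s))))
    rT≢0 : ∀ m → 2 ℕ.≤ m → fromℕ m ≢ 0#
    rT≢0 (suc m) _ = fromℕ-suc≢0 m
    deficit≤1 : E ≤ 1#
    -- The initial deficits sum to at most rT, and the rounds divide this by 2 ^ L, which is at
    -- least rT.
    deficit≤1 = *-cancelˡ-≤ (fromℕ-nonNeg (r ℕ.* T)) (rT≢0 (r ℕ.* T) 2≤rT) (begin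
      fromℕ (r ℕ.* T) * E             ≤⟨ *-monoʳ-≤ 0≤E (fromℕ-mono rT≤2^u) ⟩
      fromℕ (2 ℕ.^ length u) * E      ≤⟨ Ex-deficit (All.map (λ (g , b) → deficit≤missing g b) good-polytopes) u start-inv ⟩
      totalDeficit initialSlots              ≤⟨ totalDeficit-empty rows ⟩
      fromℕ (length rows ℕ.* r)       ≡⟨ cong fromℕ (trans (cong (ℕ._* r) length-rows) (ℕ.*-comm T r)) ⟩
      fromℕ (r ℕ.* T)                 ≡⟨ sym (*-identityʳ _) ⟩
      fromℕ (r ℕ.* T) * 1#            ∎)

  -- Sampling and repair both skip elements of mass zero. This is what keeps the cost of every
  -- outcome finite when the linear program is finite.
  output-supported : ∀ {ss} → Inv rows K ss → ∀ t {e} → e ∈ nth (output ss) t → ¬ z t e ≤ 0#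
  output-supported {ss} J t {e} e∈ z≤0 = go rowAt ss (same-rows J) (good-slots J) t e∈ (≤-trans (≤-reflexive (zAt≡ t e)) z≤0)
    where
    go : ∀ {T} (R : Fin T → Row) ss → rowsOf ss ≡ List.tabulate R → All (GoodSlot K) ss →
         ∀ t → e ∈ nth (output ss) t → ¬ zAt (R t) e ≤ 0#
    go {suc T} R ((row , S) ∷ ss) eq (g ∷ gs) t e∈ with List.∷-injective eq
    go {suc T} R ((row , S) ∷ ss) eq (g ∷ gs) zero    e∈ | refl , _ =
      All.lookup (augmentAll-supported row (budget priced row) S priced (GoodSlot.supported g)) (∈-setOf⁻ e∈)
    go {suc T} R ((row , S) ∷ ss) eq (g ∷ gs) (suc t) e∈ | _ , eq′ = go (R ∘ suc) ss eq′ gs t e∈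

  expectation-finite : ∀ {A : Set} {m : Run A} {b} {Q : A → Set} (f : A → Carrier⁺) (g : A → Carrier) → Spec m b Q →
    (∀ {v} → Q v → f v ≡ [ g v ]) → expectation f m ≡ [ Ex g m ]
  expectation-finite f g S eq = go {f = f} {g} {eq} (Spec.outcomes S)
    where
    go : ∀ {A : Set} {m : Run A} {b} {Q : A → Set} {f : A → Carrier⁺} {g : A → Carrier} {eq : ∀ {v} → Q v → f v ≡ [ g v ]} →
      All (λ (p , s , v) → 0# ≤ p × s ℕ.≤ b × Q v) m → expectation f m ≡ [ Ex g m ]
    go [] = refl
    go {m = (p , _ , v) ∷ _} {f = f} {g} {eq} ((_ , _ , q) ∷ o) = cong₂ (λ x y → (p ·⁺ x) +⁺ y) (eq q) (go {f = f} {g} {eq} o)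

  lpTerm-sum : sum (λ t → sum λ e → a e * y t e) + sum (λ t → sum λ e → z t e * finitePart (c t e)) ≡ lpValue
  lpTerm-sum = begin
    sum (λ t → sum λ e → a e * y t e) + sum (λ t → sum λ e → z t e * finitePart (c t e))
      ≡⟨ sym (sum-+ (λ t → sum λ e → a e * y t e) (λ t → sum λ e → z t e * finitePart (c t e))) ⟩
    sum (λ t → (sum λ e → a e * y t e) + (sum λ e → z t e * finitePart (c t e)))
      ≡⟨ sum-cong (λ t → trans (sym (sum-+ (λ e → a e * y t e) (λ e → z t e * finitePart (c t e)))) (sum-cong λ e → sym (term t e))) ⟩
    sum (λ t → sum λ e → lpTerm (rowAt t) e)
      ≡⟨ sum-swap (λ t e → lpTerm (rowAt t) e) ⟩
    sum (λ e → sum λ t → lpTerm (rowAt t) e)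
      ≡⟨ sum-cong (λ e → sym (trans (share≡ rows e) (sumL-tabulate (λ row → lpTerm row e) rowAt))) ⟩
    lpValue ∎
    where
    open ≡-Reasoning
    term : ∀ t e → lpTerm (rowAt t) e ≡ a e * y t e + z t e * finitePart (c t e)
    term t e = cong₂ _+_ (cong (a e *_) (yAt≡ B N≤B feasible t e)) (trans (cong₂ _*_ (cAt≡ t e) (zAt≡ t e)) (*-comm _ _))

  expected-cost-bound : expectedCost rounding ≤ 4 ·log₂ (r ℕ.* T) · lpCost I y z
  expected-cost-bound p q 1≤q Nq≤2p with rounds-bound (r ℕ.* T) L₁ L₂ r T p q refl 2≤rT Nq≤2p L₁-lower L₂-lower
  ... | budgeted , q≤p with lpCost I y z in eq
  -- Since 0 · ∞ = 0, the factor 4p has to be nonzero; it is, because p ≥ q ≥ 1.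
  ...   | ⊤⁺ = infinite (ℕ.*-mono-≤ {1} {4} (s≤s z≤n) (ℕ.≤-trans 1≤q q≤p))
    where
    infinite : ∀ {k x} → 1 ℕ.≤ k → x ≤⁺ fromℕ k ·⁺ ⊤⁺
    infinite {suc k} {x} _ with fromℕ (suc k) ≟ 0#
    ... | yes k≡0 = contradiction k≡0 (fromℕ-suc≢0 k)
    ... | no _ = x Supremum.≤⊤⁺
  ...   | [ Y ] = subst (λ X → fromℕ q ·⁺ X ≤⁺ [ fromℕ (4 ℕ.* p) * Y ])
      (sym (expectation-finite (cost I ∘ solution) finiteCost spec-rounding cost-finite)) Supremum.[ bounded ]
    where
    open ≤-Reasoning
    -- A finite sum has finite terms, so an infinite cost forces its mass to be zero, and replacing
    -- that cost by 0 leaves the value of the linear program unchanged.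
    finite-terms : ∀ t e → z t e ·⁺ c t e ≡ [ z t e * finitePart (c t e) ] × (c t e ≡ ⊤⁺ → z t e ≡ 0#)
    finite-terms t e = ·⁺-finite (z t e) (c t e) (proj₂ (sum⁺-finite (λ e → z t e ·⁺ c t e)
      (proj₂ (sum⁺-finite (λ t → sum⁺ λ e → z t e ·⁺ c t e) (proj₂ (proj₂ (+⁺-finite [ _ ] _ eq))) t)) e))
    Y≡ : Y ≡ lpValue
    Y≡ = trans ([]-injective (trans (sym eq) (cong ([ _ ] +⁺_) (sum⁺-[] λ t → sum⁺-[] λ e → proj₁ (finite-terms t e))))) lpTerm-sum
    cost-finite : ∀ {out} → Output out → cost I (solution out) ≡ [ finiteCost out ]
    cost-finite (ss , J , refl) = sum⁺-[] λ t → cong (_+⁺ [ sumOver a (solution (output ss) t ─ previous ∅ (solution (output ss)) t) ]) (sumOver⁺-[] (c t) (solution (output ss) t)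
      (λ {e} e∈ c≡⊤ → output-supported J t e∈ (≤-reflexive (proj₂ (finite-terms t e) c≡⊤))))
    bounded : fromℕ q * Ex finiteCost (run rounding) ≤ fromℕ (4 ℕ.* p) * Y
    bounded = begin
      fromℕ q * Ex finiteCost (run rounding)          ≤⟨ *-monoˡ-≤ (fromℕ-nonNeg q) Ex-finiteCost ⟩
      fromℕ q * (fromℕ (suc (length u)) * lpValue)    ≡⟨ sym (*-assoc _ _ _) ⟩
      fromℕ q * fromℕ (suc (length u)) * lpValue      ≡⟨ cong (_* lpValue) (sym (fromℕ-* q _)) ⟩
      fromℕ (q ℕ.* suc (length u)) * lpValue          ≤⟨ *-monoʳ-≤ lpValue-nonNeg (fromℕ-mono (subst (λ k → q ℕ.* suc k ℕ.≤ 4 ℕ.* p) (sym length-u) budgeted)) ⟩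
      fromℕ (4 ℕ.* p) * lpValue                       ≡⟨ cong (fromℕ (4 ℕ.* p) *_) (sym Y≡) ⟩
      fromℕ (4 ℕ.* p) * Y                             ∎

open import Data.Nat.Base using (_*_; _^_; _≤_)

theorem3p2 : Σ[ C ∈ ℕ ] Σ[ A ∈ Procedure ] Σ[ k ∈ ℕ ] Σ[ d ∈ ℕ ]
    ((F : OrderedField) (H : Height F) (n T : ℕ) →
    let open OrderedField F using (Carrier)
        open Extended F using (_≤_·log₂_·_)
        open Problem F
    in (I : Instance n T) (y z : Fin T → Fin n → Carrier) →
    let r = rank (Instance.matroid I) full
        open Rounding H I y z
    in LPFeasible I y z →
    2 ≤ r * T →
    AlwaysFeasible A
    × AlwaysWithin (k * inputSize ^ d) A
    × (expectedCost A ≤ C ·log₂ (r * T) · lpCost I y z))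
theorem3p2 = 4 , rounding , 700 ℕ.* 16 , 8 , λ F H n T I y z feasible 2≤rT →
  let N = Rounding.inputSize H I y z
      B = N ℕ.* N ℕ.+ N
      open Correctness H I y z feasible 2≤rT B ℕ.≤-refl
  in (λ p s out o∈ _ → output-feasible (proj₂ (outcome o∈)))
   , (λ p s out o∈ _ → ℕ.≤-trans (proj₁ (outcome o∈)) (quartic N (s≤s z≤n)))
   , expected-cost-bound
  where
  -- The running time is 700 B ^ 4 with B = N² + N ≤ 2N²; this is the origin of the factor 16 and
  -- the degree 8.
  quartic : ∀ N → 1 ℕ.≤ N → 700 ℕ.* (N ℕ.* N ℕ.+ N) ℕ.^ 4 ℕ.≤ 700 ℕ.* 16 ℕ.* N ℕ.^ 8
  quartic N 1≤N = ℕ.≤-trans (ℕ.*-monoʳ-≤ 700 (ℕ.^-monoˡ-≤ 4 doubled)) (ℕ.≤-reflexive (expand 700 N))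
    where
    doubled : N ℕ.* N ℕ.+ N ℕ.≤ 2 ℕ.* (N ℕ.* N)
    doubled = ℕ.+-monoʳ-≤ (N ℕ.* N) (ℕ.≤-trans (ℕ.≤-trans (ℕ.≤-reflexive (sym (ℕ.*-identityʳ N))) (ℕ.*-monoʳ-≤ N 1≤N)) (ℕ.m≤m+n (N ℕ.* N) 0))
    expand : ∀ k N → k ℕ.* (2 ℕ.* (N ℕ.* N) ℕ.* (2 ℕ.* (N ℕ.* N) ℕ.* (2 ℕ.* (N ℕ.* N) ℕ.* (2 ℕ.* (N ℕ.* N) ℕ.* 1))))
      ≡ k ℕ.* 16 ℕ.* (N ℕ.* (N ℕ.* (N ℕ.* (N ℕ.* (N ℕ.* (N ℕ.* (N ℕ.* (N ℕ.* 1))))))))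
    expand = solve-∀
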